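{- Let $C,k,t\in\mathbb{Z}^+$ and let $0<\alpha<1$. There is a distributed algorithm (in the LOCAL model) which, given a $K_t$-minor-free graph $G=(V,E)$ that is $(C,\gamma_k)$-bounded, finds in $O(\log^*|V|)$ rounds a distance-$k$ dominating set $D\subseteq V(G)$ such that $|D|\le(1+\alpha)\gamma_k(G)$. (Here $C,k,t,\alpha$ are fixed and known to the algorithm, so the constant hidden in $O(\cdot)$ may depend on them but not on $G$.)
   Context: Graphs are finite and simple. A graph $G$ is $K_t$-minor-free if the complete graph $K_t$ cannot be obtained from a subgraph of $G$ by a sequence of edge contractions (discarding loops and parallel edges). A set $D\subseteq V(G)$ is a distance-$k$ dominating set if every vertex of $G$ is within distance at most $k$ of some vertex of $D$; $\gamma_k(G)$ is the minimum size of such a set, so $\gamma_1(G)$ is the usual domination number. A graph $G$ is $(C,\gamma_k)$-bounded if $\gamma_1(G)\le C\,\gamma_k(G)$. $\log^*$ is the iterated logarithm. LOCAL model (standard deterministic LOCAL model): vertices of $G$ are computational units with unique identifiers; computation proceeds in synchronized rounds, and in each round every vertex can send messages to and receive messages from its neighbors (of unbounded size) and perform arbitrary individual computations. -}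

module Defs where

open import Data.Bool using (Bool)
open import Data.Fin using (Fin; punchOut; _≟_)
open import Data.Fin.Properties using (any?; all?)
open import Data.Fin.Subset using (Subset; _∈_; ∣_∣; ⊤)
open import Data.Fin.Subset.Properties using (_∈?_; ∈⊤; ∣⊤∣≡n; anySubset?)
open import Data.Integer using (+_)
open import Data.Maybe using (Maybe; just; nothing)
open import Data.Nat as ℕ using (ℕ; zero; suc; _*_; _≤_; z≤n; s≤s)
open import Data.Nat.Logarithm using (⌈log₂_⌉)
open import Data.Product using (∃; ∃-syntax; Σ-syntax; _×_; _,_; proj₁)
open import Data.Rational as ℚ using (ℚ; 1ℚ)
open import Data.Sum using (_⊎_)
open import Data.Vec using (lookup)
open import Function using (_∘_)
open import Function.Bundles using (_⇔_; _↔_; _↣_; Inverse; Injection)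
open import Level using (0ℓ)
open import Relation.Binary using (Rel; Decidable; Symmetric; Irreflexive)
open import Relation.Binary.PropositionalEquality using (_≡_; _≢_; refl; sym)
open import Relation.Nullary using (Dec; yes; no; ¬_; ¬?; contradiction; _×-dec_)
open import Relation.Nullary.Decidable using (map′)

record Graph (n : ℕ) : Set₁ where
  field
    Adj        : Rel (Fin n) 0ℓ
    adj?       : Decidable Adj
    adj-sym    : Symmetric Adj
    adj-irrefl : Irreflexive _≡_ Adj

open Graph public

complete : (n : ℕ) → Graph n
complete n = record
  { Adj        = _≢_
  ; adj?       = λ u v → ¬? (u ≟ v)
  ; adj-sym    = λ u≢v → u≢v ∘ sym
  ; adj-irrefl = λ u≡v u≢v → u≢v u≡v
  }

-- H is, up to the names of its vertices, a subgraph of G.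
_IsSubgraphOf_ : ∀ {m n} → Graph m → Graph n → Set
_IsSubgraphOf_ {m} {n} H G =
  Σ[ f ∈ Fin m ↣ Fin n ] (∀ {u v} → Adj H u v → Adj G (Injection.to f u) (Injection.to f v))

_≅_ : ∀ {m n} → Graph m → Graph n → Set
_≅_ {m} {n} G H =
  Σ[ f ∈ Fin m ↔ Fin n ] (∀ {u v} → Adj G u v ⇔ Adj H (Inverse.to f u) (Inverse.to f v))

-- The image of G under a map of vertices, loops and parallel edges discarded.
image : ∀ {m n} → (Fin n → Fin m) → Graph n → Graph m
image π G = record
  { Adj        = λ a b → a ≢ b × (∃[ u ] ∃[ v ] π u ≡ a × π v ≡ b × Adj G u v)
  ; adj?       = λ a b → ¬? (a ≟ b) ×-dec
                   any? λ u → any? λ v → (π u ≟ a) ×-dec (π v ≟ b) ×-dec adj? G u v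
  ; adj-sym    = λ (a≢b , u , v , πu , πv , uv) →
                   a≢b ∘ sym , v , u , πv , πu , adj-sym G uv
  ; adj-irrefl = λ a≡b (a≢b , _) → a≢b a≡b
  }

-- Sends y to the same place as x and is injective on the vertices other than y.
identify : ∀ {n} {x y : Fin (suc n)} → y ≢ x → Fin (suc n) → Fin n
identify {y = y} y≢x u with y ≟ u
... | yes _  = punchOut y≢x
... | no y≢u = punchOut y≢u

contract : ∀ {n} (G : Graph (suc n)) {x y : Fin (suc n)} → Adj G x y → Graph n
contract G e = image (identify λ y≡x → adj-irrefl G (sym y≡x) e) G

data _ContractsTo_ : ∀ {m n} → Graph m → Graph n → Set₁ where
  done : ∀ {m n} {G : Graph m} {H : Graph n} → G ≅ H → G ContractsTo H
  step : ∀ {m n} {G : Graph (suc m)} {H : Graph n} {x y : Fin (suc m)}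
         (e : Adj G x y) → contract G e ContractsTo H → G ContractsTo H

_IsMinorOf_ : ∀ {m n} → Graph m → Graph n → Set₁
H IsMinorOf G = ∃[ l ] Σ[ S ∈ Graph l ] (S IsSubgraphOf G × S ContractsTo H)

CompleteMinorFree : ∀ {n} → ℕ → Graph n → Set₁
CompleteMinorFree t G = ¬ (complete t IsMinorOf G)

module _ {n} (G : Graph n) where

  -- Within k u v: there is a walk of length at most k from u to v.
  data Within : ℕ → Fin n → Fin n → Set where
    here : ∀ {k u} → Within k u u
    step : ∀ {k u v w} → Adj G u w → Within k w v → Within (suc k) u v

  IsDominating : ℕ → Subset n → Set
  IsDominating k D = ∀ v → ∃[ u ] (u ∈ D × Within k v u)

  IsMinimumSize : ℕ → ℕ → Set
  IsMinimumSize k m = (∃[ D ] (IsDominating k D × ∣ D ∣ ≡ m))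
                    × (∀ D → IsDominating k D → m ≤ ∣ D ∣)

  within? : ∀ k u v → Dec (Within k u v)
  within? zero u v = map′ (λ { refl → here }) (λ { here → refl }) (u ≟ v)
  within? (suc k) u v with u ≟ v
  ... | yes refl = yes here
  ... | no u≢v = map′ (λ (w , uw , wv) → step uw wv)
                      (λ { here → contradiction refl u≢v ; (step uw wv) → _ , uw , wv })
                      (any? λ w → adj? G u w ×-dec within? k w v)

  isDominating? : ∀ k D → Dec (IsDominating k D)
  isDominating? k D = all? λ v → any? λ u → (u ∈? D) ×-dec within? k v u

least : ∀ {P : ℕ → Set} → (∀ m → Dec (P m)) → ∀ m → P m →
        ∃[ l ] (P l × (∀ j → P j → l ≤ j))
least P? m p with P? 0
... | yes p₀ = 0 , p₀ , λ _ _ → z≤n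
least P? zero    p | no ¬p₀ = contradiction p ¬p₀
least P? (suc m) p | no ¬p₀ with least (P? ∘ suc) m p
... | l , pl , l-least =
  suc l , pl , λ { zero p₀ → contradiction p₀ ¬p₀ ; (suc j) pj → s≤s (l-least j pj) }

minimumSize : ∀ {n} k (G : Graph n) → ∃ (IsMinimumSize G k)
minimumSize {n} k G
  with least (λ m → anySubset? λ D → isDominating? G k D ×-dec (∣ D ∣ ℕ.≟ m))
             n (⊤ , (λ v → v , ∈⊤ , here) , ∣⊤∣≡n n)
... | m , attained , m-least = m , attained , λ D dom → m-least ∣ D ∣ (D , dom , refl)

γ : ∀ {n} → ℕ → Graph n → ℕ
γ k G = proj₁ (minimumSize k G)

DominationBounded : ∀ {n} → ℕ → ℕ → Graph n → Set
DominationBounded C k G = γ 1 G ≤ C * γ k G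

-- A deterministic algorithm, run by every vertex, for networks with identifiers
-- from Fin N. A vertex initially knows N and its own identifier. In a round it
-- sends `send s j` to its neighbour with identifier j, if there is one, and
-- receives a message from each neighbour, labelled by the sender's identifier.
-- A vertex halts, with its final output, once `output` of its state is a `just`.
record Algorithm (Out : Set) (N : ℕ) : Set₁ where
  field
    State   : Set
    Message : Set
    init    : Fin N → State
    send    : State → Fin N → Message
    receive : State → (Fin N → Maybe Message) → State
    output  : State → Maybe Out

module _ {Out : Set} {N n : ℕ} (A : Algorithm Out N) (G : Graph n) (ident : Fin n ↣ Fin N) where
  open Algorithm A
  open Injection ident using () renaming (to to idOf)

  inbox : (Fin n → State) → Fin n → Fin N → Maybe Message
  inbox s v j with any? (λ u → adj? G v u ×-dec (idOf u ≟ j))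
  ... | yes (u , _) = just (send (s u) (idOf v))
  ... | no _        = nothing

  stateAfter : ℕ → Fin n → State
  stateAfter zero    v = init (idOf v)
  stateAfter (suc r) v with output (stateAfter r v)
  ... | just _  = stateAfter r v
  ... | nothing = receive (stateAfter r v) (inbox (stateAfter r) v)

  outputAfter : ℕ → Fin n → Maybe Out
  outputAfter r v = output (stateAfter r v)

-- After r rounds every vertex has halted and knows whether it belongs to D.
FindsInRounds : ∀ {N n} → Subset n → ℕ → Algorithm Bool N → Graph n → Fin n ↣ Fin N → Set
FindsInRounds D r A G ident = ∀ v → outputAfter A G ident r v ≡ just (lookup D v)

-- The number of times log₂ has to be applied to n to reach a value at most 1.
-- Rounding up does not change it: for an integer m, x ≤ m iff ⌈x⌉ ≤ m, and the
-- thresholds 1, 2, 4, 16, … at which the count changes are integers. The first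
-- argument is fuel; n suffices because ⌈log₂ n⌉ < n for n > 1.
log*-fuel : ℕ → ℕ → ℕ
log*-fuel zero    n               = 0
log*-fuel (suc f) zero            = 0
log*-fuel (suc f) (suc zero)      = 0
log*-fuel (suc f) n@(suc (suc _)) = suc (log*-fuel f ⌈log₂ n ⌉)

log* : ℕ → ℕ
log* n = log*-fuel n n

_∈O_ : (ℕ → ℕ) → (ℕ → ℕ) → Set
f ∈O g = ∃[ K ] ∃[ n₀ ] (∀ n → n₀ ≤ n → f n ≤ K * g n)

-- Real numbers as two-sided Dedekind cuts: lower q means q < α, upper q means α < q.
record ℝ : Set₁ where
  field
    lower upper     : ℚ → Set
    lower-inhabited : ∃ lower
    upper-inhabited : ∃ upper
    lower-rounded   : ∀ q → lower q ⇔ (∃[ r ] (q ℚ.< r × lower r))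
    upper-rounded   : ∀ q → upper q ⇔ (∃[ r ] (r ℚ.< q × upper r))
    disjoint        : ∀ q → ¬ (lower q × upper q)
    located         : ∀ {q r} → q ℚ.< r → lower q ⊎ upper r

open ℝ public

_<ᴿ_ : ℚ → ℝ → Set
q <ᴿ α = lower α q

_ᴿ<_ : ℝ → ℚ → Set
α ᴿ< q = upper α q

ℕ→ℚ : ℕ → ℚ
ℕ→ℚ m = + m ℚ./ 1

-- a ≤ (1 + α) b for a real α: equivalently a ≤ (1 + q) b for all rationals q > α.
_≤[1+_]_ : ℕ → ℝ → ℕ → Set
a ≤[1+ α ] b = ∀ q → α ᴿ< q → ℕ→ℚ a ℚ.≤ (1ℚ ℚ.+ q) ℚ.* ℕ→ℚ b

-- Let S be uncovered if its common neighbours cannot be dominated by 2d vertices outside of S,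
-- where d bounds the edge density of the minors of G (Mader). If M is a dominating set, then
-- collapsing the other vertices onto M shows that at most |M| vertices lie in uncovered sets
-- avoiding M, while every vertex that is not uncovered by itself lies in boundedly many minimal
-- uncovered sets. Hence the vertices in minimal uncovered sets, together with everything that
-- they do not dominate, form a dominating set of size O(|M|), recognisable from a ball of
-- constant radius.
--
-- Contracting stars around these centres leaves O(γ₁) = O(γ_k) edges. Every contracted vertex
-- points along its heaviest edge; after colouring this pseudoforest in log* rounds, a derandomised
-- choice of stars contains a constant fraction of the weight. So a constant number of rounds of
-- contraction gives clusters of bounded radius with at most α γ_k edges between them, and taking
-- optimal distance-k dominating sets cluster by cluster costs at most one extra vertex per end of
-- such an edge: the centre next to the point where a shortest path leaves the cluster.

module Submission where

open import Data.Bool as Bool using (Bool; true; false; if_then_else_; _∧_; not)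
open import Data.Fin as Fin using (Fin; zero; suc; toℕ; punchIn; punchOut)
open import Data.Fin.Properties as Finₚ
  using (any?; all?; toℕ<n; toℕ-injective; punchIn-punchOut; punchOut-punchIn; punchInᵢ≢i; punchIn-injective)
open import Data.Fin.Subset as Subset using (Subset; _∈_; _∉_; _⊆_; _⊂_; ∣_∣; ⁅_⁆; _∪_; Nonempty; inside; outside)
open import Data.Fin.Subset.Properties
  using (_∈?_; anySubset?; nonempty?; _⊂?_; p⊂q⇒∣p∣<∣q∣; x∈⁅x⁆; x∈⁅y⁆⇒x≡y; ∣⁅x⁆∣≡1; p⊆p∪q; q⊆p∪q; x∈p∪q⁻;
         ⊆-antisym; ∉⊥; ∣⊥∣≡0)
open import Data.Integer as ℤ using (+[1+_]; -[1+_]; +<+) renaming (+_ to pos)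
open import Data.Integer.Properties using (pos-*)
open import Data.List as List using (List; []; _∷_; length; concatMap)
open import Data.List.Membership.DecPropositional as Dec∈ using ()
open import Data.List.Membership.Propositional as List∈ using ()
open import Data.List.Membership.Propositional.Properties using (∈-map⁺; ∈-++⁺ˡ; ∈-++⁺ʳ)
open import Data.List.Properties using (length-map; length-++)
open import Data.List.Relation.Unary.Any using (here; there)
open import Data.Maybe as Maybe using (Maybe; just; nothing; fromMaybe; is-just; maybe′)
open import Data.Maybe.Properties using (just-injective)
open import Data.Nat
open import Data.Nat.Induction using (<-rec)
open import Data.Nat.Logarithm using (⌈log₂_⌉; ⌈log₂⌉-mono-≤; ⌈log₂⌈n/2⌉⌉≡⌈log₂n⌉∸1; ⌈log₂2^n⌉≡n)
open import Data.Nat.Properties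
open import Data.Nat.Solver using (module +-*-Solver)
open import Data.Product
open import Data.Rational as ℚ using (ℚ; mkℚ; 0ℚ; 1ℚ; toℚᵘ; ↧ₙ_)
open import Data.Rational.Properties as ℚₚ using (toℚᵘ-cancel-≤; toℚᵘ-fromℚᵘ; toℚᵘ-homo-+; toℚᵘ-homo-*)
open import Data.Rational.Unnormalised as ℚᵘ using (mkℚᵘ; 1ℚᵘ)
import Data.Rational.Unnormalised.Properties as ℚᵘₚ
open import Data.Sum using (_⊎_; inj₁; inj₂)
open import Data.Unit using (⊤; tt)
open import Data.Vec as Vec using (Vec; []; _∷_; here; there; tabulate; lookup)
open import Data.Vec.Properties using (lookup⇒[]=; []=⇒lookup; lookup∘tabulate; lookup-map; tabulate-cong; tabulate-∘)
open import Function using (_∘_; id; case_of_)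
open import Function.Bundles using (_↣_; Injection; Equivalence; mk↣; mk↔ₛ′; mk⇔)
open import Function.Construct.Composition using (_↣-∘_)
open import Function.Construct.Identity using (↣-id)
open import Level using (0ℓ)
open import Relation.Binary as B using (Rel; tri<; tri≈; tri>)
open import Relation.Binary.PropositionalEquality hiding ([_])
open import Relation.Nullary
open import Relation.Nullary.Decidable using (dec-true; dec-false; does-⇔)
open import Relation.Unary using (Pred; Decidable)
open import Defs

open +-*-Solver using (solve; _:+_; _:*_; _:=_; con)

-- Finite sums and cardinalities

-- Minors are not renumbered. A contraction is a map of the vertex set into itself with connected
-- fibres, a deletion a restriction of the adjacency relation, so that `Sparse` bounds all minors
-- needed by one statement about `Fin n`; only the passage to `_IsMinorOf_` builds contraction
-- sequences.
--
-- The obstacle is to separate what is proved about the construction from what a vertex can compute.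
-- The construction is defined globally, and `Computes r f` then exhibits a function of the view of
-- depth `r`, fixed before the network is, that agrees with it. All choices (a centre next to a
-- vertex, a heaviest edge, a smallest set) are therefore functions of finite tables, so that a
-- vertex which has rebuilt a table makes the same choice. The number of contraction rounds depends
-- only on `d`, `C` and a positive rational below `α`, so colour reduction is the only part whose
-- cost grows with `N`.

𝟙 : ∀ {P : Set} → Dec P → ℕ
𝟙 P? = if does P? then 1 else 0

𝟙-true : ∀ {P : Set} (P? : Dec P) → P → 𝟙 P? ≡ 1
𝟙-true P? p rewrite dec-true P? p = refl

𝟙-false : ∀ {P : Set} (P? : Dec P) → ¬ P → 𝟙 P? ≡ 0
𝟙-false P? ¬p rewrite dec-false P? ¬p = refl

𝟙≤1 : ∀ {P : Set} (P? : Dec P) → 𝟙 P? ≤ 1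
𝟙≤1 (yes _) = ≤-refl
𝟙≤1 (no _)  = z≤n

𝟙-positive : ∀ {P : Set} (P? : Dec P) → 0 < 𝟙 P? → P
𝟙-positive (yes p) _ = p

𝟙-mono : ∀ {P Q : Set} (P? : Dec P) (Q? : Dec Q) → (P → Q) → 𝟙 P? ≤ 𝟙 Q?
𝟙-mono (yes p) Q? f = ≤-reflexive (sym (𝟙-true Q? (f p)))
𝟙-mono (no _)  Q? f = z≤n

𝟙-⇔ : ∀ {P Q : Set} (P? : Dec P) (Q? : Dec Q) → (P → Q) → (Q → P) → 𝟙 P? ≡ 𝟙 Q?
𝟙-⇔ P? Q? f g = ≤-antisym (𝟙-mono P? Q? f) (𝟙-mono Q? P? g)

𝟙-× : ∀ {P Q : Set} (P? : Dec P) (Q? : Dec Q) → 𝟙 (P? ×-dec Q?) ≡ 𝟙 P? * 𝟙 Q?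
𝟙-× (yes _) (yes _) = refl
𝟙-× (yes _) (no _)  = refl
𝟙-× (no _)  _       = refl

𝟙-bound : ∀ {P : Set} (P? : Dec P) {m} → (P → 1 ≤ m) → 𝟙 P? ≤ m
𝟙-bound (yes p) f = f p
𝟙-bound (no _)  _ = z≤n

opaque
  ∑ : ∀ {n} → (Fin n → ℕ) → ℕ
  ∑ {zero}  f = 0
  ∑ {suc n} f = f zero + ∑ (f ∘ suc)

  ∑-cong : ∀ {n} {f g : Fin n → ℕ} → (∀ i → f i ≡ g i) → ∑ f ≡ ∑ g
  ∑-cong {zero}  f≡g = refl
  ∑-cong {suc n} f≡g = cong₂ _+_ (f≡g zero) (∑-cong (f≡g ∘ suc))

  ∑-mono : ∀ {n} {f g : Fin n → ℕ} → (∀ i → f i ≤ g i) → ∑ f ≤ ∑ g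
  ∑-mono {zero}  f≤g = z≤n
  ∑-mono {suc n} f≤g = +-mono-≤ (f≤g zero) (∑-mono (f≤g ∘ suc))

  ∑-+ : ∀ {n} (f g : Fin n → ℕ) → ∑ (λ i → f i + g i) ≡ ∑ f + ∑ g
  ∑-+ {zero}  f g = refl
  ∑-+ {suc n} f g rewrite ∑-+ (f ∘ suc) (g ∘ suc) =
    solve 4 (λ a b c d → a :+ b :+ (c :+ d) := a :+ c :+ (b :+ d)) refl
      (f zero) (g zero) (∑ (f ∘ suc)) (∑ (g ∘ suc))

  *-∑ : ∀ {n} c (f : Fin n → ℕ) → c * ∑ f ≡ ∑ (λ i → c * f i)
  *-∑ {zero}  c f = *-zeroʳ c
  *-∑ {suc n} c f = trans (*-distribˡ-+ c (f zero) _) (cong (c * f zero +_) (*-∑ c (f ∘ suc)))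

  ∑-zero : ∀ {n} (f : Fin n → ℕ) → (∀ i → f i ≡ 0) → ∑ f ≡ 0
  ∑-zero {zero}  f f≡0 = refl
  ∑-zero {suc n} f f≡0 = cong₂ _+_ (f≡0 zero) (∑-zero (f ∘ suc) (f≡0 ∘ suc))

  ∑-swap : ∀ {m n} (f : Fin m → Fin n → ℕ) → ∑ (λ i → ∑ (f i)) ≡ ∑ (λ j → ∑ λ i → f i j)
  ∑-swap {zero} {n} f = sym (∑-zero {n} (λ _ → 0) λ _ → refl)
  ∑-swap {suc m} f = trans (cong (∑ (f zero) +_) (∑-swap (f ∘ suc))) (sym (∑-+ (f zero) _))

  term≤∑ : ∀ {n} (f : Fin n → ℕ) i → f i ≤ ∑ f
  term≤∑ {suc n} f zero    = m≤m+n _ _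
  term≤∑ {suc n} f (suc i) = ≤-trans (term≤∑ (f ∘ suc) i) (m≤n+m _ _)

  ∑-positive : ∀ {n} (f : Fin n → ℕ) → 0 < ∑ f → ∃ λ i → 0 < f i
  ∑-positive {suc n} f 0<Σ with f zero in eq
  ... | suc _ = zero , subst (0 <_) (sym eq) z<s
  ... | zero  = map suc id (∑-positive (f ∘ suc) 0<Σ)

  ∑-single : ∀ {n} (a : Fin n) (g : Fin n → ℕ) → ∑ (λ x → 𝟙 (x Fin.≟ a) * g x) ≡ g a
  ∑-single zero    g =
    trans (cong₂ _+_ (*-identityˡ (g zero)) (∑-zero (λ x → 𝟙 (suc x Fin.≟ zero) * g (suc x)) λ _ → refl))
          (+-identityʳ (g zero))
  ∑-single (suc a) g = ∑-single a (g ∘ suc)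

  ∑-single′ : ∀ {n} (a : Fin n) (g : Fin n → ℕ) → ∑ (λ x → 𝟙 (a Fin.≟ x) * g x) ≡ g a
  ∑-single′ a g =
    trans (∑-cong λ x → cong (_* g x) (𝟙-⇔ (a Fin.≟ x) (x Fin.≟ a) sym sym)) (∑-single a g)

_when_ : ∀ {P : Set} → ℕ → Dec P → ℕ
m when P? = if does P? then m else 0

when≡* : ∀ {P : Set} m (P? : Dec P) → m when P? ≡ 𝟙 P? * m
when≡* m (yes _) = sym (+-identityʳ m)
when≡* m (no _)  = refl

∑-when : ∀ {n} (a : Fin n) (g : Fin n → ℕ) → ∑ (λ x → g x when (x Fin.≟ a)) ≡ g a
∑-when a g = trans (∑-cong λ x → when≡* (g x) (x Fin.≟ a)) (∑-single a g)

# : ∀ {n} {P : Pred (Fin n) 0ℓ} → Decidable P → ℕ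
# P? = ∑ λ x → 𝟙 (P? x)

#-mono : ∀ {n} {P Q : Pred (Fin n) 0ℓ} (P? : Decidable P) (Q? : Decidable Q) →
         (∀ x → P x → Q x) → # P? ≤ # Q?
#-mono P? Q? f = ∑-mono λ x → 𝟙-mono (P? x) (Q? x) (f x)

#-positive : ∀ {n} {P : Pred (Fin n) 0ℓ} (P? : Decidable P) {x} → P x → 1 ≤ # P?
#-positive P? {x} p = ≤-trans (≤-reflexive (sym (𝟙-true (P? x) p))) (term≤∑ (λ y → 𝟙 (P? y)) x)

#-⊎ : ∀ {n} {P Q R : Pred (Fin n) 0ℓ} (P? : Decidable P) (Q? : Decidable Q) (R? : Decidable R) →
      (∀ x → P x → Q x ⊎ R x) → # P? ≤ # Q? + # R?
#-⊎ P? Q? R? f = ≤-trans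
  (∑-mono λ x → 𝟙-bound (P? x) λ p → case f x p of λ where
    (inj₁ q) → ≤-trans (≤-reflexive (sym (𝟙-true (Q? x) q))) (m≤m+n _ _)
    (inj₂ r) → ≤-trans (≤-reflexive (sym (𝟙-true (R? x) r))) (m≤n+m _ _))
  (≤-reflexive (∑-+ _ _))

#-⋃ : ∀ {m n} {P : Pred (Fin n) 0ℓ} {Q : Fin m → Pred (Fin n) 0ℓ}
      (P? : Decidable P) (Q? : ∀ j → Decidable (Q j)) →
      (∀ x → P x → ∃ λ j → Q j x) → # P? ≤ ∑ λ j → # (Q? j)
#-⋃ P? Q? f = ≤-trans
  (∑-mono λ x → 𝟙-bound (P? x) λ p → #-positive (λ j → Q? j x) (proj₂ (f x p)))
  (≤-reflexive (∑-swap _))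

#≤length : ∀ {n} {P : Pred (Fin n) 0ℓ} (P? : Decidable P) (xs : List (Fin n)) →
           (∀ x → P x → x List∈.∈ xs) → # P? ≤ length xs
#≤length P? []       f = ≤-reflexive (∑-zero _ λ x → 𝟙-false (P? x) λ p → case f x p of λ ())
#≤length P? (y ∷ ys) f = ≤-trans
  (#-⊎ P? (λ x → x Fin.≟ y) (λ x → P? x ×-dec ¬? (x Fin.≟ y)) λ x p → case x Fin.≟ y of λ where
    (yes x≡y) → inj₁ x≡y
    (no x≢y)  → inj₂ (p , x≢y))
  (+-mono-≤
    (≤-reflexive (trans (∑-cong λ x → sym (*-identityʳ (𝟙 (x Fin.≟ y)))) (∑-single y λ _ → 1)))
    (#≤length (λ x → P? x ×-dec ¬? (x Fin.≟ y)) ys λ x (p , x≢y) → case f x p of λ where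
      (here x≡y)    → contradiction x≡y x≢y
      (there x∈ys) → x∈ys))

-- Models of complete graphs and minors

data Path {n} (G : Graph n) (P : Pred (Fin n) 0ℓ) : Fin n → Fin n → Set where
  stop : ∀ {u} → P u → Path G P u u
  move : ∀ {u w v} → P u → Adj G u w → Path G P w v → Path G P u v

module _ {n} {G : Graph n} where

  mapPath : ∀ {P Q : Pred (Fin n) 0ℓ} → (∀ {x} → P x → Q x) → ∀ {u v} → Path G P u v → Path G Q u v
  mapPath f (stop p)     = stop (f p)
  mapPath f (move p e π) = move (f p) e (mapPath f π)

  _◅◅_ : ∀ {P : Pred (Fin n) 0ℓ} {u v w} → Path G P u v → Path G P v w → Path G P u w
  stop _      ◅◅ ρ = ρ
  move p e π ◅◅ ρ = move p e (π ◅◅ ρ)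

  start∈ : ∀ {P : Pred (Fin n) 0ℓ} {u v} → Path G P u v → P u
  start∈ (stop p)     = p
  start∈ (move p _ _) = p

  reversePath : ∀ {P : Pred (Fin n) 0ℓ} {u v} → Path G P u v → Path G P v u
  reversePath (stop p)     = stop p
  reversePath (move p e π) = reversePath π ◅◅ move (start∈ π) (adj-sym G e) (stop p)

liftPath : ∀ {m n} {G : Graph m} {H : Graph n} (f : Fin m → Fin n) →
           (∀ {u v} → f u ≡ f v → Path G (λ x → f x ≡ f u) u v) →
           (∀ {x y} → Adj H x y → ∃[ u ] ∃[ v ] f u ≡ x × f v ≡ y × Adj G u v) →
           ∀ {P : Pred (Fin n) 0ℓ} {x y} → Path H P x y →
           ∀ {u v} → f u ≡ x → f v ≡ y → Path G (P ∘ f) u v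
liftPath f fibre edge {P} (stop p) refl fv =
  mapPath (λ fz → subst P (sym fz) p) (fibre (sym fv))
liftPath f fibre edge {P} (move p e π) refl fv with edge e
... | a , b , fa , fb , ab =
  mapPath (λ fz → subst P (sym fz) p) (fibre (sym fa)) ◅◅
  move (subst P (sym fa) p) ab (liftPath f fibre edge π fb fv)

-- A model of K_t in G. Every branch set is asked to contain a vertex of positive
-- degree, which matters for t = 1 only: isolated vertices may stand for unused
-- identifiers.
record CompleteModel {n} (t : ℕ) (G : Graph n) : Set where
  field
    branch    : Fin n → Maybe (Fin t)
    nonempty  : ∀ i → ∃[ u ] ∃[ w ] branch u ≡ just i × Adj G u w
    connected : ∀ {i u v} → branch u ≡ just i → branch v ≡ just i →
                Path G (λ x → branch x ≡ just i) u v
    adjacent  : ∀ {i j} → i ≢ j → ∃[ u ] ∃[ v ] branch u ≡ just i × branch v ≡ just j × Adj G u v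

-- Only the edges of `H` have to come from `G`, so this one statement undoes contractions,
-- restrictions to a vertex set and the renaming of vertices by identifiers.
liftModel : ∀ {m n t} {G : Graph m} {H : Graph n} (f : Fin m → Fin n) →
            (∀ {u v} → f u ≡ f v → Path G (λ x → f x ≡ f u) u v) →
            (∀ {x y} → Adj H x y → ∃[ u ] ∃[ v ] f u ≡ x × f v ≡ y × Adj G u v) →
            CompleteModel t H → CompleteModel t G
liftModel f fibre edge M = record
  { branch    = branch ∘ f
  ; nonempty  = λ i → case nonempty i of λ (x , y , bx , xy) →
                  case edge xy of λ { (u , v , refl , refl , uv) → u , v , bx , uv }
  ; connected = λ bu bv → liftPath f fibre edge (connected bu bv) refl refl
  ; adjacent  = λ i≢j → case adjacent i≢j of λ (x , y , bx , by , xy) →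
                  case edge xy of λ { (u , v , refl , refl , uv) → u , v , bx , by , uv }
  }
  where open CompleteModel M

-- Contraction sequences from models

module _ {n} {y x : Fin (suc n)} (y≢x : y ≢ x) where

  identify-≢ : ∀ {u} (y≢u : y ≢ u) → identify y≢x u ≡ punchOut y≢u
  identify-≢ {u} y≢u with y Fin.≟ u
  ... | yes y≡u = contradiction y≡u y≢u
  ... | no _    = Finₚ.punchOut-cong y refl

  identify-punchIn : ∀ a → identify y≢x (punchIn y a) ≡ a
  identify-punchIn a = trans (identify-≢ (punchInᵢ≢i y a ∘ sym)) (punchOut-punchIn y)

  punchIn-identify : ∀ {A : Set} (π : Fin (suc n) → A) → π x ≡ π y → ∀ u → π (punchIn y (identify y≢x u)) ≡ π u
  punchIn-identify π πx≡πy u with y Fin.≟ u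
  ... | yes refl = trans (cong π (punchIn-punchOut y≢x)) πx≡πy
  ... | no y≢u   = cong π (punchIn-punchOut y≢u)

imagePath : ∀ {m n} {G : Graph m} (f : Fin m → Fin n) {P : Pred (Fin m) 0ℓ} {Q : Pred (Fin n) 0ℓ} →
            (∀ {z} → P z → Q (f z)) → ∀ {u v} → Path G P u v → Path (image f G) Q (f u) (f v)
imagePath f g (stop p) = stop (g p)
imagePath {G = G} f {P} {Q} g {v = v} (move {u} {w} p e π) with f u Fin.≟ f w
... | yes fu≡fw = subst (λ z → Path (image f G) Q z (f v)) (sym fu≡fw) (imagePath f g π)
... | no fu≢fw  = move (g p) (fu≢fw , u , w , refl , refl , e) (imagePath f g π)

-- Induction on the number of vertices: contract an edge inside a fibre as long as there is one.
-- Without such an edge the connected fibres are single vertices, and `π` is an isomorphism.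
contractsToComplete : ∀ {l t} (G : Graph l) (π : Fin l → Fin t) →
  (∀ i → ∃[ u ] π u ≡ i) →
  (∀ {u v} → π u ≡ π v → Path G (λ x → π x ≡ π u) u v) →
  (∀ {i j} → i ≢ j → ∃[ u ] ∃[ v ] π u ≡ i × π v ≡ j × Adj G u v) →
  G ContractsTo complete t
contractsToComplete {l} {t} G π onto conn adj
  with any? (λ x → any? λ y → adj? G x y ×-dec (π x Fin.≟ π y))
... | no ¬e = done (mk↔ₛ′ π (proj₁ ∘ onto) (proj₂ ∘ onto) (λ u → inj (proj₂ (onto (π u)))) , mk⇔ to from)
  where
  inj : ∀ {u v} → π u ≡ π v → u ≡ v
  inj πu≡πv with conn πu≡πv
  ... | stop _     = refl
  ... | move p e ρ = contradiction (_ , _ , e , sym (start∈ ρ)) ¬e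
  to : ∀ {u v} → Adj G u v → π u ≢ π v
  to uv πu≡πv = ¬e (_ , _ , uv , πu≡πv)
  from : ∀ {u v} → π u ≢ π v → Adj G u v
  from πu≢πv with adj πu≢πv
  ... | a , b , πa , πb , ab = subst₂ (Adj G) (inj πa) (inj πb) ab
contractsToComplete {suc l} {t} G π onto conn adj | yes (x , y , xy , πx≡πy) =
  step xy (contractsToComplete (contract G xy) π′ onto′ conn′ adj′)
  where
  y≢x : y ≢ x
  y≢x y≡x = adj-irrefl G (sym y≡x) xy
  f = identify y≢x
  π′ : Fin l → Fin t
  π′ a = π (punchIn y a)
  π′f : ∀ u → π′ (f u) ≡ π u
  π′f = punchIn-identify y≢x π πx≡πy
  onto′ : ∀ i → ∃[ a ] π′ a ≡ i
  onto′ i with onto i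
  ... | u , πu = f u , trans (π′f u) πu
  conn′ : ∀ {a b} → π′ a ≡ π′ b → Path (contract G xy) (λ z → π′ z ≡ π′ a) a b
  conn′ {a} {b} eq = subst₂ (Path (contract G xy) (λ z → π′ z ≡ π′ a)) (identify-punchIn y≢x a) (identify-punchIn y≢x b)
    (imagePath f (λ {z} πz → trans (π′f z) πz) (conn eq))
  adj′ : ∀ {i j} → i ≢ j → ∃[ a ] ∃[ b ] π′ a ≡ i × π′ b ≡ j × Adj (contract G xy) a b
  adj′ i≢j with adj i≢j
  ... | u , v , πu , πv , uv =
    f u , f v , trans (π′f u) πu , trans (π′f v) πv ,
    (λ eq → i≢j (trans (sym πu) (trans (sym (π′f u)) (trans (cong π′ eq) (trans (π′f v) πv))))) ,
    u , v , refl , refl , uv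

deleteVertex : ∀ {n} → Graph (suc n) → Fin (suc n) → Graph n
deleteVertex G x = record
  { Adj        = λ a b → Adj G (punchIn x a) (punchIn x b)
  ; adj?       = λ a b → adj? G (punchIn x a) (punchIn x b)
  ; adj-sym    = adj-sym G
  ; adj-irrefl = λ { refl → adj-irrefl G refl }
  }

deletePath : ∀ {n} {G : Graph (suc n)} x {P : Pred (Fin (suc n)) 0ℓ} → ¬ P x →
             ∀ {u v} → Path G P u v → ∀ {a b} → punchIn x a ≡ u → punchIn x b ≡ v →
             Path (deleteVertex G x) (P ∘ punchIn x) a b
deletePath x ¬px (stop p) {a} refl eq with punchIn-injective x _ _ eq
... | refl = stop p
deletePath {G = G} x {P} ¬px (move {w = w} p e π) refl eq = move p
  (subst (Adj G _) (sym w≡) e) (deletePath x ¬px π w≡ eq)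
  where
  x≢w : x ≢ w
  x≢w refl = ¬px (start∈ π)
  w≡ : punchIn x (punchOut x≢w) ≡ w
  w≡ = punchIn-punchOut x≢w

-- Vertices outside all branch sets are deleted one at a time; no path inside a branch set visits
-- them. Once `β` is total, contraction takes over.
subgraphContractsToComplete : ∀ {n t} (G : Graph n) (β : Fin n → Maybe (Fin t)) →
  (∀ i → ∃[ u ] β u ≡ just i) →
  (∀ {i u v} → β u ≡ just i → β v ≡ just i → Path G (λ x → β x ≡ just i) u v) →
  (∀ {i j} → i ≢ j → ∃[ u ] ∃[ v ] β u ≡ just i × β v ≡ just j × Adj G u v) →
  complete t IsMinorOf G
subgraphContractsToComplete {n} {t} G β onto conn adj with any? (λ x → β x ≟nothing)
  where
  _≟nothing : (m : Maybe (Fin t)) → Dec (m ≡ nothing)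
  just _  ≟nothing = no λ ()
  nothing ≟nothing = yes refl
... | no ¬∃ = n , G , (↣-id _ , id) , contractsToComplete G (λ u → proj₁ (total u))
      (λ i → case onto i of λ (u , βu) → u , just-injective (trans (sym (proj₂ (total u))) βu))
      (λ {u} {v} eq → mapPath (λ {z} βz → just-injective (trans (sym (proj₂ (total z))) βz))
         (conn (proj₂ (total u)) (trans (proj₂ (total v)) (cong just (sym eq)))))
      (λ i≢j → case adj i≢j of λ (u , v , βu , βv , uv) →
         u , v , just-injective (trans (sym (proj₂ (total u))) βu)
               , just-injective (trans (sym (proj₂ (total v))) βv) , uv)
  where
  total : ∀ u → ∃[ i ] β u ≡ just i
  total u with β u in eq
  ... | just i  = i , refl
  ... | nothing = contradiction (u , eq) ¬∃
subgraphContractsToComplete {suc n} {t} G β onto conn adj | yes (x , βx) =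
  case subgraphContractsToComplete (deleteVertex G x) (β ∘ punchIn x) onto′
         (λ bu bv → deletePath x (λ eq → case trans (sym βx) eq of λ ()) (conn bu bv) refl refl) adj′
  of λ (l , S , (f , g) , c) → l , S , (mk↣ (λ {a} {b} → punchIn-injective x a b) ↣-∘ f , λ {a} {b} e → g {a} {b} e) , c
  where
  onto′ : ∀ i → ∃[ a ] β (punchIn x a) ≡ just i
  onto′ i with onto i
  ... | u , βu with x Fin.≟ u
  ...   | yes refl = case trans (sym βx) βu of λ ()
  ...   | no x≢u   = punchOut x≢u , trans (cong β (punchIn-punchOut x≢u)) βu
  adj′ : ∀ {i j} → i ≢ j → ∃[ a ] ∃[ b ] β (punchIn x a) ≡ just i × β (punchIn x b) ≡ just j
                              × Adj (deleteVertex G x) a b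
  adj′ i≢j with adj i≢j
  ... | u , v , βu , βv , uv with x Fin.≟ u | x Fin.≟ v
  ...   | yes refl | _ = case trans (sym βx) βu of λ ()
  ...   | _ | yes refl = case trans (sym βx) βv of λ ()
  ...   | no x≢u | no x≢v =
    punchOut x≢u , punchOut x≢v ,
    trans (cong β (punchIn-punchOut x≢u)) βu , trans (cong β (punchIn-punchOut x≢v)) βv ,
    subst₂ (Adj G) (sym (punchIn-punchOut x≢u)) (sym (punchIn-punchOut x≢v)) uv

modelIsMinor : ∀ {n t} {G : Graph n} → CompleteModel t G → complete t IsMinorOf G
modelIsMinor {G = G} M = subgraphContractsToComplete G branch
  (λ i → case nonempty i of λ (u , _ , bu , _) → u , bu) connected adjacent
  where open CompleteModel M

-- Density of graphs without a complete minor

adj : ∀ {n} → Graph n → Fin n → Fin n → ℕ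
adj G x y = 𝟙 (adj? G x y)

adj-loop : ∀ {n} (G : Graph n) x → adj G x x ≡ 0
adj-loop G x = 𝟙-false (adj? G x x) (adj-irrefl G refl)

adj-comm : ∀ {n} (G : Graph n) x y → adj G x y ≡ adj G y x
adj-comm G x y = 𝟙-⇔ (adj? G x y) (adj? G y x) (adj-sym G) (adj-sym G)

-- Twice the number of edges, so that no density below needs halving.
degreeSum : ∀ {n} → Graph n → ℕ
degreeSum G = ∑ λ x → ∑ λ y → adj G x y

codegree : ∀ {n} → Graph n → Fin n → Fin n → ℕ
codegree G x y = ∑ λ z → adj G x z * adj G y z

-- Merging a and b destroys an edge only if it joins a and b or is parallel to another one.
private
  module Merging {n} (A A′ : Fin n → Fin n → ℕ) (a b : Fin n) (a≢b : a ≢ b)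
    (A≤1 : ∀ x y → A x y ≤ 1) (A-comm : ∀ x y → A x y ≡ A y x) (A-loop : ∀ x → A x x ≡ 0)
    (A′-comm : ∀ x y → A′ x y ≡ A′ y x)
    (kept : ∀ {x y} → x ≢ b → y ≢ b → A x y ≤ A′ x y)
    (moved : ∀ {y} → y ≢ a → y ≢ b → A b y ≤ A′ a y)
    where

    C : Fin n → ℕ
    C z = A a z * A b z

    twice : (Fin n → ℕ) → Fin n → Fin n → Fin n → ℕ
    twice f c x y = (f y when (x Fin.≟ c)) + (f x when (y Fin.≟ c))

    corner : Fin n → Fin n → ℕ
    corner x y = (2 when (x Fin.≟ a)) when (y Fin.≟ a)

    -- On the left, row and column `b` are added onto `a`. On the right they are added at `b`, where
    -- `A′` need not have them. Both additions have the same total and cancel. The entry 2 at the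
    -- corner pays for the edge `ab`, which would become a loop.
    lhs rhs : Fin n → Fin n → ℕ
    lhs x y = A x y + twice (A b) a x y
    rhs x y = A′ x y + ((twice C a x y + twice (A b) b x y) + corner x y)

    or-and : ∀ {p q r} → p ≤ 1 → q ≤ 1 → p ≤ r → q ≤ r → p + q ≤ r + p * q
    or-and {p = zero}                      _ _ _ q≤r = ≤-trans q≤r (m≤m+n _ 0)
    or-and {p = suc zero} {zero}           _ _ p≤r _ = +-monoˡ-≤ 0 p≤r
    or-and {p = suc zero} {suc zero}       _ _ p≤r _ = +-monoˡ-≤ 1 p≤r
    or-and {p = suc zero} {suc (suc _)} _ (s≤s ()) _ _
    or-and {p = suc (suc _)} (s≤s ()) _ _ _

    row-a : ∀ y → lhs a y ≤ rhs a y
    row-a y with a Fin.≟ a | a Fin.≟ b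
    ... | no a≢a | _       = contradiction refl a≢a
    ... | _      | yes a≡b = contradiction a≡b a≢b
    ... | yes _  | no _ with y Fin.≟ a | y Fin.≟ b
    ...   | yes refl | yes refl = contradiction refl a≢b
    ...   | yes refl | no _ rewrite A-loop a =
      ≤-trans (+-mono-≤ (A≤1 b a) (A≤1 b a)) (m≤n+m 2 (A′ a a))
    ...   | no _ | yes refl rewrite A-loop b | A-comm a b | *-zeroʳ (A b a) | +-identityʳ (A b a) =
      m≤n+m _ _
    ...   | no y≢a | no y≢b rewrite +-identityʳ (A b y) | +-identityʳ (C y) | +-identityʳ (C y) | +-identityʳ (C y) =
      or-and (A≤1 a y) (A≤1 b y) (kept a≢b y≢b) (moved y≢a y≢b)

    row-b : ∀ y → y ≢ a → lhs b y ≤ rhs b y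
    row-b y y≢a with b Fin.≟ b | b Fin.≟ a | y Fin.≟ a
    ... | no b≢b | _ | _       = contradiction refl b≢b
    ... | _ | yes b≡a | _      = contradiction (sym b≡a) a≢b
    ... | _ | _ | yes y≡a      = contradiction y≡a y≢a
    ... | yes _ | no _ | no _ rewrite +-identityʳ (A b y) =
      ≤-trans (m≤m+n (A b y) _) (≤-trans (m≤m+n _ 0) (m≤n+m _ (A′ b y)))

    flip≤ : ∀ x y → lhs y x ≤ rhs y x → lhs x y ≤ rhs x y
    flip≤ x y = subst₂ _≤_ (cong₂ _+_ (A-comm y x) (twice-comm (A b) a))
      (cong₂ _+_ (A′-comm y x) (cong₂ _+_ (cong₂ _+_ (twice-comm C a) (twice-comm (A b) b)) corner-comm))
      where
      twice-comm : ∀ f c → twice f c y x ≡ twice f c x y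
      twice-comm f c = +-comm (f x when (y Fin.≟ c)) _
      corner-comm : corner y x ≡ corner x y
      corner-comm with x Fin.≟ a | y Fin.≟ a
      ... | yes _ | yes _ = refl
      ... | yes _ | no _  = refl
      ... | no _  | yes _ = refl
      ... | no _  | no _  = refl

    pointwise : ∀ x y → lhs x y ≤ rhs x y
    pointwise x y = go (x Fin.≟ a) (y Fin.≟ a) (x Fin.≟ b) (y Fin.≟ b)
      where
      twice-no : ∀ {f c} → x ≢ c → y ≢ c → twice f c x y ≡ 0
      twice-no {c = c} x≢c y≢c with x Fin.≟ c | y Fin.≟ c
      ... | yes x≡c | _ = contradiction x≡c x≢c
      ... | no _ | yes y≡c = contradiction y≡c y≢c
      ... | no _ | no _ = refl
      go : Dec (x ≡ a) → Dec (y ≡ a) → Dec (x ≡ b) → Dec (y ≡ b) → lhs x y ≤ rhs x y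
      go (yes refl) _          _          _          = row-a y
      go (no _)     (yes refl) _          _          = flip≤ x y (row-a x)
      go (no _)     (no y≢a)   (yes refl) _          = row-b y y≢a
      go (no x≢a)   (no _)     (no _)     (yes refl) = flip≤ x y (row-b x x≢a)
      go (no x≢a)   (no y≢a)   (no x≢b)   (no y≢b)   =
        ≤-trans (≤-reflexive (trans (cong (A x y +_) (twice-no x≢a y≢a)) (+-identityʳ _)))
                (≤-trans (kept x≢b y≢b) (m≤m+n _ _))

    ∑∑ : (Fin n → Fin n → ℕ) → ℕ
    ∑∑ f = ∑ λ x → ∑ λ y → f x y

    ∑∑-+ : ∀ f g → ∑∑ (λ x y → f x y + g x y) ≡ ∑∑ f + ∑∑ g
    ∑∑-+ f g = trans (∑-cong λ x → ∑-+ (f x) (g x)) (∑-+ _ _)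

    ∑∑-twice : ∀ f c → ∑∑ (twice f c) ≡ ∑ f + ∑ f
    ∑∑-twice f c = trans (∑∑-+ (λ x y → f y when (x Fin.≟ c)) (λ x y → f x when (y Fin.≟ c)))
      (cong₂ _+_ (trans (∑-swap _) (∑-cong λ y → ∑-when c λ _ → f y)) (∑-cong λ x → ∑-when c λ _ → f x))

    ∑∑-corner : ∑∑ corner ≡ 2
    ∑∑-corner = trans (∑-cong λ x → ∑-when a λ _ → 2 when (x Fin.≟ a)) (∑-when a λ _ → 2)

    total : ∑∑ A ≤ ∑∑ A′ + 2 * suc (∑ C)
    total = +-cancelʳ-≤ (β + β) (∑∑ A) _ (begin
      ∑∑ A + (β + β)                                 ≡⟨ cong (∑∑ A +_) (∑∑-twice (A b) a) ⟨
      ∑∑ A + ∑∑ (twice (A b) a)                      ≡⟨ ∑∑-+ A _ ⟨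
      ∑∑ lhs                                         ≤⟨ ∑-mono (λ x → ∑-mono (pointwise x)) ⟩
      ∑∑ rhs                                         ≡⟨ ∑∑-+ A′ _ ⟩
      ∑∑ A′ + ∑∑ (λ x y → (twice C a x y + twice (A b) b x y) + corner x y)
                                                     ≡⟨ cong (∑∑ A′ +_) (∑∑-+ (λ x y → twice C a x y + twice (A b) b x y) corner) ⟩
      ∑∑ A′ + (∑∑ (λ x y → twice C a x y + twice (A b) b x y) + ∑∑ corner)
                                                     ≡⟨ cong (∑∑ A′ +_) (cong₂ _+_ (trans (∑∑-+ (twice C a) (twice (A b) b))
                                                          (cong₂ _+_ (∑∑-twice C a) (∑∑-twice (A b) b))) ∑∑-corner) ⟩
      ∑∑ A′ + ((∑ C + ∑ C + (β + β)) + 2)            ≡⟨ solve 3 (λ e c β → e :+ ((c :+ c :+ (β :+ β)) :+ con 2)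
                                                            := (e :+ con 2 :* (con 1 :+ c)) :+ (β :+ β)) refl (∑∑ A′) (∑ C) β ⟩
      (∑∑ A′ + 2 * suc (∑ C)) + (β + β)              ∎)
      where
      open ≤-Reasoning
      β = ∑ (A b)

module _ {n} (G : Graph n) {a b : Fin n} (ab : Adj G a b) where

  private
    a≢b : a ≢ b
    a≢b a≡b = adj-irrefl G a≡b ab

  merge : Fin n → Fin n
  merge x = if does (x Fin.≟ b) then a else x

  merge-b : merge b ≡ a
  merge-b with b Fin.≟ b
  ... | yes _  = refl
  ... | no b≢b = contradiction refl b≢b

  merge-≢ : ∀ {x} → x ≢ b → merge x ≡ x
  merge-≢ {x} x≢b with x Fin.≟ b
  ... | yes x≡b = contradiction x≡b x≢b
  ... | no _    = refl

  merge≢b : ∀ x → merge x ≢ b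
  merge≢b x with x Fin.≟ b
  ... | yes _  = a≢b
  ... | no x≢b = x≢b

  merge-fibre : ∀ {u v} → merge u ≡ merge v → Path G (λ x → merge x ≡ merge u) u v
  merge-fibre {u} {v} eq with u Fin.≟ b | v Fin.≟ b
  ... | yes refl | yes refl = stop merge-b
  ... | yes refl | no v≢b   = subst (Path G _ b) eq (move merge-b (adj-sym G ab) (stop (merge-≢ a≢b)))
  ... | no u≢b   | yes refl = subst (λ z → Path G (λ x → merge x ≡ z) z b) (sym eq)
                                (move (merge-≢ a≢b) ab (stop merge-b))
  ... | no u≢b   | no v≢b   = subst (Path G _ u) eq (stop (merge-≢ u≢b))

  private
    G′ = image merge G

    kept : ∀ {x y} → x ≢ b → y ≢ b → adj G x y ≤ adj G′ x y
    kept {x} {y} x≢b y≢b = 𝟙-mono (adj? G x y) (adj? G′ x y) λ xy →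
      (λ x≡y → adj-irrefl G x≡y xy) , x , y , merge-≢ x≢b , merge-≢ y≢b , xy

    moved : ∀ {y} → y ≢ a → y ≢ b → adj G b y ≤ adj G′ a y
    moved {y} y≢a y≢b = 𝟙-mono (adj? G b y) (adj? G′ a y) λ by →
      (y≢a ∘ sym) , b , y , merge-b , merge-≢ y≢b , by

  degreeSum-merge : degreeSum G ≤ degreeSum (image merge G) + 2 * suc (codegree G a b)
  degreeSum-merge = Merging.total (adj G) (adj G′) a b a≢b (λ x y → 𝟙≤1 (adj? G x y))
    (adj-comm G) (adj-loop G) (adj-comm G′) kept moved

-- Dense graphs contain complete models

restrict : ∀ {n} {V : Pred (Fin n) 0ℓ} → Decidable V → Graph n → Graph n
restrict {V = V} V? G = record
  { Adj        = λ x y → V x × V y × Adj G x y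
  ; adj?       = λ x y → V? x ×-dec V? y ×-dec adj? G x y
  ; adj-sym    = λ (vx , vy , xy) → vy , vx , adj-sym G xy
  ; adj-irrefl = λ x≡y (_ , _ , xy) → adj-irrefl G x≡y xy
  }

edge-exists : ∀ {n} (G : Graph n) → 0 < degreeSum G → ∃[ x ] ∃[ y ] Adj G x y
edge-exists G 0<e with ∑-positive _ 0<e
... | x , 0<d with ∑-positive _ 0<d
...   | y , 0<a = x , y , 𝟙-positive (adj? G x y) 0<a

-- An average degree above `density t` forces a model of K_(t+1). The recursion is the price of a
-- contraction: an edge whose ends have at most `density t` common neighbours takes at most
-- `2 * suc (density t)` from the degree sum, and one vertex disappears.
density : ℕ → ℕ
density zero    = 0
density (suc t) = 2 * suc (density t)

-- `v` becomes a branch set of its own. It is adjacent to the others because vertices outside its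
-- neighbourhood are isolated in the restricted graph, so the positive degree demanded by `nonempty`
-- yields a neighbour of `v` in each branch set.
joinNeighbour : ∀ {n t} (G : Graph n) {v w} → Adj G v w →
                CompleteModel (suc t) (restrict (adj? G v) G) → CompleteModel (suc (suc t)) G
joinNeighbour {n} {t} G {v} {w} vw M = record
  { branch    = β
  ; nonempty  = nonempty′
  ; connected = connected′ _
  ; adjacent  = adjacent′ _ _
  }
  where
  open CompleteModel M
  H = restrict (adj? G v) G
  β : Fin n → Maybe (Fin (suc (suc t)))
  β x = if does (x Fin.≟ v) then just zero else
        (if does (adj? G v x) then Maybe.map suc (branch x) else nothing)
  βv : β v ≡ just zero
  βv with v Fin.≟ v
  ... | yes _  = refl
  ... | no v≢v = contradiction refl v≢v
  βsuc : ∀ {x i} → Adj G v x → branch x ≡ just i → β x ≡ just (suc i)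
  βsuc {x} vx bx with x Fin.≟ v | adj? G v x
  ... | yes refl | _      = contradiction vx (adj-irrefl G refl)
  ... | no _     | no ¬vx = contradiction vx ¬vx
  ... | no _     | yes _  rewrite bx = refl
  βsuc⁻¹ : ∀ {x i} → β x ≡ just (suc i) → Adj G v x × branch x ≡ just i
  βsuc⁻¹ {x} eq with x Fin.≟ v | adj? G v x
  βsuc⁻¹ {x} eq | no _ | yes vx with branch x
  βsuc⁻¹ {x} refl | no _ | yes vx | just _ = vx , refl
  βzero⁻¹ : ∀ {x} → β x ≡ just zero → x ≡ v
  βzero⁻¹ {x} eq with x Fin.≟ v | adj? G v x
  ... | yes x≡v | _ = x≡v
  βzero⁻¹ {x} eq | no _ | yes vx with branch x
  βzero⁻¹ {x} () | no _ | yes vx | just _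
  βzero⁻¹ {x} () | no _ | yes vx | nothing
  path : ∀ {i a b} → Adj G v a → Path H (λ x → branch x ≡ just i) a b → Path G (λ x → β x ≡ just (suc i)) a b
  path va (stop ba)                  = stop (βsuc va ba)
  path va (move ba (_ , vc , ac) π) = move (βsuc va ba) ac (path vc π)
  nonempty′ : ∀ i → ∃[ u ] ∃[ w ] β u ≡ just i × Adj G u w
  nonempty′ zero    = v , w , βv , vw
  nonempty′ (suc i) with nonempty i
  ... | u , z , bu , (vu , _ , uz) = u , z , βsuc vu bu , uz
  connected′ : ∀ i {a b} → β a ≡ just i → β b ≡ just i → Path G (λ x → β x ≡ just i) a b
  connected′ zero {a} {b} ba bb with βzero⁻¹ {a} ba | βzero⁻¹ {b} bb
  ... | refl | refl = stop ba
  connected′ (suc i) {a} {b} ba bb with βsuc⁻¹ {a} ba | βsuc⁻¹ {b} bb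
  ... | va , ba′ | _ , bb′ = path va (connected ba′ bb′)
  adjacent′ : ∀ i j → i ≢ j → ∃[ a ] ∃[ b ] β a ≡ just i × β b ≡ just j × Adj G a b
  adjacent′ zero    zero    i≢j = contradiction refl i≢j
  adjacent′ zero    (suc j) _   with nonempty j
  ... | u , _ , bu , (vu , _ , _) = v , u , βv , βsuc vu bu , vu
  adjacent′ (suc i) zero    _   with nonempty i
  ... | u , _ , bu , (vu , _ , _) = u , v , βsuc vu bu , βv , adj-sym G vu
  adjacent′ (suc i) (suc j) i≢j with adjacent {i} {j} (i≢j ∘ cong suc)
  ... | a , b , ba , bb , (va , vb , ab) = a , b , βsuc va ba , βsuc vb bb , ab

-- `V` stands for the vertex set: merging leaves the type `Fin n` alone, and vertices merged away
-- must not count.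
DenseHasModel : ℕ → Set₁
DenseHasModel t = ∀ {n} (G : Graph n) {V : Pred (Fin n) 0ℓ} (V? : Decidable V) →
  (∀ {x y} → Adj G x y → V x) → density t * # V? < degreeSum G → CompleteModel (suc t) G

-- Mader's argument: contract an edge whose ends have few common neighbours, which keeps
-- the graph dense; if there is none, then neighbourhoods are dense.
denseStep : ∀ t → DenseHasModel t → ∀ m {n} (G : Graph n) {V : Pred (Fin n) 0ℓ} (V? : Decidable V) →
            (∀ {x y} → Adj G x y → V x) → # V? ≤ m → density (suc t) * # V? < degreeSum G →
            CompleteModel (suc (suc t)) G
denseStep t IH zero G V? endpoint small dense
  with edge-exists G (≤-<-trans z≤n dense)
... | x , y , xy = contradiction (≤-trans (#-positive V? (endpoint xy)) small) λ ()
denseStep t IH (suc m) G {V} V? endpoint small dense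
  with any? (λ x → any? λ y → adj? G x y ×-dec (codegree G x y ≤? density t))
... | yes (a , b , ab , few) =
  liftModel (merge G ab) (merge-fibre G ab) proj₂ (denseStep t IH m G′ V′? endpoint′ small′ dense′)
  where
  G′ = image (merge G ab) G
  V′? : Decidable (λ x → V x × x ≢ b)
  V′? x = V? x ×-dec ¬? (x Fin.≟ b)
  endpoint′ : ∀ {x y} → Adj G′ x y → V x × x ≢ b
  endpoint′ (_ , u , _ , refl , _ , uv) = merge-V , merge≢b G ab u
    where
    merge-V : V (merge G ab u)
    merge-V with u Fin.≟ b
    ... | yes _ = endpoint ab
    ... | no _  = endpoint uv
  fewer : suc (# V′?) ≤ # V?
  fewer = ≤-trans
    (≤-reflexive (trans (cong (_+ # V′?) (sym (∑-when b λ _ → 1))) (sym (∑-+ _ λ x → 𝟙 (V′? x)))))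
    (∑-mono λ x → pt x (x Fin.≟ b))
    where
    pt : ∀ x → Dec (x ≡ b) → (1 when (x Fin.≟ b)) + 𝟙 (V′? x) ≤ 𝟙 (V? x)
    pt x (no x≢b) rewrite dec-false (x Fin.≟ b) x≢b = 𝟙-mono (V? x ×-dec yes x≢b) (V? x) proj₁
    pt x (yes refl) rewrite 𝟙-false (V′? x) (λ (_ , x≢x) → x≢x refl)
      | dec-true (x Fin.≟ x) refl | 𝟙-true (V? x) (endpoint (adj-sym G ab)) = ≤-refl
  small′ : # V′? ≤ m
  small′ = ≤-pred (≤-trans fewer small)
  dense′ : density (suc t) * # V′? < degreeSum G′
  dense′ = +-cancelʳ-< (density (suc t)) _ _ (begin-strict
    density (suc t) * # V′? + density (suc t)  ≡⟨ +-comm _ (density (suc t)) ⟩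
    density (suc t) + density (suc t) * # V′?  ≡⟨ *-suc (density (suc t)) _ ⟨
    density (suc t) * suc (# V′?)              ≤⟨ *-monoʳ-≤ (density (suc t)) fewer ⟩
    density (suc t) * # V?                     <⟨ dense ⟩
    degreeSum G                                ≤⟨ degreeSum-merge G ab ⟩
    degreeSum G′ + 2 * suc (codegree G a b)    ≤⟨ +-monoʳ-≤ (degreeSum G′) (*-monoʳ-≤ 2 (s≤s few)) ⟩
    degreeSum G′ + density (suc t)             ∎)
    where open ≤-Reasoning
... | no ¬few with edge-exists G (≤-<-trans z≤n dense)
...   | v , w , vw = joinNeighbour G vw (IH H (adj? G v) proj₁ dense′)
  where
  H = restrict (adj? G v) G
  -- No edge at `v` has few common neighbours, so each neighbour of `v` has degree more than
  -- `density t` inside the neighbourhood.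
  many : ∀ u → 𝟙 (adj? G v u) * suc (density t) ≤ ∑ (λ z → adj H u z)
  many u with adj? G v u
  ... | no _   = z≤n
  ... | yes vu = ≤-trans (≤-reflexive (+-identityʳ _)) (≤-trans (≰⇒> λ few → ¬few (v , u , vu , few))
    (∑-mono λ z → ≤-reflexive (trans (sym (𝟙-× (adj? G v z) (adj? G u z)))
      (𝟙-⇔ (adj? G v z ×-dec adj? G u z) (yes vu ×-dec adj? G v z ×-dec adj? G u z)
        (λ (vz , uz) → vu , vz , uz) (λ (_ , vz , uz) → vz , uz)))))
  dense′ : density t * # (adj? G v) < degreeSum H
  dense′ = begin-strict
    density t * # (adj? G v)           <⟨ *-monoˡ-< (# (adj? G v)) {{>-nonZero (#-positive (adj? G v) vw)}} (n<1+n (density t)) ⟩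
    suc (density t) * # (adj? G v)     ≡⟨ *-∑ (suc (density t)) _ ⟩
    ∑ (λ u → suc (density t) * adj G v u) ≡⟨ ∑-cong (λ u → *-comm (suc (density t)) (adj G v u)) ⟩
    ∑ (λ u → adj G v u * suc (density t)) ≤⟨ ∑-mono many ⟩
    degreeSum H                        ∎
    where open ≤-Reasoning

mader : ∀ t → DenseHasModel t
-- A model of K_1 needs just a vertex of positive degree, which any edge supplies.
mader zero G V? _ dense with edge-exists G dense
... | x , y , xy = record
  { branch    = λ z → if does (z Fin.≟ x) then just zero else nothing
  ; nonempty  = λ { zero → x , y , bx , xy }
  ; connected = λ {i} bu bv → conn bu bv
  ; adjacent  = λ { {zero} {zero} i≢j → contradiction refl i≢j }
  }
  where
  b : _ → Maybe (Fin 1)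
  b z = if does (z Fin.≟ x) then just zero else nothing
  bx : b x ≡ just zero
  bx with x Fin.≟ x
  ... | yes _  = refl
  ... | no x≢x = contradiction refl x≢x
  b⁻¹ : ∀ {z i} → b z ≡ just i → z ≡ x
  b⁻¹ {z} eq with z Fin.≟ x
  ... | yes z≡x = z≡x
  conn : ∀ {i u v} → b u ≡ just i → b v ≡ just i → Path G (λ z → b z ≡ just i) u v
  conn {i} {u} {v} bu bv with b⁻¹ {u} bu | b⁻¹ {v} bv
  ... | refl | refl = stop bu
mader (suc t) G V? endpoint dense = denseStep t (mader t) _ G V? endpoint ≤-refl dense

FibreConnected : ∀ {n} → Graph n → (Fin n → Fin n) → Set
FibreConnected G f = ∀ {u v} → f u ≡ f v → Path G (λ x → f x ≡ f u) u v

-- `f` encodes a contraction and `L` the vertices that survive, so this speaks about induced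
-- subgraphs of contractions; `d` bounds their average degree.
Sparse : ∀ {n} → ℕ → Graph n → Set₁
Sparse d G = ∀ {f} → FibreConnected G f → ∀ {L : Pred _ 0ℓ} (L? : Decidable L) →
             degreeSum (restrict L? (image f G)) ≤ d * # L?

modelFree⇒sparse : ∀ {n} t {G : Graph n} → ¬ CompleteModel (suc t) G → Sparse (density t) G
modelFree⇒sparse t {G} ¬M {f} conn L? = ≮⇒≥ λ dense →
  ¬M (liftModel f conn (λ (_ , _ , _ , xy) → xy) (mader t (restrict L? (image f G)) L? proj₁ dense))

-- Approximating the domination number

does-true : ∀ {P : Set} (P? : Dec P) → does P? ≡ true → P
does-true (yes p) _ = p

subsetOf : ∀ {n} {P : Pred (Fin n) 0ℓ} → Decidable P → Subset n
subsetOf P? = tabulate λ x → does (P? x)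

∈subsetOf⁺ : ∀ {n} {P : Pred (Fin n) 0ℓ} (P? : Decidable P) {x} → P x → x ∈ subsetOf P?
∈subsetOf⁺ P? {x} p = lookup⇒[]= x _ (trans (lookup∘tabulate _ x) (dec-true (P? x) p))

∈subsetOf⁻ : ∀ {n} {P : Pred (Fin n) 0ℓ} (P? : Decidable P) {x} → x ∈ subsetOf P? → P x
∈subsetOf⁻ P? {x} x∈ = does-true (P? x) (trans (sym (lookup∘tabulate _ x)) ([]=⇒lookup x∈))

opaque
  unfolding ∑

  ∣subsetOf∣ : ∀ {n} {P : Pred (Fin n) 0ℓ} (P? : Decidable P) → ∣ subsetOf P? ∣ ≡ # P?
  ∣subsetOf∣ {zero}  P? = refl
  ∣subsetOf∣ {suc n} P? with P? zero
  ... | yes _ = cong suc (∣subsetOf∣ (P? ∘ suc))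
  ... | no _  = ∣subsetOf∣ (P? ∘ suc)

∣_∣≡# : ∀ {n} (S : Subset n) → ∣ S ∣ ≡ # (_∈? S)
∣ S ∣≡# = trans
  (cong ∣_∣ (⊆-antisym (λ x∈S → ∈subsetOf⁺ (_∈? S) x∈S) (∈subsetOf⁻ (_∈? S)))) (∣subsetOf∣ (_∈? S))

elements : ∀ {n} → Subset n → List (Fin n)
elements []            = []
elements (inside  ∷ S) = zero ∷ List.map suc (elements S)
elements (outside ∷ S) = List.map suc (elements S)

length-elements : ∀ {n} (S : Subset n) → length (elements S) ≡ ∣ S ∣
length-elements []            = refl
length-elements (inside  ∷ S) = cong suc (trans (length-map suc (elements S)) (length-elements S))
length-elements (outside ∷ S) = trans (length-map suc (elements S)) (length-elements S)

∈-elements : ∀ {n} {S : Subset n} {x} → x ∈ S → x List∈.∈ elements S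
∈-elements {S = inside  ∷ S} here        = here refl
∈-elements {S = inside  ∷ S} (there x∈S) = there (∈-map⁺ suc (∈-elements x∈S))
∈-elements {S = outside ∷ S} (there x∈S) = ∈-map⁺ suc (∈-elements x∈S)

length-concatMap : ∀ {A B : Set} (f : A → List B) {m} → (∀ x → length (f x) ≤ m) →
                   ∀ xs → length (concatMap f xs) ≤ length xs * m
length-concatMap f f≤m []       = z≤n
length-concatMap f f≤m (x ∷ xs) = ≤-trans (≤-reflexive (length-++ (f x)))
  (+-mono-≤ (f≤m x) (length-concatMap f f≤m xs))

∈-concatMap : ∀ {A B : Set} (f : A → List B) {x y xs} → x List∈.∈ xs → y List∈.∈ f x → y List∈.∈ concatMap f xs
∈-concatMap f (here refl) y∈ = ∈-++⁺ˡ y∈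
∈-concatMap f (there x∈)  y∈ = ∈-++⁺ʳ _ (∈-concatMap f x∈ y∈)

-- Stated for a relation, not a graph: a vertex will evaluate it on the part of the adjacency
-- relation that it sees, which need not be symmetric.
Covered : ∀ {n} → Rel (Fin n) 0ℓ → ℕ → Subset n → Set
Covered R s S = ∃[ K ] (∣ K ∣ ≤ s × (∀ x → x ∈ K → x ∉ S) ×
  (∀ p → (∀ x → x ∈ S → R p x) → ∃[ k ] (k ∈ K × (k ≡ p ⊎ R p k))))

opaque
  covered? : ∀ {n} {R : Rel (Fin n) 0ℓ} → B.Decidable R → ∀ s → Decidable (Covered R s)
  covered? R? s S = anySubset? λ K → (∣ K ∣ ≤? s) ×-dec
    all? (λ x → (x ∈? K) →-dec ¬? (x ∈? S)) ×-dec
    all? (λ p → all? (λ x → (x ∈? S) →-dec R? p x) →-dec any? λ k → (k ∈? K) ×-dec ((k Fin.≟ p) ⊎-dec R? p k))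

-- Minimality ranges over nonempty sets. Every vertex is a common neighbour of the empty set, which
-- is therefore uncovered as soon as no `s` vertices dominate the graph, and would hide all other
-- uncovered sets.
Critical : ∀ {n} → Rel (Fin n) 0ℓ → ℕ → Subset n → Set
Critical R s S = ¬ Covered R s S × ¬ (∃[ S′ ] (Nonempty S′ × S′ ⊂ S × ¬ Covered R s S′))

opaque
  critical? : ∀ {n} {R : Rel (Fin n) 0ℓ} → B.Decidable R → ∀ s → Decidable (Critical R s)
  critical? R? s S = ¬? (covered? R? s S) ×-dec
    ¬? (anySubset? λ S′ → nonempty? S′ ×-dec (S′ ⊂? S) ×-dec ¬? (covered? R? s S′))

InCritical : ∀ {n} → Rel (Fin n) 0ℓ → ℕ → Pred (Fin n) 0ℓ
InCritical R s x = ∃[ S ] (x ∈ S × Critical R s S)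

opaque
  inCritical? : ∀ {n} {R : Rel (Fin n) 0ℓ} → B.Decidable R → ∀ s → Decidable (InCritical R s)
  inCritical? R? s x = anySubset? λ S → (x ∈? S) ×-dec critical? R? s S

starFibres : ∀ {n} {G : Graph n} {f : Fin n → Fin n} →
             (∀ u → Path G (λ x → f x ≡ f u) u (f u)) → FibreConnected G f
starFibres {G = G} {f} π {u} {v} fu≡fv =
  π u ◅◅ subst (λ z → Path G (λ x → f x ≡ z) z v) (sym fu≡fv) (reversePath (π v))

-- The choice depends on a vector of Booleans, so a vertex that rebuilds this vector from messages
-- chooses alike. `x` is the default if there is no candidate.
choose : ∀ {n} → Vec Bool n → Fin n → Fin n
choose v x with any? (λ m → lookup v m Bool.≟ true)
... | yes (m , _) = m
... | no _        = x

choose-spec : ∀ {n} (v : Vec Bool n) x →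
  lookup v (choose v x) ≡ true ⊎ (choose v x ≡ x × (∀ m → lookup v m ≢ true))
choose-spec v x with any? (λ m → lookup v m Bool.≟ true)
... | yes (m , eq) = inj₁ eq
... | no ¬∃        = inj₂ (refl , λ m eq → ¬∃ (m , eq))

-- Serves twice: the analysis keeps the exceptional vertices and collapses the others onto an
-- arbitrary dominating set, while the algorithm collapses onto its own centres.
module Collapsing {n} (G : Graph n) {K M : Pred (Fin n) 0ℓ} (K? : Decidable K) (M? : Decidable M)
  (M⊆K : ∀ {x} → M x → K x) where

  options : Fin n → Vec Bool n
  options x = tabulate λ m → does (adj? G x m ×-dec M? m)

  collapse : Fin n → Fin n
  collapse x = if does (K? x) then x else choose (options x) x

  data Collapse (x : Fin n) : Fin n → Set where
    keep : K x → Collapse x x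
    join : ∀ {m} → Adj G x m → M m → Collapse x m
    lone : ¬ K x → (∀ m → Adj G x m → ¬ M m) → Collapse x x

  collapses : ∀ x → Collapse x (collapse x)
  collapses x = go (K? x)
    where
    options⁻ : ∀ {m} → lookup (options x) m ≡ true → Adj G x m × M m
    options⁻ {m} eq = does-true (adj? G x m ×-dec M? m) (trans (sym (lookup∘tabulate _ m)) eq)
    go : (k : Dec (K x)) → Collapse x (if does k then x else choose (options x) x)
    go (yes kx) = keep kx
    go (no ¬kx) with choose-spec (options x) x
    ... | inj₁ eq         = join (proj₁ (options⁻ eq)) (proj₂ (options⁻ eq))
    ... | inj₂ (eq , ¬m) = subst (Collapse x) (sym eq) (lone ¬kx λ m xm mm →
            ¬m m (trans (lookup∘tabulate _ m) (dec-true (adj? G x m ×-dec M? m) (xm , mm))))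

  collapse-kept : ∀ {x} → K x → collapse x ≡ x
  collapse-kept {x} kx rewrite dec-true (K? x) kx = refl

  collapse-idem : ∀ x → collapse (collapse x) ≡ collapse x
  collapse-idem x with collapse x in eq | collapses x
  ... | _ | keep _    = eq
  ... | _ | join _ mm = collapse-kept (M⊆K mm)
  ... | _ | lone _ _  = eq

  collapse-path : ∀ u → Path G (λ x → collapse x ≡ collapse u) u (collapse u)
  collapse-path u = go (collapses u) refl
    where
    go : ∀ {y} → Collapse u y → y ≡ collapse u → Path G (λ x → collapse x ≡ collapse u) u y
    go (keep _)     _  = stop refl
    go (join uy my) eq = move refl uy (stop (trans (collapse-kept (M⊆K my)) eq))
    go (lone _ _)   _  = stop refl

module Constants (d : ℕ) where

  s : ℕ
  s = 2 * d

  -- Size of a search tree of depth `j`: a node is either a leaf, an uncovered set of at most `d`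
  -- vertices, or has at most `s` children. The sum covers both cases.
  treeSize : ℕ → ℕ
  treeSize zero    = d
  treeSize (suc j) = d + s * treeSize j

  -- Each of the at most `s` vertices of a cover accounts for itself and for what is left after it
  -- has joined the set; the base case is `biclique`.
  residual : ℕ → ℕ
  residual zero    = d
  residual (suc j) = s * suc (residual j)

  approx : ℕ
  approx = (1 + treeSize d) + (1 + residual d)

module Approximation {n} (G : Graph n) {V : Pred (Fin n) 0ℓ} (V? : Decidable V)
  (endpoint : ∀ {x y} → Adj G x y → V x) (d : ℕ) where

  open Constants d public

  Core : Pred (Fin n) 0ℓ
  Core = InCritical (Adj G) s

  core? : Decidable Core
  core? = inCritical? (adj? G) s

  Dom : Pred (Fin n) 0ℓ
  Dom x = V x × (Core x ⊎ (∀ j → Adj G x j → ¬ Core j))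

  opaque
    dom? : Decidable Dom
    dom? x = V? x ×-dec (core? x ⊎-dec all? λ j → adj? G x j →-dec ¬? (core? j))

  dom-dominates : ∀ {x} → V x → Dom x ⊎ ∃[ y ] (Adj G x y × Dom y)
  dom-dominates {x} vx with core? x | any? (λ j → adj? G x j ×-dec core? j)
  ... | yes cx | _ = inj₁ (vx , inj₁ cx)
  ... | no _   | yes (j , xj , cj) = inj₂ (j , xj , endpoint (adj-sym G xj) , inj₁ cj)
  ... | no _   | no ¬∃ = inj₁ (vx , inj₂ λ j xj cj → ¬∃ (j , xj , cj))

  Common : Subset n → Pred (Fin n) 0ℓ
  Common S p = ∀ x → x ∈ S → Adj G p x

  common? : ∀ S → Decidable (Common S)
  common? S p = all? λ x → (x ∈? S) →-dec adj? G p x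

  module _ (sparse : Sparse d G) where

    -- The set and its common neighbours span a complete bipartite graph, whose degree sum
    -- `2 * σ * π` exceeds `d * (σ + π)` if both sides are larger than `d`.
    biclique : ∀ S → d < ∣ S ∣ → # (common? S) ≤ d
    biclique S d<S = ≮⇒≥ λ d<P → <⇒≱ (too-many d<P) few
      where
      L? : Decidable (λ x → x ∈ S ⊎ Common S x)
      L? x = (x ∈? S) ⊎-dec common? S x
      G′ = restrict L? (image id G)
      σ = ∣ S ∣
      π = # (common? S)
      few : degreeSum G′ ≤ d * (σ + π)
      few = ≤-trans (sparse (λ { refl → stop refl }) L?)
        (*-monoʳ-≤ d (≤-trans (#-⊎ L? (_∈? S) (common? S) λ _ → id) (≤-reflexive (cong (_+ π) (sym ∣ S ∣≡#)))))
      edge : ∀ {x p} → x ∈ S → Common S p → Adj G′ x p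
      edge x∈S cp = inj₁ x∈S , inj₂ cp , (λ { refl → adj-irrefl G refl (cp _ x∈S) }) , _ , _ , refl , refl , adj-sym G (cp _ x∈S)
      pt : ∀ x y → 𝟙 (x ∈? S) * 𝟙 (common? S y) + 𝟙 (common? S x) * 𝟙 (y ∈? S) ≤ adj G′ x y
      pt x y = go (x ∈? S) (common? S x)
        where
        go : (p : Dec (x ∈ S)) (q : Dec (Common S x)) → 𝟙 p * 𝟙 (common? S y) + 𝟙 q * 𝟙 (y ∈? S) ≤ adj G′ x y
        go (yes x∈S) (yes cx) = contradiction (cx x x∈S) (adj-irrefl G refl)
        go (yes x∈S) (no _)   = ≤-trans (≤-reflexive (trans (+-identityʳ _) (+-identityʳ _)))
          (𝟙-mono (common? S y) (adj? G′ x y) (edge x∈S))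
        go (no _)    (yes cx) = ≤-trans (≤-reflexive (+-identityʳ _))
          (𝟙-mono (y ∈? S) (adj? G′ x y) λ y∈S → adj-sym G′ (edge y∈S cx))
        go (no _)    (no _)   = z≤n
      product : ∀ (f g : Fin n → ℕ) → ∑ f * ∑ g ≡ ∑ λ x → ∑ λ y → f x * g y
      product f g = trans (*-comm (∑ f) (∑ g)) (trans (*-∑ (∑ g) f)
        (∑-cong λ x → trans (*-comm (∑ g) (f x)) (*-∑ (f x) g)))
      many : σ * π + π * σ ≤ degreeSum G′
      many = begin
        σ * π + π * σ ≡⟨ cong (λ z → z * π + π * z) ∣ S ∣≡# ⟩
        # (_∈? S) * π + π * # (_∈? S) ≡⟨ cong₂ _+_ (product _ _) (product _ _) ⟩
        (∑ λ x → ∑ λ y → 𝟙 (x ∈? S) * 𝟙 (common? S y)) + (∑ λ x → ∑ λ y → 𝟙 (common? S x) * 𝟙 (y ∈? S))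
          ≡⟨ ∑-+ _ _ ⟨
        (∑ λ x → (∑ λ y → 𝟙 (x ∈? S) * 𝟙 (common? S y)) + (∑ λ y → 𝟙 (common? S x) * 𝟙 (y ∈? S)))
          ≡⟨ ∑-cong (λ x → ∑-+ (λ y → 𝟙 (x ∈? S) * 𝟙 (common? S y)) _) ⟨
        (∑ λ x → ∑ λ y → 𝟙 (x ∈? S) * 𝟙 (common? S y) + 𝟙 (common? S x) * 𝟙 (y ∈? S))
          ≤⟨ ∑-mono (λ x → ∑-mono (pt x)) ⟩
        degreeSum G′ ∎
        where open ≤-Reasoning
      too-many : d < π → d * (σ + π) < degreeSum G′
      too-many d<P = begin-strict
        d * (σ + π)       ≡⟨ *-distribˡ-+ d σ π ⟩
        d * σ + d * π     <⟨ +-mono-<-≤ (*-monoˡ-< σ {{>-nonZero (≤-<-trans z≤n d<S)}} d<P) (*-monoˡ-≤ π (<⇒≤ d<S)) ⟩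
        π * σ + σ * π     ≡⟨ +-comm (π * σ) _ ⟩
        σ * π + π * σ     ≤⟨ many ⟩
        degreeSum G′      ∎
        where open ≤-Reasoning

    -- The common neighbours of an uncovered set do not cover themselves, so there are more
    -- than s ≥ d of them.
    uncovered-small : ∀ {S} → ¬ Covered (Adj G) s S → ∣ S ∣ ≤ d
    uncovered-small {S} ¬cov = ≮⇒≥ λ d<S → ¬cov
      ( subsetOf (common? S)
      , ≤-trans (≤-reflexive (∣subsetOf∣ (common? S))) (≤-trans (biclique S d<S) (m≤m+n d _))
      , (λ x x∈ x∈S → adj-irrefl G refl (∈subsetOf⁻ (common? S) x∈ x x∈S))
      , λ p cp → p , ∈subsetOf⁺ (common? S) cp , inj₁ refl )

    critical-below : ∀ m S → ∣ S ∣ ≤ m → Nonempty S → ¬ Covered (Adj G) s S →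
                     ∃[ S′ ] (Nonempty S′ × S′ ⊆ S × Critical (Adj G) s S′)
    critical-below m S S≤m ne ¬cov
      with anySubset? (λ S′ → nonempty? S′ ×-dec (S′ ⊂? S) ×-dec ¬? (covered? (adj? G) s S′))
    ... | no ¬∃ = S , ne , id , ¬cov , ¬∃
    critical-below zero S S≤m ne ¬cov | yes (S′ , ne′ , S′⊂S , ¬cov′) =
      contradiction (≤-trans (p⊂q⇒∣p∣<∣q∣ S′⊂S) S≤m) λ ()
    critical-below (suc m) S S≤m ne ¬cov | yes (S′ , ne′ , S′⊂S , ¬cov′)
      with critical-below m S′ (≤-pred (≤-trans (p⊂q⇒∣p∣<∣q∣ S′⊂S) S≤m)) ne′ ¬cov′
    ... | T , neT , T⊆S′ , critT = T , neT , (λ x∈T → proj₁ S′⊂S (T⊆S′ x∈T)) , critT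

    -- As long as S is covered, every critical set containing S meets the cover of S.
    tree : ℕ → Subset n → List (Fin n)
    tree j S with covered? (adj? G) s S
    ... | no _ = elements S
    tree zero    S | yes _       = []
    tree (suc j) S | yes (K , _) = concatMap (λ k → tree j (S ∪ ⁅ k ⁆)) (elements K)

    length-tree : ∀ j S → length (tree j S) ≤ treeSize j
    length-tree j S with covered? (adj? G) s S
    length-tree zero    S | no ¬cov = ≤-trans (≤-reflexive (length-elements S)) (uncovered-small ¬cov)
    length-tree (suc j) S | no ¬cov = ≤-trans (≤-reflexive (length-elements S)) (≤-trans (uncovered-small ¬cov) (m≤m+n d _))
    length-tree zero    S | yes _   = z≤n
    length-tree (suc j) S | yes (K , K≤s , _) = ≤-trans
      (length-concatMap _ (λ k → length-tree j (S ∪ ⁅ k ⁆)) (elements K))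
      (≤-trans (*-monoˡ-≤ (treeSize j) (≤-trans (≤-reflexive (length-elements K)) K≤s)) (m≤n+m _ d))

    ∣∪⁅⁆∣ : ∀ {S : Subset n} {k} → k ∉ S → suc ∣ S ∣ ≤ ∣ S ∪ ⁅ k ⁆ ∣
    ∣∪⁅⁆∣ {S} {k} k∉S = p⊂q⇒∣p∣<∣q∣ (p⊆p∪q ⁅ k ⁆ , k , q⊆p∪q S ⁅ k ⁆ (x∈⁅x⁆ k) , k∉S)

    ∪⁅⁆⊆ : ∀ {S T : Subset n} {k} → S ⊆ T → k ∈ T → S ∪ ⁅ k ⁆ ⊆ T
    ∪⁅⁆⊆ {S} {T} {k} S⊆T k∈T x∈ with x∈p∪q⁻ S ⁅ k ⁆ x∈
    ... | inj₁ x∈S = S⊆T x∈S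
    ... | inj₂ x∈k = subst (_∈ T) (sym (x∈⁅y⁆⇒x≡y k x∈k)) k∈T

    -- If `S` is uncovered, the minimality of `T` leaves only `S = T`. Otherwise the cover of `S`
    -- meets `T`, as it would cover `T` too: common neighbours of `T` are common neighbours of `S`.
    -- A vertex of the cover lies outside `S`, so each step uses up one of the at most `j` vertices
    -- of `T` still missing.
    ∈-tree : ∀ j S T → Nonempty S → S ⊆ T → Critical (Adj G) s T → ∣ T ∣ ≤ ∣ S ∣ + j →
             ∀ {x} → x ∈ T → x List∈.∈ tree j S
    ∈-tree j S T neS S⊆T crit T≤S+j {x} x∈T with covered? (adj? G) s S
    ... | no ¬cov = ∈-elements (case x ∈? S of λ where
            (yes x∈S) → x∈S
            (no x∉S)  → contradiction (S , neS , ((λ {z} → S⊆T {z}) , x , x∈T , x∉S) , ¬cov) (proj₂ crit))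
    ∈-tree j S T neS S⊆T crit T≤S+j {x} x∈T | yes (K , K≤s , K∩S , cov)
      with any? (λ k → (k ∈? K) ×-dec (k ∈? T))
    ... | no ¬∃ = contradiction
            (K , K≤s , (λ k k∈K k∈T → ¬∃ (k , k∈K , k∈T)) , λ p cp → cov p λ y y∈S → cp y (S⊆T y∈S))
            (proj₁ crit)
    ∈-tree zero S T neS S⊆T crit T≤S+j {x} x∈T | yes (K , K≤s , K∩S , cov) | yes (k , k∈K , k∈T) =
      contradiction (≤-trans (p⊂q⇒∣p∣<∣q∣ ((λ {z} → S⊆T {z}) , k , k∈T , K∩S k k∈K)) (≤-trans T≤S+j (≤-reflexive (+-identityʳ _)))) (<-irrefl refl)
    ∈-tree (suc j) S T neS S⊆T crit T≤S+j {x} x∈T | yes (K , K≤s , K∩S , cov) | yes (k , k∈K , k∈T) =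
      ∈-concatMap (λ k → tree j (S ∪ ⁅ k ⁆)) (∈-elements k∈K)
        (∈-tree j (S ∪ ⁅ k ⁆) T (k , q⊆p∪q S ⁅ k ⁆ (x∈⁅x⁆ k)) (∪⁅⁆⊆ S⊆T k∈T) crit
          (≤-trans T≤S+j (≤-trans (≤-reflexive (+-suc ∣ S ∣ j)) (+-monoˡ-≤ j (∣∪⁅⁆∣ (K∩S k k∈K))))) x∈T)

    module _ {M : Pred (Fin n) 0ℓ} (M? : Decidable M)
      (dominated : ∀ {v} → V v → M v ⊎ ∃[ m ] (Adj G v m × M m)) where

      Avoids : Pred (Subset n) 0ℓ
      Avoids S = ∀ x → x ∈ S → ¬ M x

      Exceptional : Pred (Fin n) 0ℓ
      Exceptional x = ∃[ S ] (x ∈ S × Avoids S × ¬ Covered (Adj G) s S)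

      opaque
        exceptional? : Decidable Exceptional
        exceptional? x = anySubset? λ S → (x ∈? S) ×-dec all? (λ y → (y ∈? S) →-dec ¬? (M? y)) ×-dec ¬? (covered? (adj? G) s S)

      Kept : Pred (Fin n) 0ℓ
      Kept x = Exceptional x ⊎ M x

      kept? : Decidable Kept
      kept? x = exceptional? x ⊎-dec M? x

      open Collapsing G kept? M? inj₂

      collapse-M : ∀ {p} → V p → ¬ Exceptional p → M (collapse p) × (collapse p ≡ p ⊎ Adj G p (collapse p))
      collapse-M {p} vp ¬xp = go (collapses p)
        where
        go : ∀ {y} → Collapse p y → M y × (y ≡ p ⊎ Adj G p y)
        go (keep (inj₁ xp)) = contradiction xp ¬xp
        go (keep (inj₂ mp)) = mp , inj₁ refl
        go (join py my)     = my , inj₂ py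
        go (lone ¬kp ¬m) with dominated vp
        ... | inj₁ mp             = contradiction (inj₂ mp) ¬kp
        ... | inj₂ (m , pm , mm) = contradiction mm (¬m m pm)

      private
        G′ = restrict kept? (image collapse G)

      -- In the graph obtained by collapsing everything else onto M, the neighbours of an
      -- exceptional vertex x would cover each uncovered set containing x that avoids M.
      exceptional-degree : ∀ {x} → Exceptional x → s < ∑ (λ y → adj G′ x y)
      exceptional-degree {x} ex@(S , x∈S , avoid , ¬cov) = ≰⇒> λ few → ¬cov
        ( K , ≤-trans (≤-reflexive (∣subsetOf∣ K?)) (≤-trans (#-mono K? (λ y → adj? G′ x y) λ _ → proj₁) few)
        , (λ y y∈K → proj₂ (∈subsetOf⁻ K? y∈K)) , cover )
        where
        K? : Decidable (λ y → Adj G′ x y × y ∉ S)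
        K? y = adj? G′ x y ×-dec ¬? (y ∈? S)
        K = subsetOf K?
        cover : ∀ p → Common S p → ∃[ k ] (k ∈ K × (k ≡ p ⊎ Adj G p k))
        cover p cp with exceptional? p
        ... | yes xp = p , ∈subsetOf⁺ K? ((inj₁ ex , inj₁ xp , x≢p , x , p ,
                         collapse-kept (inj₁ ex) , collapse-kept (inj₁ xp) , xp-edge) , p∉S) , inj₁ refl
          where
          xp-edge = adj-sym G (cp x x∈S)
          p∉S : p ∉ S
          p∉S p∈S = adj-irrefl G refl (cp p p∈S)
          x≢p : x ≢ p
          x≢p refl = p∉S x∈S
        ... | no ¬xp with collapse-M (endpoint (cp x x∈S)) ¬xp
        ...   | m , near = collapse p , ∈subsetOf⁺ K? ((inj₁ ex , inj₂ m ,
                             (λ x≡ → avoid x x∈S (subst M (sym x≡) m)) , x , p ,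
                             collapse-kept (inj₁ ex) , refl , adj-sym G (cp x x∈S)) , λ c∈S → avoid _ c∈S m) , near

      -- The origin of `s = 2 * d`: exceptional vertices have degree at least `2 * d + 1` in the
      -- collapsed graph, whose degree sum is at most `d` per vertex. The surplus `(d + 1) * χ` has
      -- to be paid by `M`.
      exceptional≤ : # exceptional? ≤ # M?
      exceptional≤ = *-cancelˡ-≤ (suc d) (+-cancelˡ-≤ (d * χ) _ _ (begin
        d * χ + suc d * χ                            ≡⟨ solve 2 (λ d χ → d :* χ :+ (con 1 :+ d) :* χ := (con 1 :+ con 2 :* d) :* χ) refl d χ ⟩
        suc s * χ                                    ≡⟨ *-∑ (suc s) _ ⟩
        ∑ (λ x → suc s * 𝟙 (exceptional? x))         ≤⟨ ∑-mono pt ⟩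
        degreeSum G′                                 ≤⟨ sparse (starFibres collapse-path) kept? ⟩
        d * # kept?                                  ≤⟨ *-monoʳ-≤ d (#-⊎ kept? exceptional? M? λ _ → id) ⟩
        d * (χ + # M?)                               ≡⟨ *-distribˡ-+ d χ _ ⟩
        d * χ + d * # M?                             ≤⟨ +-monoʳ-≤ (d * χ) (*-monoˡ-≤ (# M?) (n≤1+n d)) ⟩
        d * χ + suc d * # M?                         ∎))
        where
        open ≤-Reasoning
        χ = # exceptional?
        pt : ∀ x → suc s * 𝟙 (exceptional? x) ≤ ∑ (λ y → adj G′ x y)
        pt x = go (exceptional? x)
          where
          go : (p : Dec (Exceptional x)) → suc s * 𝟙 p ≤ ∑ (λ y → adj G′ x y)
          go (yes ex) = ≤-trans (≤-reflexive (*-identityʳ (suc s))) (exceptional-degree ex)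
          go (no _)   = ≤-trans (≤-reflexive (*-zeroʳ (suc s))) z≤n

      near : Fin n → List (Fin n)
      near m = tree d ⁅ m ⁆

      -- A critical set that avoids `M` consists of exceptional vertices; one that contains `m` is
      -- found by the search tree starting at `m`. Depth `d` suffices, as uncovered sets have at
      -- most `d` vertices.
      core≤ : # core? ≤ (1 + treeSize d) * # M?
      core≤ = begin
        # core?                                      ≤⟨ #-⊎ core? exceptional? hit? split ⟩
        # exceptional? + # hit?                      ≤⟨ +-mono-≤ exceptional≤ (#-⋃ hit? near? λ _ → id) ⟩
        # M? + ∑ (λ m → # (near? m))                 ≤⟨ +-monoʳ-≤ (# M?) (∑-mono pt) ⟩
        # M? + ∑ (λ m → treeSize d * 𝟙 (M? m))       ≡⟨ cong (# M? +_) (*-∑ (treeSize d) _) ⟨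
        (1 + treeSize d) * # M?                      ∎
        where
        open ≤-Reasoning
        open Dec∈ Fin._≟_ using () renaming (_∈?_ to _∈ˡ?_)
        near? : ∀ m → Decidable (λ x → M m × x List∈.∈ near m)
        near? m x = M? m ×-dec (x ∈ˡ? near m)
        hit? : Decidable (λ x → ∃[ m ] (M m × x List∈.∈ near m))
        hit? x = any? λ m → near? m x
        pt : ∀ m → # (near? m) ≤ treeSize d * 𝟙 (M? m)
        pt m = go (M? m)
          where
          go : (p : Dec (M m)) → # (near? m) ≤ treeSize d * 𝟙 p
          go (yes _) = ≤-trans (#≤length (near? m) (near m) λ _ → proj₂)
            (≤-trans (length-tree d ⁅ m ⁆) (≤-reflexive (sym (*-identityʳ _))))
          go (no ¬m) = ≤-trans (#≤length (near? m) [] λ x (mm , _) → contradiction mm ¬m) z≤n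
        split : ∀ x → Core x → Exceptional x ⊎ ∃[ m ] (M m × x List∈.∈ near m)
        split x (S , x∈S , crit) with any? (λ m → (m ∈? S) ×-dec M? m)
        ... | no ¬∃ = inj₁ (S , x∈S , (λ y y∈S my → ¬∃ (y , y∈S , my)) , proj₁ crit)
        ... | yes (m , m∈S , mm) = inj₂ (m , mm , ∈-tree d ⁅ m ⁆ S (m , x∈⁅x⁆ m)
                (λ x∈ → subst (_∈ S) (sym (x∈⁅y⁆⇒x≡y m x∈)) m∈S) crit
                (≤-trans (uncovered-small (proj₁ crit)) (m≤n+m d _)) x∈S)

      Rest : Pred (Fin n) 0ℓ
      Rest x = V x × ¬ Core x × (∀ j → Adj G x j → ¬ Core j)

      rest? : Decidable Rest
      rest? x = V? x ×-dec ¬? (core? x) ×-dec all? λ j → adj? G x j →-dec ¬? (core? j)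

      commonRest? : ∀ S → Decidable (λ p → Common S p × Rest p)
      commonRest? S p = common? S p ×-dec rest? p

      -- An uncovered nonempty set contains a critical one, so its common neighbours are adjacent to
      -- the core and none is left. A covered set is enlarged by a vertex of its cover, in one
      -- branch for each, until it has more than `d` vertices.
      commonRest≤ : ∀ j S → Nonempty S → d < ∣ S ∣ + j → # (commonRest? S) ≤ residual j
      commonRest≤ zero S ne d<S = ≤-trans (#-mono (commonRest? S) (common? S) λ _ → proj₁)
        (biclique S (≤-trans d<S (≤-reflexive (+-identityʳ _))))
      commonRest≤ (suc j) S ne d<S+j with covered? (adj? G) s S
      ... | no ¬cov with critical-below _ S ≤-refl ne ¬cov
      ...   | T , (t , t∈T) , T⊆S , crit = ≤-trans
              (#≤length (commonRest? S) [] λ p (cp , _ , _ , ¬c) → contradiction (T , t∈T , crit) (¬c t (cp t (T⊆S t∈T))))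
              z≤n
      commonRest≤ (suc j) S ne d<S+j | yes (K , K≤s , K∩S , cov) = begin
        # (commonRest? S)                                ≤⟨ #-⋃ (commonRest? S) part? split ⟩
        ∑ (λ k → # (part? k))                            ≤⟨ ∑-mono pt ⟩
        ∑ (λ k → suc (residual j) * 𝟙 (k ∈? K))          ≡⟨ *-∑ (suc (residual j)) _ ⟨
        suc (residual j) * # (_∈? K)                     ≡⟨ *-comm (suc (residual j)) _ ⟩
        # (_∈? K) * suc (residual j)                     ≡⟨ cong (_* suc (residual j)) ∣ K ∣≡# ⟨
        ∣ K ∣ * suc (residual j)                         ≤⟨ *-monoˡ-≤ (suc (residual j)) K≤s ⟩
        residual (suc j)                                 ∎
        where
        open ≤-Reasoning
        part? : ∀ k → Decidable (λ p → k ∈ K × (p ≡ k ⊎ (Common (S ∪ ⁅ k ⁆) p × Rest p)))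
        part? k p = (k ∈? K) ×-dec ((p Fin.≟ k) ⊎-dec commonRest? (S ∪ ⁅ k ⁆) p)
        split : ∀ p → Common S p × Rest p → ∃[ k ] (k ∈ K × (p ≡ k ⊎ (Common (S ∪ ⁅ k ⁆) p × Rest p)))
        split p (cp , rp) with cov p cp
        ... | k , k∈K , inj₁ k≡p = k , k∈K , inj₁ (sym k≡p)
        ... | k , k∈K , inj₂ pk  = k , k∈K , inj₂ ((λ x x∈ → case x∈p∪q⁻ S ⁅ k ⁆ x∈ of λ where
                (inj₁ x∈S) → cp x x∈S
                (inj₂ x∈k) → subst (Adj G p) (sym (x∈⁅y⁆⇒x≡y k x∈k)) pk) , rp)
        pt : ∀ k → # (part? k) ≤ suc (residual j) * 𝟙 (k ∈? K)
        pt k = go (k ∈? K)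
          where
          go : (p : Dec (k ∈ K)) → # (part? k) ≤ suc (residual j) * 𝟙 p
          go (yes k∈K) = ≤-trans (#-⊎ (part? k) (Fin._≟ k) (commonRest? (S ∪ ⁅ k ⁆)) λ _ → proj₂)
            (≤-trans (+-mono-≤ (#≤length (Fin._≟ k) (k ∷ []) λ { _ refl → here refl })
              (commonRest≤ j (S ∪ ⁅ k ⁆) (k , q⊆p∪q S ⁅ k ⁆ (x∈⁅x⁆ k))
                (≤-trans d<S+j (≤-trans (≤-reflexive (+-suc ∣ S ∣ j)) (+-monoˡ-≤ j (∣∪⁅⁆∣ (K∩S k k∈K)))))))
              (≤-reflexive (sym (*-identityʳ _))))
          go (no k∉K) = ≤-trans (#≤length (part? k) [] λ p (k∈K , _) → contradiction k∈K k∉K) z≤n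

      rest≤ : # rest? ≤ (1 + residual d) * # M?
      rest≤ = begin
        # rest?                                    ≤⟨ #-⋃ rest? by? split ⟩
        ∑ (λ m → # (by? m))                        ≤⟨ ∑-mono pt ⟩
        ∑ (λ m → (1 + residual d) * 𝟙 (M? m))      ≡⟨ *-∑ (1 + residual d) _ ⟨
        (1 + residual d) * # M?                    ∎
        where
        open ≤-Reasoning
        by? : ∀ m → Decidable (λ r → M m × (r ≡ m ⊎ (Common ⁅ m ⁆ r × Rest r)))
        by? m r = M? m ×-dec ((r Fin.≟ m) ⊎-dec commonRest? ⁅ m ⁆ r)
        split : ∀ r → Rest r → ∃[ m ] (M m × (r ≡ m ⊎ (Common ⁅ m ⁆ r × Rest r)))
        split r rr with dominated (proj₁ rr)
        ... | inj₁ mr             = r , mr , inj₁ refl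
        ... | inj₂ (m , rm , mm) = m , mm , inj₂ ((λ x x∈ → subst (Adj G r) (sym (x∈⁅y⁆⇒x≡y m x∈)) rm) , rr)
        pt : ∀ m → # (by? m) ≤ (1 + residual d) * 𝟙 (M? m)
        pt m = go (M? m)
          where
          go : (p : Dec (M m)) → # (by? m) ≤ (1 + residual d) * 𝟙 p
          go (yes _) = ≤-trans (#-⊎ (by? m) (Fin._≟ m) (commonRest? ⁅ m ⁆) λ _ → proj₂)
            (≤-trans (+-mono-≤ (#≤length (Fin._≟ m) (m ∷ []) λ { _ refl → here refl })
              (commonRest≤ d ⁅ m ⁆ (m , x∈⁅x⁆ m) (≤-reflexive (cong (_+ d) (sym (∣⁅x⁆∣≡1 m))))))
              (≤-reflexive (sym (*-identityʳ _))))
          go (no ¬m) = ≤-trans (#≤length (by? m) [] λ r (mm , _) → contradiction mm ¬m) z≤n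

      dom≤ : # dom? ≤ approx * # M?
      dom≤ = begin
        # dom?                                                        ≤⟨ #-⊎ dom? core? rest? split ⟩
        # core? + # rest?                                             ≤⟨ +-mono-≤ core≤ rest≤ ⟩
        (1 + treeSize d) * # M? + (1 + residual d) * # M?             ≡⟨ *-distribʳ-+ (# M?) (1 + treeSize d) _ ⟨
        approx * # M?                                                 ∎
        where
        open ≤-Reasoning
        split : ∀ x → Dom x → Core x ⊎ Rest x
        split x (vx , inj₁ cx) = inj₁ cx
        split x (vx , inj₂ ¬c) with core? x
        ... | yes cx = inj₁ cx
        ... | no ¬cx = inj₂ (vx , ¬cx , ¬c)

-- Weighted graphs and star contractions

when-true : ∀ {P : Set} m (P? : Dec P) → P → m when P? ≡ m
when-true m P? p rewrite dec-true P? p = refl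

when-false : ∀ {P : Set} m (P? : Dec P) → ¬ P → m when P? ≡ 0
when-false m P? ¬p rewrite dec-false P? ¬p = refl

when≤ : ∀ {P : Set} m (P? : Dec P) → m when P? ≤ m
when≤ m (yes _) = ≤-refl
when≤ m (no _)  = z≤n

when-mono : ∀ {P : Set} {l m} (P? : Dec P) → (P → l ≤ m) → l when P? ≤ m when P?
when-mono (yes p) f = f p
when-mono (no _)  f = z≤n

0when : ∀ {P : Set} (P? : Dec P) → 0 when P? ≡ 0
0when (yes _) = refl
0when (no _)  = refl

when-swap : ∀ {P Q : Set} m (P? : Dec P) (Q? : Dec Q) → (m when P?) when Q? ≡ (m when Q?) when P?
when-swap m (yes _) (yes _) = refl
when-swap m (yes _) (no _)  = refl
when-swap m (no _)  (yes _) = refl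
when-swap m (no _)  (no _)  = refl

when⁻ : ∀ {P : Set} {m} (P? : Dec P) → 0 < m when P? → P × 0 < m
when⁻ (yes p) 0<m = p , 0<m

∑-when-const : ∀ {n} {P : Set} (P? : Dec P) (f : Fin n → ℕ) → ∑ (λ i → f i when P?) ≡ ∑ f when P?
∑-when-const (yes _) f = refl
∑-when-const (no _)  f = ∑-zero _ λ _ → refl

∑-when′ : ∀ {n} (a : Fin n) (g : Fin n → ℕ) → ∑ (λ x → g x when (a Fin.≟ x)) ≡ g a
∑-when′ a g = trans (∑-cong λ x → when≡* (g x) (a Fin.≟ x)) (∑-single′ a g)

opaque
  unfolding ∑

  ∑-suc : ∀ {n} (f : Fin (suc n) → ℕ) → ∑ f ≡ f zero + ∑ (f ∘ suc)
  ∑-suc f = refl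

∑-threshold : ∀ Θ {m} → m ≤ Θ → ∑ {Θ} (λ θ → 𝟙 (toℕ θ <? m)) ≡ m
∑-threshold zero    z≤n       = ∑-zero _ λ ()
∑-threshold (suc Θ) {zero}  _ = ∑-zero _ λ _ → refl
∑-threshold (suc Θ) {suc m} (s≤s m≤Θ) = trans (∑-suc _) (cong suc (trans
  (∑-cong λ θ → 𝟙-⇔ (suc (toℕ θ) <? suc m) (toℕ θ <? m) ≤-pred s≤s) (∑-threshold Θ m≤Θ)))

maximum : ∀ {n} (r : Vec ℕ (suc n)) → ∃[ j ] ∀ l → lookup r l ≤ lookup r j
maximum {zero}  (x ∷ [])  = zero , λ { zero → ≤-refl }
maximum {suc n} (x ∷ r@(_ ∷ _)) with maximum r
... | j , max with x ≤? lookup r j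
...   | yes x≤ = suc j , λ { zero → x≤ ; (suc l) → max l }
...   | no x≰  = zero , λ { zero → ≤-refl ; (suc l) → ≤-trans (max l) (<⇒≤ (≰⇒> x≰)) }

-- A row of zeros returns `i`, so a vertex without edges becomes a root, pointing to itself.
heaviest : ∀ {n} → Vec ℕ n → Fin n → Fin n
heaviest {suc n} r i with lookup r (proj₁ (maximum r))
... | zero  = i
... | suc _ = proj₁ (maximum r)

heaviest-spec : ∀ {n} (r : Vec ℕ n) i →
                (∀ j → lookup r j ≤ lookup r (heaviest r i)) × (heaviest r i ≡ i ⊎ 0 < lookup r (heaviest r i))
heaviest-spec {suc n} r i with lookup r (proj₁ (maximum r)) in eq
... | zero  = (λ j → ≤-trans (proj₂ (maximum r) j) (≤-trans (≤-reflexive eq) z≤n)) , inj₁ refl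
... | suc _ = proj₂ (maximum r) , inj₂ (subst (0 <_) (sym eq) z<s)

double : ∀ {n} → (Fin n → Fin n → ℕ) → ℕ
double w = ∑ λ x → ∑ λ y → w x y

record Weight (n : ℕ) : Set where
  field
    weight : Fin n → Fin n → ℕ
    comm   : ∀ x y → weight x y ≡ weight y x
    loop   : ∀ x → weight x x ≡ 0

open Weight public

support : ∀ {n} → Weight n → Graph n
support w = record
  { Adj        = λ x y → 0 < weight w x y
  ; adj?       = λ x y → 0 <? weight w x y
  ; adj-sym    = λ {x} {y} → subst (0 <_) (comm w x y)
  ; adj-irrefl = λ { {x} refl 0<w → <-irrefl (sym (loop w x)) 0<w }
  }

LocallySparse : ∀ {n} → ℕ → Graph n → Set₁
LocallySparse d G = ∀ {L : Pred _ 0ℓ} (L? : Decidable L) → degreeSum (restrict L? G) ≤ d * # L?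

contractWeight : ∀ {n} → (Fin n → Fin n) → (Fin n → Fin n → ℕ) → Fin n → Fin n → ℕ
contractWeight g w a b =
  (∑ λ i → (∑ λ j → w i j when (g j Fin.≟ b)) when (g i Fin.≟ a)) when ¬? (a Fin.≟ b)

contracted : ∀ {n} → (Fin n → Fin n) → Weight n → Weight n
contracted g w = record
  { weight = contractWeight g (weight w)
  ; comm   = λ a b → cong₂ (λ m (P : Bool) → if P then m else 0) (exchange g a b) (flip a b)
  ; loop   = λ a → when-false _ (¬? (a Fin.≟ a)) λ a≢a → a≢a refl
  }
  where
  flip : ∀ a b → does (¬? (a Fin.≟ b)) ≡ does (¬? (b Fin.≟ a))
  flip a b with a Fin.≟ b | b Fin.≟ a
  ... | yes _   | yes _   = refl
  ... | no _    | no _    = refl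
  ... | yes a≡b | no b≢a  = contradiction (sym a≡b) b≢a
  ... | no a≢b  | yes b≡a = contradiction (sym b≡a) a≢b
  exchange : ∀ g a b → (∑ λ i → (∑ λ j → weight w i j when (g j Fin.≟ b)) when (g i Fin.≟ a)) ≡
                   (∑ λ i → (∑ λ j → weight w i j when (g j Fin.≟ a)) when (g i Fin.≟ b))
  exchange g a b = trans (∑-cong λ i → sym (∑-when-const (g i Fin.≟ a) _)) (trans (∑-swap _)
    (∑-cong λ j → trans (∑-cong λ i → trans (when-swap _ (g j Fin.≟ b) (g i Fin.≟ a))
      (cong (λ z → (z when (g i Fin.≟ a)) when (g j Fin.≟ b)) (comm w i j))) (∑-when-const (g j Fin.≟ b) _)))

-- Both sides sort the pairs of vertices by their images under `g`. The filter `Φ` is there to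
-- follow edges through several contractions.
double-contractWeight : ∀ {n} (g : Fin n → Fin n) w {Φ : Fin n → Fin n → Set} (Φ? : B.Decidable Φ) →
  double (λ a b → contractWeight g w a b when Φ? a b) ≡
  double (λ i j → (w i j when ¬? (g i Fin.≟ g j)) when Φ? (g i) (g j))
double-contractWeight {n} g w Φ? = begin
  (∑ λ a → ∑ λ b → on a b (∑ λ i → (∑ λ j → w i j when (g j Fin.≟ b)) when (g i Fin.≟ a)))
    ≡⟨ (∑-cong λ a → ∑-cong λ b → trans (sym (on-∑ a b _)) (∑-cong λ i →
         trans (on-when a b (g i Fin.≟ a)) (cong (_when (g i Fin.≟ a)) (sym (on-∑ a b λ j → w i j when (g j Fin.≟ b)))))) ⟩
  (∑ λ a → ∑ λ b → ∑ λ i → (∑ λ j → on a b (w i j when (g j Fin.≟ b))) when (g i Fin.≟ a))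
    ≡⟨ (∑-cong λ a → trans (∑-swap _) (∑-cong λ i → trans (∑-when-const (g i Fin.≟ a) _) (cong (_when (g i Fin.≟ a))
         (trans (∑-swap _) (∑-cong λ j → trans (∑-cong λ b → on-when a b (g j Fin.≟ b))
           (∑-when′ (g j) λ b → on a b (w i j))))))) ⟩
  (∑ λ a → ∑ λ i → (∑ λ j → on a (g j) (w i j)) when (g i Fin.≟ a))
    ≡⟨ ∑-swap _ ⟩
  (∑ λ i → ∑ λ a → (∑ λ j → on a (g j) (w i j)) when (g i Fin.≟ a))
    ≡⟨ (∑-cong λ i → ∑-when′ (g i) λ a → ∑ λ j → on a (g j) (w i j)) ⟩
  (∑ λ i → ∑ λ j → on (g i) (g j) (w i j)) ∎
  where
  open ≡-Reasoning
  on : Fin n → Fin n → ℕ → ℕ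
  on a b m = (m when ¬? (a Fin.≟ b)) when Φ? a b
  on-∑ : ∀ a b (f : Fin n → ℕ) → ∑ (λ i → on a b (f i)) ≡ on a b (∑ f)
  on-∑ a b f = trans (∑-when-const (Φ? a b) _) (cong (_when Φ? a b) (∑-when-const (¬? (a Fin.≟ b)) f))
  on-when : ∀ a b {P : Set} {m} (P? : Dec P) → on a b (m when P?) ≡ on a b m when P?
  on-when a b P? = trans (cong (_when Φ? a b) (when-swap _ P? (¬? (a Fin.≟ b)))) (when-swap _ P? (Φ? a b))

contractWeight⁻ : ∀ {n} (g : Fin n → Fin n) w {a b} → 0 < contractWeight g w a b →
  a ≢ b × ∃[ i ] ∃[ j ] (g i ≡ a × g j ≡ b × 0 < w i j)
contractWeight⁻ g w {a} {b} 0<c with when⁻ (¬? (a Fin.≟ b)) 0<c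
... | a≢b , 0<∑ with ∑-positive _ 0<∑
...   | i , 0<i with when⁻ (g i Fin.≟ a) 0<i
...     | gi , 0<∑′ with ∑-positive _ 0<∑′
...       | j , 0<j with when⁻ (g j Fin.≟ b) 0<j
...         | gj , 0<w = a≢b , i , j , gi , gj , 0<w

contractWeight⁺ : ∀ {n} (g : Fin n → Fin n) w {i j} → g i ≢ g j → w i j ≤ contractWeight g w (g i) (g j)
contractWeight⁺ g w {i} {j} gi≢gj = ≤-trans
  (≤-trans (≤-trans (≤-reflexive (sym (when-true (w i j) (g j Fin.≟ g j) refl)))
                    (term≤∑ (λ l → w i l when (g l Fin.≟ g j)) j))
           (≤-trans (≤-reflexive (sym (when-true _ (g i Fin.≟ g i) refl)))
                    (term≤∑ (λ m → (∑ λ l → w m l when (g l Fin.≟ g j)) when (g m Fin.≟ g i)) i)))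
  (≤-reflexive (sym (when-true _ (¬? (g i Fin.≟ g j)) gi≢gj)))

module _ {n} (w : Weight n) where

  -- Layer cake: w x y ≤ min (ω x) (ω y), and for every θ the vertices with ω > θ span
  -- few edges.
  double≤heaviest : ∀ {d} → LocallySparse d (support w) → (ω : Fin n → ℕ) → (∀ x y → weight w x y ≤ ω x) →
                    double (weight w) ≤ d * ∑ ω
  double≤heaviest {d} sparse ω w≤ω = begin
    double (weight w)
      ≤⟨ ∑-mono (λ x → ∑-mono λ y → layers x y) ⟩
    (∑ λ x → ∑ λ y → ∑ {Θ} λ θ → adj (layer θ) x y)
      ≡⟨ trans (∑-cong λ x → ∑-swap _) (∑-swap _) ⟩
    (∑ {Θ} λ θ → degreeSum (layer θ))
      ≤⟨ ∑-mono (λ θ → sparse (above? θ)) ⟩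
    (∑ {Θ} λ θ → d * # (above? θ))
      ≡⟨ *-∑ d _ ⟨
    d * (∑ {Θ} λ θ → # (above? θ))
      ≡⟨ cong (d *_) (trans (∑-swap _) (∑-cong λ x → ∑-threshold Θ (term≤∑ ω x))) ⟩
    d * ∑ ω ∎
    where
    open ≤-Reasoning
    Θ = ∑ ω
    above? : ∀ θ → Decidable (λ x → toℕ θ < ω x)
    above? θ x = toℕ θ <? ω x
    layer : Fin Θ → Graph n
    layer θ = restrict (above? θ) (support w)
    layers : ∀ x y → weight w x y ≤ ∑ {Θ} λ θ → adj (layer θ) x y
    layers x y = ≤-trans (≤-reflexive (sym (∑-threshold Θ (≤-trans (w≤ω x y) (term≤∑ ω x)))))
      (∑-mono λ θ → 𝟙-mono (toℕ θ <? weight w x y) (adj? (layer θ) x y) λ θ<w →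
        <-≤-trans θ<w (w≤ω x y) , <-≤-trans θ<w (≤-trans (≤-reflexive (comm w x y)) (w≤ω y x)) , ≤-<-trans z≤n θ<w)

-- Sender and receiver factors of a label (true = sender): twice the conditional probability
-- that a uniformly random completion makes the vertex a sender, or a receiver.
sending receiving : Maybe Bool → ℕ
sending nothing        = 1
sending (just true)    = 2
sending (just false)   = 0
receiving nothing      = 1
receiving (just true)  = 0
receiving (just false) = 2

-- Labels are chosen one colour class after the other by the method of conditional
-- expectations, so that the edges i → p i from a sender to a receiver carry at least a
-- quarter of the total weight.
decide : ℕ → ℕ → Bool
decide out into = does (into ≤? out)

joinedLabels? : (x y : Maybe Bool) → Dec (x ≡ just true × y ≡ just false)
joinedLabels? (just true)  (just false) = yes (refl , refl)
joinedLabels? (just true)  (just true)  = no λ ()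
joinedLabels? (just true)  nothing      = no λ ()
joinedLabels? (just false) y            = no λ ()
joinedLabels? nothing      y            = no λ ()

module Labelling {n} (p : Fin n → Fin n) (ω : Fin n → ℕ) (col : Fin n → ℕ) where

  outgoing : (Fin n → Maybe Bool) → Fin n → ℕ
  outgoing ℓ i = ω i * receiving (ℓ (p i))

  incoming : (Fin n → Maybe Bool) → Fin n → ℕ
  incoming ℓ i = ∑ λ j → (ω j * sending (ℓ j)) when (p j Fin.≟ i)

  label : ℕ → Fin n → Maybe Bool
  label zero    i = nothing
  label (suc m) i = if does (col i ≟ m) then just (decide (outgoing (label m) i) (incoming (label m) i)) else label m i

  Joined : ℕ → Fin n → Set
  Joined q i = label q i ≡ just true × label q (p i) ≡ just false

  joined? : ∀ q → Decidable (Joined q)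
  joined? q i = joinedLabels? (label q i) (label q (p i))

  star : ℕ → Fin n → Fin n
  star q i = if does (joined? q i) then p i else i

  star-joined : ∀ q {i} → Joined q i → star q i ≡ p i
  star-joined q {i} ji rewrite dec-true (joined? q i) ji = refl

  star-¬joined : ∀ q {i} → ¬ Joined q i → star q i ≡ i
  star-¬joined q {i} ¬ji rewrite dec-false (joined? q i) ¬ji = refl

  star-p : ∀ q {i} → Joined q i → star q (p i) ≡ p i
  star-p q (_ , r) = star-¬joined q λ (s , _) → case trans (sym r) s of λ ()

  star-idem : ∀ q i → star q (star q i) ≡ star q i
  star-idem q i with joined? q i
  ... | yes ji = star-p q ji
  ... | no ¬ji = star-¬joined q ¬ji

  module _ (proper : ∀ i → p i ≢ i → col i ≢ col (p i)) (root : ∀ {i} → p i ≡ i → ω i ≡ 0) where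

    unchanged : ∀ m {i} → col i ≢ m → label (suc m) i ≡ label m i
    unchanged m {i} c≢m rewrite dec-false (col i ≟ m) c≢m = refl

    decided : ∀ m {i} → col i ≡ m → label (suc m) i ≡ just (decide (outgoing (label m) i) (incoming (label m) i))
    decided m {i} c≡m rewrite dec-true (col i ≟ m) c≡m = refl

    unlabelled : ∀ m i → m ≤ col i → label m i ≡ nothing
    unlabelled zero    i _   = refl
    unlabelled (suc m) i m<c = trans (unchanged m λ c≡m → <-irrefl (sym c≡m) m<c) (unlabelled m i (<⇒≤ m<c))

    labelled : ∀ m {i} → col i < m → ∃[ b ] label m i ≡ just b
    labelled (suc m) {i} c<m = case col i ≟ m of λ where
      (yes c≡m) → _ , decided m c≡m
      (no c≢m)  → map₂ (trans (unchanged m c≢m)) (labelled m (≤∧≢⇒< (≤-pred c<m) c≢m))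

    -- Four times the expected contribution of the edge from `j` to `p j` when the missing labels
    -- are random: `ω j` at the start; in the end `4 * ω j` for joined edges and 0 for all others.
    potential : ℕ → Fin n → ℕ
    potential m j = ω j * (sending (label m j) * receiving (label m (p j)))

    module _ (m : ℕ) where

      active? : Decidable (λ i → col i ≡ m)
      active? i = col i ≟ m

      -- Edges are sorted by which end has colour `m`. Properness excludes both ends, except at
      -- roots, which carry no weight; hence `split` is exact.
      own into rest : ℕ → Fin n → ℕ
      own  k j = potential k j when active? j
      into k j = potential k j when active? (p j)
      rest k j = (potential k j when ¬? (active? j)) when ¬? (active? (p j))

      no-weight : ∀ k {j} → p j ≡ j → potential k j ≡ 0
      no-weight k pj≡j rewrite root pj≡j = refl

      split : ∀ k j → potential k j ≡ own k j + into k j + rest k j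
      split k j = go (p j Fin.≟ j) (active? j) (active? (p j))
        where
        go : Dec (p j ≡ j) → (a : Dec (col j ≡ m)) (b : Dec (col (p j) ≡ m)) →
             potential k j ≡ (potential k j when a) + (potential k j when b) + ((potential k j when ¬? a) when ¬? b)
        go (yes pj≡j) a b rewrite no-weight k pj≡j | 0when a | 0when b | 0when (¬? a) | 0when (¬? b) = refl
        go (no pj≢j) (yes a) (yes b) = contradiction (trans a (sym b)) (proper j pj≢j)
        go (no pj≢j) (yes a) (no b)  = sym (trans (+-identityʳ _) (+-identityʳ _))
        go (no pj≢j) (no a)  (yes b) = sym (+-identityʳ _)
        go (no pj≢j) (no a)  (no b)  = refl

      rest-unchanged : ∀ j → rest m j ≡ rest (suc m) j
      rest-unchanged j = go (active? j) (active? (p j))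
        where
        go : (a : Dec (col j ≡ m)) (b : Dec (col (p j) ≡ m)) →
             (potential m j when ¬? a) when ¬? b ≡ (potential (suc m) j when ¬? a) when ¬? b
        go (yes _) b = refl
        go (no _) (yes _) = refl
        go (no a) (no b) = sym (cong₂ (λ x y → ω j * (sending x * receiving y)) (unchanged m a) (unchanged m b))

      around : ℕ → Fin n → ℕ
      around k i = potential k i + ∑ (λ j → potential k j when (p j Fin.≟ i))

      regroup : ∀ k → ∑ (own k) + ∑ (into k) ≡ ∑ λ i → around k i when active? i
      regroup k = trans (cong (∑ (own k) +_) into-regroup) (trans (sym (∑-+ (own k) _))
        (∑-cong λ i → distrib (potential k i) (∑ λ j → potential k j when (p j Fin.≟ i)) (active? i)))
        where
        distrib : ∀ {P : Set} x y (P? : Dec P) → (x when P?) + (y when P?) ≡ (x + y) when P?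
        distrib x y (yes _) = refl
        distrib x y (no _)  = refl
        into-regroup : ∑ (into k) ≡ ∑ λ i → (∑ λ j → potential k j when (p j Fin.≟ i)) when active? i
        into-regroup = trans (∑-cong λ j → sym (∑-when′ (p j) λ i → potential k j when active? i))
          (trans (∑-swap _) (∑-cong λ i → trans (∑-cong λ j → when-swap (potential k j) (active? i) (p j Fin.≟ i))
            (∑-when-const (active? i) _)))

      -- Before the decision the edges at `i` contribute `out + into′`. A sender doubles `out` and
      -- loses `into′`, a receiver does the reverse; the larger doubled value is at least the sum.
      around-grows : ∀ i → col i ≡ m → around m i ≤ around (suc m) i
      around-grows i ci = ≤-trans (≤-reflexive (cong₂ _+_ before-out before-in)) (compare′ (into′ ≤? out) refl)
        where
        out into′ : ℕ
        out = outgoing (label m) i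
        into′ = incoming (label m) i
        before-out : potential m i ≡ out
        before-out rewrite unlabelled m i (≤-reflexive (sym ci)) = cong (ω i *_) (+-identityʳ _)
        before-in : ∑ (λ j → potential m j when (p j Fin.≟ i)) ≡ into′
        before-in = ∑-cong λ j → go j (p j Fin.≟ i)
          where
          go : ∀ j → (e : Dec (p j ≡ i)) → potential m j when e ≡ (ω j * sending (label m j)) when e
          go j (no _) = refl
          go j (yes pj≡i) rewrite pj≡i | unlabelled m i (≤-reflexive (sym ci)) = cong (ω j *_) (*-identityʳ _)
        new : Maybe Bool
        new = label (suc m) i
        after-out : new ≡ just true → potential (suc m) i ≡ out + out
        after-out eq = go (p i Fin.≟ i)
          where
          go : Dec (p i ≡ i) → potential (suc m) i ≡ out + out
          go (yes pi≡i) rewrite no-weight (suc m) pi≡i | root pi≡i = refl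
          go (no pi≢i) rewrite eq | unchanged m {p i} (λ cpi → proper i pi≢i (trans ci (sym cpi))) =
            solve 2 (λ a b → a :* (con 2 :* b) := a :* b :+ a :* b) refl (ω i) (receiving (label m (p i)))
        after-in : new ≡ just false → ∑ (λ j → potential (suc m) j when (p j Fin.≟ i)) ≡ into′ + into′
        after-in eq = trans (∑-cong λ j → go j (p j Fin.≟ i)) (∑-+ _ _)
          where
          go : ∀ j → (e : Dec (p j ≡ i)) →
               potential (suc m) j when e ≡ ((ω j * sending (label m j)) when e) + ((ω j * sending (label m j)) when e)
          go j (no _) = refl
          go j (yes pj≡i) with j Fin.≟ i
          ... | yes refl rewrite root pj≡i = refl
          ... | no j≢i = trans
            (cong₂ (λ x y → ω j * (sending x * receiving y))
              (unchanged m λ cj → proper j (λ pj≡j → j≢i (trans (sym pj≡j) pj≡i)) (trans cj (sym (trans (cong col pj≡i) ci))))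
              (trans (cong (label (suc m)) pj≡i) eq))
            (solve 2 (λ a b → a :* (b :* con 2) := a :* b :+ a :* b) refl (ω j) (sending (label m j)))
        compare′ : (c : Dec (into′ ≤ out)) → c ≡ (into′ ≤? out) → out + into′ ≤ around (suc m) i
        compare′ (yes into≤out) eq = ≤-trans (+-monoʳ-≤ out into≤out)
          (≤-trans (≤-reflexive (sym (after-out (trans (decided m ci) (cong (just ∘ does) (sym eq)))))) (m≤m+n _ _))
        compare′ (no into≰out) eq = ≤-trans (+-monoˡ-≤ into′ (<⇒≤ (≰⇒> into≰out)))
          (≤-trans (≤-reflexive (sym (after-in (trans (decided m ci) (cong (just ∘ does) (sym eq)))))) (m≤n+m _ _))

      potential-grows : ∑ (potential m) ≤ ∑ (potential (suc m))
      potential-grows = begin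
        ∑ (potential m)                                           ≡⟨ total m ⟩
        ∑ (λ i → around m i when active? i) + ∑ (rest m)          ≤⟨ +-mono-≤ (∑-mono λ i → when-mono (active? i) (around-grows i))
                                                                       (≤-reflexive (∑-cong rest-unchanged)) ⟩
        ∑ (λ i → around (suc m) i when active? i) + ∑ (rest (suc m)) ≡⟨ total (suc m) ⟨
        ∑ (potential (suc m))                                     ∎
        where
        open ≤-Reasoning
        total : ∀ k → ∑ (potential k) ≡ ∑ (λ i → around k i when active? i) + ∑ (rest k)
        total k = trans (∑-cong (split k)) (trans (∑-+ _ (rest k))
          (cong (_+ ∑ (rest k)) (trans (∑-+ (own k) (into k)) (regroup k))))

    potential≥ : ∀ m → ∑ ω ≤ ∑ (potential m)
    potential≥ zero    = ≤-reflexive (∑-cong λ i → sym (*-identityʳ (ω i)))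
    potential≥ (suc m) = ≤-trans (potential≥ m) (potential-grows m)

    joined-weight : ∀ q → (∀ i → col i < q) → ∑ ω ≤ 4 * ∑ (λ i → ω i when joined? q i)
    joined-weight q col<q = ≤-trans (potential≥ q) (≤-trans (∑-mono pt) (≤-reflexive (sym (*-∑ 4 _))))
      where
      pt : ∀ i → potential q i ≤ 4 * (ω i when joined? q i)
      pt i with label q i | label q (p i) | labelled q (col<q i) | labelled q (col<q (p i))
      ... | just false | just b     | _ | _ = ≤-trans (≤-reflexive (*-zeroʳ (ω i))) z≤n
      ... | just true  | just true  | _ | _ = ≤-trans (≤-reflexive (*-zeroʳ (ω i))) z≤n
      ... | just true  | just false | _ | _ = ≤-reflexive (*-comm (ω i) 4)

module _ {n} (w : Weight n) (p : Fin n → Fin n) (col : Fin n → ℕ)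
  (heavy : ∀ i j → weight w i j ≤ weight w i (p i))
  (proper : ∀ i → p i ≢ i → col i ≢ col (p i)) where

  private
    ω : Fin n → ℕ
    ω i = weight w i (p i)
  open Labelling p ω col

  -- `W ≤ d * ∑ ω` and `∑ ω ≤ 4 * Ω`, where the weight `Ω` of the pointers inside stars is lost in
  -- the contraction.
  contraction-shrinks : ∀ {d} → LocallySparse d (support w) → ∀ q → (∀ i → col i < q) →
    double (weight w) + 4 * d * double (weight (contracted (star q) w)) ≤ 4 * d * double (weight w)
  contraction-shrinks {d} sparse q col<q = begin
    W + 4 * d * W′                                   ≤⟨ +-monoˡ-≤ _ (double≤heaviest w {d} sparse ω heavy) ⟩
    d * ∑ ω + 4 * d * W′                             ≤⟨ +-monoˡ-≤ _ (*-monoʳ-≤ d (joined-weight proper root q col<q)) ⟩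
    d * (4 * Ω) + 4 * d * W′                         ≡⟨ solve 3 (λ d j w → d :* (con 4 :* j) :+ con 4 :* d :* w := con 4 :* d :* (j :+ w)) refl d Ω W′ ⟩
    4 * d * (Ω + W′)                                 ≤⟨ *-monoʳ-≤ (4 * d) inner ⟩
    4 * d * W                                        ∎
    where
    open ≤-Reasoning
    W  = double (weight w)
    W′ = double (weight (contracted (star q) w))
    Ω  = ∑ λ i → ω i when joined? q i
    root : ∀ {i} → p i ≡ i → ω i ≡ 0
    root {i} pi≡i = trans (cong (weight w i) pi≡i) (loop w i)
    g = star q
    within : ∀ i → ω i when joined? q i ≤ ∑ λ j → weight w i j when (g i Fin.≟ g j)
    within i with joined? q i in eq
    ... | no _   = z≤n
    ... | yes ji = ≤-trans (≤-reflexive (sym (when-true (ω i) (p i Fin.≟ g (p i)) (sym (star-p q ji)))))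
      (term≤∑ (λ j → weight w i j when (p i Fin.≟ g j)) (p i))
    inner : Ω + W′ ≤ W
    inner = begin
      Ω + W′
        ≤⟨ +-mono-≤ (∑-mono within) (≤-reflexive (trans (∑-cong λ a → ∑-cong λ b → sym (when-true _ (yes tt) tt))
                                                        (double-contractWeight g (weight w) λ _ _ → yes tt))) ⟩
      (∑ λ i → ∑ λ j → weight w i j when (g i Fin.≟ g j)) + (∑ λ i → ∑ λ j → weight w i j when ¬? (g i Fin.≟ g j))
        ≡⟨ trans (sym (∑-+ _ _)) (∑-cong λ i → trans (sym (∑-+ _ _)) (∑-cong λ j → both (weight w i j) (g i Fin.≟ g j))) ⟩
      W ∎
      where
      both : ∀ {P : Set} m (P? : Dec P) → (m when P?) + (m when ¬? P?) ≡ m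
      both m (yes _) = +-identityʳ m
      both m (no _)  = refl

-- Colour reduction and the iterated logarithm

lowBit : ℕ → ℕ
lowBit zero          = 0
lowBit (suc zero)    = 1
lowBit (suc (suc n)) = lowBit n

bit : ℕ → ℕ → ℕ
bit zero    x = lowBit x
bit (suc j) x = bit j ⌊ x /2⌋

lowBit<2 : ∀ n → lowBit n < 2
lowBit<2 zero          = z<s
lowBit<2 (suc zero)    = ≤-refl
lowBit<2 (suc (suc n)) = lowBit<2 n

bit<2 : ∀ j x → bit j x < 2
bit<2 zero    x = lowBit<2 x
bit<2 (suc j) x = bit<2 j ⌊ x /2⌋

lowBit+2⌊/2⌋ : ∀ n → lowBit n + 2 * ⌊ n /2⌋ ≡ n
lowBit+2⌊/2⌋ zero          = refl
lowBit+2⌊/2⌋ (suc zero)    = refl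
lowBit+2⌊/2⌋ (suc (suc n)) = trans
  (solve 2 (λ p h → p :+ con 2 :* (con 1 :+ h) := con 2 :+ (p :+ con 2 :* h)) refl (lowBit n) ⌊ n /2⌋)
  (cong (2 +_) (lowBit+2⌊/2⌋ n))

lowBit-unique : ∀ {b b′} j j′ → b < 2 → b′ < 2 → b + 2 * j ≡ b′ + 2 * j′ → b ≡ b′ × j ≡ j′
lowBit-unique {b} {b′} j j′ b<2 b′<2 eq =
  trans (sym (p b j b<2)) (trans (cong lowBit eq) (p b′ j′ b′<2)) ,
  trans (sym (h b j b<2)) (trans (cong ⌊_/2⌋ eq) (h b′ j′ b′<2))
  where
  unfold : ∀ b j → b + 2 * suc j ≡ 2 + (b + 2 * j)
  unfold = solve 2 (λ b j → b :+ con 2 :* (con 1 :+ j) := con 2 :+ (b :+ con 2 :* j)) refl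
  p : ∀ b j → b < 2 → lowBit (b + 2 * j) ≡ b
  p b (suc j) b<2              = trans (cong lowBit (unfold b j)) (p b j b<2)
  p zero zero _                = refl
  p (suc zero) zero _          = refl
  p (suc (suc _)) zero (s≤s (s≤s ()))
  h : ∀ b j → b < 2 → ⌊ b + 2 * j /2⌋ ≡ j
  h b (suc j) b<2              = trans (cong ⌊_/2⌋ (unfold b j)) (cong suc (h b j b<2))
  h zero zero _                = refl
  h (suc zero) zero _          = refl
  h (suc (suc _)) zero (s≤s (s≤s ()))

firstDifference : ℕ → ℕ → ℕ → ℕ
firstDifference zero    x y = 0
firstDifference (suc f) x y =
  if does (lowBit x ≟ lowBit y) then suc (firstDifference f ⌊ x /2⌋ ⌊ y /2⌋) else 0

halves≢ : ∀ {x y} → x ≢ y → lowBit x ≡ lowBit y → ⌊ x /2⌋ ≢ ⌊ y /2⌋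
halves≢ {x} {y} x≢y px≡py hx≡hy = x≢y (trans (sym (lowBit+2⌊/2⌋ x)) (trans (cong₂ (λ p h → p + 2 * h) px≡py hx≡hy) (lowBit+2⌊/2⌋ y)))

halves-fuel : ∀ {f x y} → x ≢ y → x + y ≤ suc f → ⌊ x /2⌋ + ⌊ y /2⌋ ≤ f
halves-fuel {x = zero}  {zero}  x≢y _ = contradiction refl x≢y
halves-fuel {x = zero}  {suc y} _ le  = ≤-trans (≤-pred (⌊n/2⌋<n y)) (≤-pred le)
halves-fuel {x = suc x} {y}     _ le  = ≤-trans (+-mono-≤ (≤-pred (⌊n/2⌋<n x)) (⌊n/2⌋≤n y)) (≤-pred le)

bit-difference : ∀ f {x y} → x ≢ y → x + y ≤ f → bit (firstDifference f x y) x ≢ bit (firstDifference f x y) y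
bit-difference zero {zero} {zero} x≢y _ = contradiction refl x≢y
bit-difference (suc f) {x} {y} x≢y x+y≤f with lowBit x ≟ lowBit y
... | yes px≡py rewrite dec-true (lowBit x ≟ lowBit y) px≡py = bit-difference f (halves≢ x≢y px≡py) (halves-fuel x≢y x+y≤f)
... | no px≢py rewrite dec-false (lowBit x ≟ lowBit y) px≢py = px≢py

⌊/2⌋<2^ : ∀ {m x} → x < 2 ^ suc m → ⌊ x /2⌋ < 2 ^ m
⌊/2⌋<2^ {m} {x} x<2^ = *-cancelˡ-< 2 _ _ (≤-<-trans (≤-trans (m≤n+m _ (lowBit x)) (≤-reflexive (lowBit+2⌊/2⌋ x))) x<2^)

firstDifference< : ∀ f m {x y} → x ≢ y → x + y ≤ f → x < 2 ^ m → y < 2 ^ m → firstDifference f x y < m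
firstDifference< zero m {zero} {zero} x≢y _ _ _ = contradiction refl x≢y
firstDifference< (suc f) zero {zero} {zero} x≢y _ _ _ = contradiction refl x≢y
firstDifference< (suc f) zero {suc x} x≢y _ (s≤s ()) _
firstDifference< (suc f) zero {zero} {suc y} x≢y _ _ (s≤s ())
firstDifference< (suc f) (suc m) {x} {y} x≢y x+y≤f x<2^ y<2^ with lowBit x ≟ lowBit y
... | yes px≡py rewrite dec-true (lowBit x ≟ lowBit y) px≡py =
  s≤s (firstDifference< f m (halves≢ x≢y px≡py) (halves-fuel x≢y x+y≤f) (⌊/2⌋<2^ {m} x<2^) (⌊/2⌋<2^ {m} y<2^))
... | no px≢py rewrite dec-false (lowBit x ≟ lowBit y) px≢py = z<s

-- Encodes the lowest position in which `x` differs from the colour `y` of the parent, together with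
-- the bit of `x` there. The fuel `x + y` suffices since halving decreases the sum of two distinct
-- colours.
reduceColour : ℕ → ℕ → ℕ
reduceColour x y = bit (firstDifference (x + y) x y) x + 2 * firstDifference (x + y) x y

reduceColour< : ∀ {m x y} → x ≢ y → x < 2 ^ m → y < 2 ^ m → reduceColour x y < 2 * m
reduceColour< {m} {x} {y} x≢y x<2^ y<2^ = begin-strict
  reduceColour x y       <⟨ +-monoˡ-< (2 * j) (bit<2 j x) ⟩
  2 + 2 * j              ≡⟨ *-suc 2 j ⟨
  2 * suc j              ≤⟨ *-monoʳ-≤ 2 (firstDifference< (x + y) m x≢y ≤-refl x<2^ y<2^) ⟩
  2 * m                  ∎
  where
  open ≤-Reasoning
  j = firstDifference (x + y) x y

-- Equal values would mean that the parent chose the same position and has the same bit there, but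
-- this position was chosen because `x` and `y` differ in it. The colour `z` of the grandparent is
-- arbitrary.
reduceColour-proper : ∀ {x y} z → x ≢ y → reduceColour x y ≢ reduceColour y z
reduceColour-proper {x} {y} z x≢y eq
  with lowBit-unique (firstDifference (x + y) x y) (firstDifference (y + z) y z)
         (bit<2 (firstDifference (x + y) x y) x) (bit<2 (firstDifference (y + z) y z) y) eq
... | b≡b′ , j≡j′ = bit-difference (x + y) x≢y ≤-refl (trans b≡b′ (cong (λ j → bit j y) (sym j≡j′)))

-- A root behaves as if it had chosen position 0.
reduceColour-proper-root : ∀ {x y} → x ≢ y → reduceColour x y ≢ lowBit y
reduceColour-proper-root {x} {y} x≢y eq
  with lowBit-unique (firstDifference (x + y) x y) 0 (bit<2 (firstDifference (x + y) x y) x) (lowBit<2 y)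
         (trans eq (sym (+-identityʳ (lowBit y))))
... | b≡b′ , j≡0 = bit-difference (x + y) x≢y ≤-refl (trans b≡b′ (cong (λ j → bit j y) (sym j≡0)))

tower : ℕ → ℕ
tower zero    = 1
tower (suc k) = 2 ^ tower k

tower≥1 : ∀ k → 1 ≤ tower k
tower≥1 zero    = ≤-refl
tower≥1 (suc k) = m^n>0 2 (tower k)

n<2^n : ∀ n → n < 2 ^ n
n<2^n zero    = ≤-refl
n<2^n (suc n) = begin
  2 + n           ≤⟨ +-mono-≤ (m^n>0 2 n) (n<2^n n) ⟩
  2 ^ n + 2 ^ n   ≡⟨ cong (2 ^ n +_) (+-identityʳ _) ⟨
  2 ^ suc n       ∎
  where open ≤-Reasoning

tower-double : ∀ k → 2 * tower k ≤ tower (suc k)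
tower-double k with tower k | tower≥1 k
... | suc x | _ = *-monoʳ-≤ 2 (n<2^n x)

opaque
  -- Eight is `4 * tower 1`, the bound that `colour<` gives after `L` steps.
  palette : ℕ
  palette = 8

-- Cole–Vishkin colour reduction along the edges i → p i.
module Colouring {n} (p : Fin n → Fin n) where

  colour : ℕ → Fin n → ℕ
  colour zero    i = toℕ i
  colour (suc m) i =
    if does (p i Fin.≟ i) then lowBit (colour m i) else reduceColour (colour m i) (colour m (p i))

  colour-root : ∀ m {i} → p i ≡ i → colour (suc m) i ≡ lowBit (colour m i)
  colour-root m {i} pi≡i rewrite dec-true (p i Fin.≟ i) pi≡i = refl

  colour-inner : ∀ m {i} → p i ≢ i → colour (suc m) i ≡ reduceColour (colour m i) (colour m (p i))
  colour-inner m {i} pi≢i rewrite dec-false (p i Fin.≟ i) pi≢i = refl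

  colour-proper : ∀ m i → p i ≢ i → colour m i ≢ colour m (p i)
  colour-proper zero    i pi≢i eq = pi≢i (sym (toℕ-injective eq))
  colour-proper (suc m) i pi≢i eq = case p (p i) Fin.≟ p i of λ where
    (yes root) → reduceColour-proper-root (colour-proper m i pi≢i)
      (trans (sym (colour-inner m pi≢i)) (trans eq (colour-root m root)))
    (no inner) → reduceColour-proper (colour m (p (p i))) (colour-proper m i pi≢i)
      (trans (sym (colour-inner m pi≢i)) (trans eq (colour-inner m inner)))

  colour<2* : ∀ m b → 1 ≤ b → (∀ i → colour m i < 2 ^ b) → ∀ i → colour (suc m) i < 2 * b
  colour<2* m b 1≤b small i = case p i Fin.≟ i of λ where
    (yes root) → subst (_< 2 * b) (sym (colour-root m root)) (<-≤-trans (lowBit<2 (colour m i)) (*-monoʳ-≤ 2 1≤b))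
    (no inner) → subst (_< 2 * b) (sym (colour-inner m inner)) (reduceColour< {b} (colour-proper m i inner) (small i) (small (p i)))

  -- 4 * tower (suc k) is 2 ^ (2 + tower k), and 2 * (2 + tower k) ≤ 4 * tower (suc (pred k)).
  colour< : ∀ L → n ≤ tower L → ∀ m i → colour m i < 4 * tower (suc (L ∸ m))
  colour< L n≤ zero    i = begin-strict
    toℕ i                 <⟨ toℕ<n i ⟩
    n                     ≤⟨ n≤ ⟩
    tower L               ≤⟨ m≤n*m (tower L) 2 ⟩
    2 * tower L           ≤⟨ tower-double L ⟩
    tower (suc L)         ≤⟨ m≤n*m (tower (suc L)) 4 ⟩
    4 * tower (suc L)     ∎
    where open ≤-Reasoning
  colour< L n≤ (suc m) i = <-≤-trans
    (colour<2* m (2 + tower (L ∸ m)) (s≤s z≤n) (λ j → subst (colour m j <_) 4* (colour< L n≤ m j)) i)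
    (subst (λ k → 2 * (2 + tower (L ∸ m)) ≤ 4 * tower (suc k)) (pred[m∸n]≡m∸[1+n] L m) (shrink (L ∸ m)))
    where
    4* : 4 * tower (suc (L ∸ m)) ≡ 2 ^ (2 + tower (L ∸ m))
    4* = *-assoc 2 2 (tower (suc (L ∸ m)))
    shrink : ∀ k → 2 * (2 + tower k) ≤ 4 * tower (suc (pred k))
    shrink zero    = s≤s (s≤s (s≤s (s≤s (s≤s (s≤s z≤n)))))
    shrink (suc k) = begin
      2 * (2 + tower (suc k))              ≤⟨ *-monoʳ-≤ 2 (+-monoˡ-≤ (tower (suc k)) (^-monoʳ-≤ 2 (tower≥1 k))) ⟩
      2 * (tower (suc k) + tower (suc k))  ≡⟨ solve 1 (λ t → con 2 :* (t :+ t) := con 4 :* t) refl (tower (suc k)) ⟩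
      4 * tower (suc k)                    ∎
      where open ≤-Reasoning

  opaque
    unfolding palette

    colour<palette : ∀ L → n ≤ tower L → ∀ i → colour L i < palette
    colour<palette L n≤ i = subst (λ k → colour L i < 4 * tower (suc k)) (n∸n≡0 L) (colour< L n≤ L i)

-- The iterated logarithm as an inverse of the tower function

n≤2^⌈log₂n⌉ : ∀ n → n ≤ 2 ^ ⌈log₂ n ⌉
n≤2^⌈log₂n⌉ = <-rec _ go
  where
  open ≤-Reasoning
  go : ∀ n → (∀ {m} → m < n → m ≤ 2 ^ ⌈log₂ m ⌉) → n ≤ 2 ^ ⌈log₂ n ⌉
  go zero          _   = z≤n
  go (suc zero)    _   = ≤-refl
  go n@(suc (suc m)) rec = begin
    n                                ≡⟨ ⌊n/2⌋+⌈n/2⌉≡n n ⟨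
    ⌊ n /2⌋ + ⌈ n /2⌉                ≤⟨ +-monoˡ-≤ ⌈ n /2⌉ (⌊n/2⌋≤⌈n/2⌉ n) ⟩
    ⌈ n /2⌉ + ⌈ n /2⌉                ≡⟨ cong (⌈ n /2⌉ +_) (+-identityʳ _) ⟨
    2 * ⌈ n /2⌉                      ≤⟨ *-monoʳ-≤ 2 (rec (⌈n/2⌉<n m)) ⟩
    2 * 2 ^ ⌈log₂ ⌈ n /2⌉ ⌉          ≡⟨ cong (λ k → 2 * 2 ^ k) (⌈log₂⌈n/2⌉⌉≡⌈log₂n⌉∸1 n) ⟩
    2 ^ suc (⌈log₂ n ⌉ ∸ 1)          ≡⟨ cong (2 ^_) (m+[n∸m]≡n {1} (⌈log₂⌉-mono-≤ {2} {n} (s≤s (s≤s z≤n)))) ⟩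
    2 ^ ⌈log₂ n ⌉                    ∎

⌈log₂⌉≤ : ∀ {n m} → n ≤ 2 ^ m → ⌈log₂ n ⌉ ≤ m
⌈log₂⌉≤ {m = m} n≤ = ≤-trans (⌈log₂⌉-mono-≤ n≤) (≤-reflexive (⌈log₂2^n⌉≡n m))

≤tower-log* : ∀ n → n ≤ tower (log* n)
≤tower-log* n = go n n ≤-refl
  where
  go : ∀ f n → n ≤ f → n ≤ tower (log*-fuel f n)
  go zero    zero          _   = z≤n
  go (suc f) zero          _   = z≤n
  go (suc f) (suc zero)    _   = ≤-refl
  go (suc f) n@(suc (suc m)) n≤f = ≤-trans (n≤2^⌈log₂n⌉ n)
    (^-monoʳ-≤ 2 (go f ⌈log₂ n ⌉ (≤-trans (⌈log₂⌉≤ (n<2^n (suc m))) (≤-pred n≤f))))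

-- With `≤tower-log*`, this makes `log* n` the least height `k` with `n ≤ tower k`.
log*≤ : ∀ {n} k → n ≤ tower k → log* n ≤ k
log*≤ {n} k n≤ = go n n k n≤
  where
  go : ∀ f n k → n ≤ tower k → log*-fuel f n ≤ k
  go zero    n                k       _  = z≤n
  go (suc f) zero             k       _  = z≤n
  go (suc f) (suc zero)       k       _  = z≤n
  go (suc f) (suc (suc n))    zero    (s≤s ())
  go (suc f) n@(suc (suc _)) (suc k) n≤ = s≤s (go f ⌈log₂ n ⌉ k (⌈log₂⌉≤ n≤))

-- One more copy of `tower k` costs at most a doubling, and a doubling at most one storey.
tower-+ : ∀ k c → c * tower k ≤ tower (c + k)
tower-+ k zero    = z≤n
tower-+ k (suc c) = begin
  tower k + c * tower k               ≤⟨ +-mono-≤ (≤-trans (m≤n*m (tower k) 1) (mono c)) (tower-+ k c) ⟩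
  tower (c + k) + tower (c + k)       ≡⟨ cong (tower (c + k) +_) (+-identityʳ _) ⟨
  2 * tower (c + k)                   ≤⟨ tower-double (c + k) ⟩
  tower (suc c + k)                   ∎
  where
  open ≤-Reasoning
  mono : ∀ c → 1 * tower k ≤ tower (c + k)
  mono zero    = ≤-reflexive (*-identityˡ _)
  mono (suc c) = ≤-trans (mono c) (≤-trans (m≤n*m (tower (c + k)) 2) (tower-double (c + k)))

-- A power multiplies by `c` one storey lower, in the exponent, so identifiers of polynomial size
-- raise the height by at most `c`.
log*-^ : ∀ {N} n c → N ≤ n ^ c → log* N ≤ c + log* n
log*-^ {N} n c N≤ = log*≤ (c + log* n) (≤-trans N≤ (≤-trans (^-monoˡ-≤ c (≤tower-log* n)) (bound c (log* n))))
  where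
  bound : ∀ c k → tower k ^ c ≤ tower (c + k)
  bound c zero    = ≤-trans (≤-reflexive (^-zeroˡ c)) (tower≥1 (c + 0))
  bound c (suc k) = begin
    (2 ^ tower k) ^ c    ≡⟨ ^-*-assoc 2 (tower k) c ⟩
    2 ^ (tower k * c)    ≡⟨ cong (2 ^_) (*-comm (tower k) c) ⟩
    2 ^ (c * tower k)    ≤⟨ ^-monoʳ-≤ 2 (tower-+ k c) ⟩
    tower (suc (c + k))  ≡⟨ cong tower (+-suc c k) ⟨
    tower (c + suc k)    ∎
    where open ≤-Reasoning

-- Clustering

module _ {n} (G : Graph n) where

  within-mono : ∀ {j k u v} → j ≤ k → Within G j u v → Within G k u v
  within-mono _         here        = here
  within-mono (s≤s j≤k) (step e π) = step e (within-mono j≤k π)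

  within-trans : ∀ {j k u v w} → Within G j u v → Within G k v w → Within G (j + k) u w
  within-trans {j} {k} here ρ       = within-mono (m≤n+m k j) ρ
  within-trans         (step e π) ρ = step e (within-trans π ρ)

  within-sym : ∀ {k u v} → Within G k u v → Within G k v u
  within-sym here                = here
  within-sym {suc k} (step e π) =
    within-mono (≤-reflexive (+-comm k 1)) (within-trans (within-sym π) (step (adj-sym G e) here))

  -- `j < k` leaves one step in reserve at `y`, to be spent on moving from `y` to its centre.
  within-exit : ∀ {P : Pred (Fin n) 0ℓ} → Decidable P → ∀ {k u v} → Within G k u v → P u → ¬ P v →
                ∃[ j ] ∃[ y ] ∃[ z ] (j < k × Within G j u y × P y × Adj G y z × ¬ P z)
  within-exit P? here pu ¬pv = contradiction pu ¬pv
  within-exit P? (step {w = w} e π) pu ¬pv with P? w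
  ... | no ¬pw = 0 , _ , w , s≤s z≤n , here , pu , e , ¬pw
  ... | yes pw with within-exit P? π pw ¬pv
  ...   | j , y , z , j<k , ρ , py , yz , ¬pz = suc j , y , z , s≤s j<k , step e ρ , py , yz , ¬pz

towardsHeaviest : ∀ {n} (w : Weight n) i →
  heaviest (tabulate (weight w i)) i ≡ i ⊎ 0 < weight w i (heaviest (tabulate (weight w i)) i)
towardsHeaviest w i with proj₂ (heaviest-spec (tabulate (weight w i)) i)
... | inj₁ eq  = inj₁ eq
... | inj₂ 0<w = inj₂ (subst (0 <_) (lookup∘tabulate (weight w i) _) 0<w)

-- L is the number of colour reduction steps.
starMap : ∀ {n} → ℕ → Weight n → Fin n → Fin n
starMap L w = Labelling.star p (λ i → weight w i (p i)) (Colouring.colour p L) palette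
  where
  p : _ → _
  p i = heaviest (tabulate (weight w i)) i

module _ {n} (L : ℕ) (n≤ : n ≤ tower L) (w : Weight n) where

  private
    p : Fin n → Fin n
    p i = heaviest (tabulate (weight w i)) i
    g = starMap L w
    open Labelling p (λ i → weight w i (p i)) (Colouring.colour p L)

    heavy : ∀ i j → weight w i j ≤ weight w i (p i)
    heavy i j = subst₂ _≤_ (lookup∘tabulate (weight w i) j) (lookup∘tabulate (weight w i) (p i))
      (proj₁ (heaviest-spec (tabulate (weight w i)) i) j)

  starMap-idem : ∀ i → g (g i) ≡ g i
  starMap-idem = star-idem palette

  starMap-move : ∀ i → g i ≡ i ⊎ 0 < weight w i (g i)
  starMap-move i = case joined? palette i of λ where
    (no ¬ji) → inj₁ (star-¬joined palette ¬ji)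
    (yes ji) → case towardsHeaviest w i of λ where
      (inj₁ pi≡i) → inj₁ (trans (star-joined palette ji) pi≡i)
      (inj₂ 0<w)  → inj₂ (subst (λ j → 0 < weight w i j) (sym (star-joined palette ji)) 0<w)

  starMap-shrinks : ∀ {d} → LocallySparse d (support w) →
    double (weight w) + 4 * d * double (weight (contracted g w)) ≤ 4 * d * double (weight w)
  starMap-shrinks {d} sparse = contraction-shrinks w p (Colouring.colour p L) heavy (Colouring.colour-proper p L) {d} sparse palette
    (Colouring.colour<palette p L n≤)

-- A vertex is at most one step from its centre at level 0. A star then joins leaders of adjacent
-- clusters, at distance at most `2 * radius k + 1`.
radius : ℕ → ℕ
radius zero    = 1
radius (suc k) = radius k + suc (2 * radius k)

module Clustering {n} (G : Graph n) (d : ℕ) (sparse : Sparse d G) (L : ℕ) (n≤ : n ≤ tower L)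
  (c : Fin n → Fin n) (c-idem : ∀ x → c (c x) ≡ c x)
  (c-path : ∀ x → Path G (λ y → c y ≡ c x) x (c x)) (c-near : ∀ x → Within G 1 x (c x)) where

  -- Truncation at 1 discards parallel edges: the initial weight counts edges of the contracted
  -- graph, which `Sparse` bounds in terms of the centres, and not all edges of `G` between two
  -- stars.
  w₀ : Weight n
  w₀ = record
    { weight = λ a b → 1 ⊓ contractWeight c (adj G) a b
    ; comm   = λ a b → cong (1 ⊓_) (comm (contracted c graphWeight) a b)
    ; loop   = λ a → cong (1 ⊓_) (loop (contracted c graphWeight) a)
    }
    where
    graphWeight : Weight n
    graphWeight = record { weight = adj G ; comm = adj-comm G ; loop = adj-loop G }

  w₀⁻ : ∀ {a b} → 0 < weight w₀ a b → Adj (image c G) a b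
  w₀⁻ {a} {b} 0<w with contractWeight⁻ c (adj G) (≤-trans 0<w (m⊓n≤n 1 _))
  ... | a≢b , u , v , cu , cv , 0<uv = a≢b , u , v , cu , cv , 𝟙-positive (adj? G u v) 0<uv

  w₀⁺ : ∀ {u v} → Adj G u v → c u ≢ c v → 0 < weight w₀ (c u) (c v)
  w₀⁺ {u} {v} uv cu≢cv = ⊓-pres-m< ≤-refl
    (≤-trans (≤-reflexive (sym (𝟙-true (adj? G u v) uv))) (contractWeight⁺ c (adj G) cu≢cv))

  mutual
    lead : ℕ → Fin n → Fin n
    lead zero    x = x
    lead (suc k) x = starMap L (w k) (lead k x)

    w : ℕ → Weight n
    w zero    = w₀
    w (suc k) = contracted (starMap L (w k)) (w k)

  cluster : ℕ → Fin n → Fin n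
  cluster k x = lead k (c x)

  -- `path` makes `cluster k` a contraction with connected fibres, and `edge` places the weighted
  -- graph inside its image; together they keep `Sparse` applicable at every level.
  record Invariant (k : ℕ) : Set where
    field
      idem : ∀ x → cluster k (cluster k x) ≡ cluster k x
      path : ∀ x → Path G (λ y → cluster k y ≡ cluster k x) x (cluster k x)
      near : ∀ x → Within G (radius k) x (cluster k x)
      edge : ∀ {a b} → 0 < weight (w k) a b → Adj (image (cluster k) G) a b

    near-edge : ∀ {a b} → 0 < weight (w k) a b → Within G (suc (2 * radius k)) a b
    near-edge 0<w with edge 0<w
    ... | _ , u , v , refl , refl , uv = within-mono G
      (≤-reflexive (trans (+-suc (radius k) (radius k)) (cong (λ r → suc (radius k + r)) (sym (+-identityʳ _)))))
      (within-trans G (within-sym G (near u)) (step uv (near v)))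

    locallySparse : LocallySparse d (support (w k))
    locallySparse L? = ≤-trans
      (∑-mono λ x → ∑-mono λ y → 𝟙-mono (adj? (restrict L? (support (w k))) x y)
        (adj? (restrict L? (image (cluster k) G)) x y) λ (lx , ly , 0<w) → lx , ly , edge 0<w)
      (sparse (starFibres path) L?)

  invariant : ∀ k → Invariant k
  invariant zero = record
    { idem = c-idem ; path = c-path ; near = c-near ; edge = w₀⁻ }
  invariant (suc k) = record
    { idem = λ x → trans (cong g (fixed (cluster k x) (idem x))) (starMap-idem L n≤ (w k) (cluster k x))
    ; path = λ x → mapPath (cong g) (path x) ◅◅ hop x (starMap-move L n≤ (w k) (cluster k x))
    ; near = λ x → within-trans G (near x) (near-hop (starMap-move L n≤ (w k) (cluster k x)))
    ; edge = edge′
    }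
    where
    open Invariant (invariant k)
    g = starMap L (w k)
    -- The end of a weighted edge is `cluster k v` for some `v`, so idempotence applies to it.
    fixed : ∀ a → cluster k a ≡ a → cluster k (g a) ≡ g a
    fixed a fa with starMap-move L n≤ (w k) a
    ... | inj₁ ga≡a = trans (cong (cluster k) ga≡a) (trans fa (sym ga≡a))
    ... | inj₂ 0<w with edge 0<w
    ...   | _ , _ , v , _ , ℓv , _ = trans (cong (cluster k) (sym ℓv)) (trans (idem v) ℓv)
    hop : ∀ x → g (cluster k x) ≡ cluster k x ⊎ 0 < weight (w k) (cluster k x) (g (cluster k x)) →
          Path G (λ y → g (cluster k y) ≡ g (cluster k x)) (cluster k x) (g (cluster k x))
    hop x (inj₁ ga≡a) = subst (Path G _ (cluster k x)) (sym ga≡a) (stop (cong g (idem x)))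
    hop x (inj₂ 0<w) with edge 0<w
    ... | _ , u , v , ℓu , ℓv , uv =
      mapPath (λ ℓy → cong g (trans ℓy ℓu)) (subst (λ a → Path G (λ y → cluster k y ≡ cluster k u) a u) ℓu (reversePath (path u)))
      ◅◅ move (cong g ℓu) uv
      (mapPath (λ ℓy → trans (cong g (trans ℓy ℓv)) (starMap-idem L n≤ (w k) (cluster k x)))
        (subst (Path G (λ y → cluster k y ≡ cluster k v) v) ℓv (path v)))
    near-hop : ∀ {a b} → b ≡ a ⊎ 0 < weight (w k) a b → Within G (suc (2 * radius k)) a b
    near-hop (inj₁ refl) = here
    near-hop (inj₂ 0<w)  = near-edge 0<w
    edge′ : ∀ {a b} → 0 < weight (w (suc k)) a b → Adj (image (cluster (suc k)) G) a b
    edge′ 0<w with contractWeight⁻ g (weight (w k)) 0<w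
    ... | a≢b , i , j , refl , refl , 0<ij with edge 0<ij
    ...   | _ , u , v , refl , refl , uv = a≢b , u , v , refl , refl , uv

  -- An edge of level `k` bundles initial edges. Those that `H` separates are followed back one
  -- contraction at a time, which composes `H` with the star map; hence `H` varies in the induction.
  crossing : ∀ k {H : Fin n → Fin n} →
    double (λ x y → weight (w k) x y when ¬? (H x Fin.≟ H y)) ≡
    double (λ x y → weight w₀ x y when ¬? (H (lead k x) Fin.≟ H (lead k y)))
  crossing zero        = refl
  crossing (suc k) {H} = trans (double-contractWeight g (weight (w k)) λ a b → ¬? (H a Fin.≟ H b))
    (trans (∑-cong λ i → ∑-cong λ j → absorb (weight (w k) i j) (g i Fin.≟ g j) (H (g i) Fin.≟ H (g j)) (cong H))
           (crossing k {H ∘ g}))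
    where
    g = starMap L (w k)
    absorb : ∀ {P Q : Set} m (P? : Dec P) (Q? : Dec Q) → (P → Q) → (m when ¬? P?) when ¬? Q? ≡ m when ¬? Q?
    absorb m _       (yes _) _ = refl
    absorb m (no _)  (no _)  _ = refl
    absorb m (yes p) (no ¬q) f = contradiction (f p) ¬q

  Boundary : ℕ → Pred (Fin n) 0ℓ
  Boundary k x = ∃[ y ] (0 < weight w₀ x y × lead k x ≢ lead k y)

  boundary? : ∀ k → Decidable (Boundary k)
  boundary? k x = any? λ y → (0 <? weight w₀ x y) ×-dec ¬? (lead k x Fin.≟ lead k y)

  -- Ordered pairs are summed, so a crossing edge pays for both of its ends.
  boundary≤ : ∀ k → # (boundary? k) ≤ double (weight (w k))
  boundary≤ k = begin
    # (boundary? k)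
      ≤⟨ ∑-mono (λ x → 𝟙-bound (boundary? k x) λ (y , 0<w , ≢) → ≤-trans 0<w
           (≤-trans (≤-reflexive (sym (when-true _ (¬? (lead k x Fin.≟ lead k y)) ≢)))
                    (term≤∑ (λ y → weight w₀ x y when ¬? (lead k x Fin.≟ lead k y)) y))) ⟩
    double (λ x y → weight w₀ x y when ¬? (lead k x Fin.≟ lead k y))
      ≡⟨ crossing k {id} ⟨
    double (λ x y → weight (w k) x y when ¬? (x Fin.≟ y))
      ≤⟨ ∑-mono (λ x → ∑-mono λ y → when≤ _ (¬? (x Fin.≟ y))) ⟩
    double (weight (w k)) ∎
    where open ≤-Reasoning

  initial≤ : ∀ {D : Pred (Fin n) 0ℓ} (D? : Decidable D) → (∀ {u v} → Adj G u v → D (c u)) →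
             double (weight w₀) ≤ d * # D?
  initial≤ D? centre = ≤-trans
    (∑-mono λ x → ∑-mono λ y → below-one (m⊓n≤m 1 _) λ 0<w → ≤-reflexive (sym
      (𝟙-true (adj? (restrict D? (image c G)) x y) (centres (w₀⁻ 0<w)))))
    (sparse (starFibres c-path) D?)
    where
    below-one : ∀ {l m} → l ≤ 1 → (0 < l → 1 ≤ m) → l ≤ m
    below-one {zero}        _ _ = z≤n
    below-one {suc zero}    _ f = f z<s
    below-one {suc (suc _)} (s≤s ())
    centres : ∀ {x y} → Adj (image c G) x y → Adj (restrict D? (image c G)) x y
    centres e@(_ , _ , _ , refl , refl , uv) = centre uv , centre (adj-sym G uv) , e

  -- With `4 * d = 1 + e` the shrinking inequality reads `W + (1 + e) * W′ ≤ W + e * W`.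
  decay : ∀ k e → 4 * d ≡ suc e → suc e ^ k * double (weight (w k)) ≤ e ^ k * double (weight w₀)
  decay zero    e eq = ≤-refl
  decay (suc k) e eq = begin
    suc e * suc e ^ k * W′        ≡⟨ solve 3 (λ a b c → a :* b :* c := b :* (a :* c)) refl (suc e) (suc e ^ k) W′ ⟩
    suc e ^ k * (suc e * W′)      ≤⟨ *-monoʳ-≤ (suc e ^ k) shrink ⟩
    suc e ^ k * (e * W)           ≡⟨ solve 3 (λ a b c → b :* (a :* c) := a :* (b :* c)) refl e (suc e ^ k) W ⟩
    e * (suc e ^ k * W)           ≤⟨ *-monoʳ-≤ e (decay k e eq) ⟩
    e * (e ^ k * double (weight w₀)) ≡⟨ *-assoc e (e ^ k) _ ⟨
    e * e ^ k * double (weight w₀) ∎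
    where
    open ≤-Reasoning
    W  = double (weight (w k))
    W′ = double (weight (w (suc k)))
    shrink : suc e * W′ ≤ e * W
    shrink = +-cancelˡ-≤ W _ _ (subst (λ z → W + z * W′ ≤ z * W) eq
      (starMap-shrinks L n≤ (w k) {d} (Invariant.locallySparse (invariant k))))

-- Local optima

opaque
  smallest : ∀ {n} {P : Pred (Subset n) 0ℓ} → Decidable P → Subset n
  smallest {n} P? with anySubset? P?
  ... | no _        = Subset.⊥
  ... | yes (S , p) =
    proj₁ (proj₁ (proj₂ (least (λ m → anySubset? λ S → P? S ×-dec (∣ S ∣ ≟ m)) ∣ S ∣ (S , p , refl))))

  smallest-spec : ∀ {n} {P : Pred (Subset n) 0ℓ} (P? : Decidable P) {S} → P S → P (smallest P?) × ∣ smallest P? ∣ ≤ ∣ S ∣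
  smallest-spec P? {S} p with anySubset? P?
  ... | no ¬∃ = contradiction (S , p) ¬∃
  ... | yes (S₀ , p₀) with least (λ m → anySubset? λ S → P? S ×-dec (∣ S ∣ ≟ m)) ∣ S₀ ∣ (S₀ , p₀ , refl)
  ...   | m , (S₁ , p₁ , eq) , minimal = p₁ , ≤-trans (≤-reflexive eq) (minimal ∣ S ∣ (S , p , refl))

Hit : ∀ {n} → Maybe (Vec Bool n) → Subset n → Set
Hit nothing    S = ⊤
Hit (just row) S = ∃[ u ] (u ∈ S × lookup row u ≡ true)

hit? : ∀ {n} (r : Maybe (Vec Bool n)) → Decidable (Hit r)
hit? nothing    S = yes tt
hit? (just row) S = any? λ u → (u ∈? S) ×-dec (lookup row u Bool.≟ true)

-- The table holds one constraint for each vertex, `nothing` being void. The set depends on the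
-- table only, hence on what a leader can collect.
smallestHitting : ∀ {n} → Vec (Maybe (Vec Bool n)) n → Subset n
smallestHitting T = smallest λ S → all? λ v → hit? (lookup T v) S

-- Every cluster chooses a smallest set dominating it, possibly with vertices outside of it.
module LocalOptimum {n} (G : Graph n) {V : Pred (Fin n) 0ℓ} (V? : Decidable V) (k : ℕ)
  (ℓ : Fin n → Fin n) (ρ : ℕ) (near : ∀ x → Within G ρ x (ℓ x)) where

  ball : Fin n → Vec Bool n
  ball v = tabulate λ u → does (within? G k v u)

  entry : Fin n → Fin n → Maybe (Vec Bool n)
  entry a v = if does (V? v ×-dec (ℓ v Fin.≟ a)) then just (ball v) else nothing

  optimum : Fin n → Subset n
  optimum a = smallestHitting (tabulate (entry a))

  -- A vertex chosen for the sake of `v` is within `k` of `v`, and `v` is within `ρ` of its leader,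
  -- so the distance condition keeps all that is needed for domination and makes membership local.
  Selected : Pred (Fin n) 0ℓ
  Selected i = ∃[ a ] (Within G (k + ρ) i a × i ∈ optimum a)

  selected? : Decidable Selected
  selected? i = any? λ a → within? G (k + ρ) i a ×-dec (i ∈? optimum a)

  module _ {X : Pred (Fin n) 0ℓ} (X? : Decidable X)
    (hits : ∀ {v} → V v → ∃[ u ] (X u × ℓ u ≡ ℓ v × Within G k v u)) where

    part? : ∀ a → Decidable (λ u → X u × ℓ u ≡ a)
    part? a u = X? u ×-dec (ℓ u Fin.≟ a)

    part-hits : ∀ a v → Hit (lookup (tabulate (entry a)) v) (subsetOf (part? a))
    part-hits a v = subst (λ r → Hit r (subsetOf (part? a))) (sym (lookup∘tabulate (entry a) v)) (go (V? v ×-dec (ℓ v Fin.≟ a)))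
      where
      go : (d : Dec (V v × ℓ v ≡ a)) → Hit (if does d then just (ball v) else nothing) (subsetOf (part? a))
      go (no _) = tt
      go (yes (vv , refl)) with hits vv
      ... | u , xu , ℓu≡ℓv , vu = u , ∈subsetOf⁺ (part? a) (xu , ℓu≡ℓv) ,
              trans (lookup∘tabulate _ u) (dec-true (within? G k v u) vu)

    optimum-spec : ∀ a → (∀ v → Hit (lookup (tabulate (entry a)) v) (optimum a)) × ∣ optimum a ∣ ≤ # (part? a)
    optimum-spec a = map₂ (λ le → ≤-trans le (≤-reflexive (∣subsetOf∣ (part? a))))
      (smallest-spec (λ S → all? λ v → hit? (lookup (tabulate (entry a)) v) S) (part-hits a))

    selected-dominates : ∀ {v} → V v → ∃[ u ] (Selected u × Within G k v u)
    selected-dominates {v} vv = go (V? v ×-dec (ℓ v Fin.≟ ℓ v))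
      (subst (λ r → Hit r (optimum (ℓ v))) (lookup∘tabulate (entry (ℓ v)) v) (proj₁ (optimum-spec (ℓ v)) v))
      where
      go : (d : Dec (V v × ℓ v ≡ ℓ v)) → Hit (if does d then just (ball v) else nothing) (optimum (ℓ v)) →
           ∃[ u ] (Selected u × Within G k v u)
      go (no ¬d) _ = contradiction (vv , refl) ¬d
      go (yes _) (u , u∈ , eq) = u , (ℓ v , within-trans G (within-sym G vu) (near v) , u∈) , vu
        where
        vu : Within G k v u
        vu = does-true (within? G k v u) (trans (sym (lookup∘tabulate _ u)) eq)

    -- In each cluster the part of `X` inside it competes in the minimisation, and these parts are
    -- disjoint.
    selected≤ : # selected? ≤ # X?
    selected≤ = begin
      # selected?                                    ≤⟨ #-⋃ selected? (λ a u → u ∈? optimum a) (λ _ (a , _ , i∈) → a , i∈) ⟩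
      ∑ (λ a → # (_∈? optimum a))                    ≡⟨ ∑-cong (λ a → ∣ optimum a ∣≡#) ⟨
      ∑ (λ a → ∣ optimum a ∣)                        ≤⟨ ∑-mono (λ a → proj₂ (optimum-spec a)) ⟩
      ∑ (λ a → # (part? a))                          ≡⟨ ∑-cong (λ a → ∑-cong λ u → trans (𝟙-× (X? u) (ℓ u Fin.≟ a)) (*-comm (𝟙 (X? u)) _)) ⟩
      ∑ (λ a → ∑ λ u → 𝟙 (ℓ u Fin.≟ a) * 𝟙 (X? u))   ≡⟨ ∑-swap _ ⟩
      ∑ (λ u → ∑ λ a → 𝟙 (ℓ u Fin.≟ a) * 𝟙 (X? u))   ≡⟨ ∑-cong (λ u → ∑-single′ (ℓ u) λ _ → 𝟙 (X? u)) ⟩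
      # X?                                           ∎
      where open ≤-Reasoning

-- The construction on a whole graph

module Construction {n} (G : Graph n) {V : Pred (Fin n) 0ℓ} (V? : Decidable V)
  (endpoint : ∀ {x y} → Adj G x y → V x) (d : ℕ) (sparse : Sparse d G)
  (L : ℕ) (n≤ : n ≤ tower L) (levels k : ℕ) (1≤k : 1 ≤ k) where

  open Approximation G V? endpoint d public
  open Collapsing G dom? dom? id public
    renaming (collapse to centre; collapses to centres; collapse-idem to centre-idem; collapse-path to centre-path)
    using ()

  centre-near : ∀ x → Within G 1 x (centre x)
  centre-near x = go (centres x)
    where
    go : ∀ {y} → Collapsing.Collapse G dom? dom? id x y → Within G 1 x y
    go (Collapsing.keep _)    = here
    go (Collapsing.join xm _) = step xm here
    go (Collapsing.lone _ _)  = here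

  open Clustering G d sparse L n≤ centre centre-idem centre-path centre-near public

  open LocalOptimum G V? k (cluster levels) (radius levels) (Invariant.near (invariant levels)) public

  centre∈dom : ∀ {u v} → Adj G u v → Dom (centre u)
  centre∈dom {u} uv = go (centres u)
    where
    go : ∀ {y} → Collapsing.Collapse G dom? dom? id u y → Dom y
    go (Collapsing.keep du)   = du
    go (Collapsing.join _ dm) = dm
    go (Collapsing.lone ¬du ¬dm) with dom-dominates (endpoint uv)
    ... | inj₁ du            = contradiction du ¬du
    ... | inj₂ (y , uy , dy) = contradiction dy (¬dm y uy)

  module _ {T : Pred (Fin n) 0ℓ} (T? : Decidable T) (covers : ∀ {v} → V v → ∃[ m ] (T m × Within G k v m)) where

    X? : Decidable (λ u → T u ⊎ Boundary levels u)
    X? u = T? u ⊎-dec boundary? levels u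

    hits : ∀ {v} → V v → ∃[ u ] ((T u ⊎ Boundary levels u) × cluster levels u ≡ cluster levels v × Within G k v u)
    hits {v} vv with covers vv
    ... | m , tm , vm with cluster levels m Fin.≟ cluster levels v
    ...   | yes same = m , inj₁ tm , same , vm
    ...   | no other with within-exit G (λ y → cluster levels y Fin.≟ cluster levels v) vm refl other
    ...     | j , y , z , j<k , vy , ℓy , yz , ℓz =
      -- The two centres differ, as equal ones would put `z` into the cluster of `y`.
      centre y , inj₂ (centre z , w₀⁺ yz (λ eq → ℓz (trans (cong (lead levels) (sym eq)) ℓy))
                      , λ eq → ℓz (trans (sym eq) ℓy))
               , trans (cong (lead levels) (centre-idem y)) ℓy
               , within-mono G (≤-trans (≤-reflexive (+-comm j 1)) j<k) (within-trans G vy (centre-near y))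

    covers-within : ∀ {v} → V v → ∃[ u ] (Selected u × Within G k v u)
    covers-within = selected-dominates X? hits

    selected≤boundary : # selected? ≤ # T? + double (weight (w levels))
    selected≤boundary = ≤-trans (selected≤ X? hits)
      (≤-trans (#-⊎ X? T? (boundary? levels) λ _ → id) (+-monoʳ-≤ (# T?) (boundary≤ levels)))

  boundary-decay : ∀ e → 4 * d ≡ suc e → ∀ {M : Pred (Fin n) 0ℓ} (M? : Decidable M) →
    (∀ {v} → V v → M v ⊎ ∃[ m ] (Adj G v m × M m)) →
    suc e ^ levels * double (weight (w levels)) ≤ e ^ levels * (d * (approx * # M?))
  boundary-decay e eq M? dominated = ≤-trans (decay levels e eq)
    (*-monoʳ-≤ (e ^ levels) (≤-trans (initial≤ dom? centre∈dom) (*-monoʳ-≤ d (dom≤ sparse M? dominated))))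

-- Local computation

-- A network whose vertices are the possible identifiers; those not in use are isolated and
-- marked as absent.
record Network (N d : ℕ) : Set₁ where
  field
    graph    : Graph N
    Present  : Pred (Fin N) 0ℓ
    present? : Decidable Present
    endpoint : ∀ {x y} → Adj graph x y → Present x
    sparse   : Sparse d graph

open Network public

View : ℕ → ℕ → Set
View N zero    = Fin N × Bool
View N (suc r) = View N r × Vec (Maybe (View N r)) N

entryIf : ∀ {P X : Set} → Dec P → X → Maybe X
entryIf P? x = if does P? then just x else nothing

entryIf-true : ∀ {P X : Set} (P? : Dec P) {x : X} → P → entryIf P? x ≡ just x
entryIf-true P? p rewrite dec-true P? p = refl

entryIf-false : ∀ {P X : Set} (P? : Dec P) {x : X} → ¬ P → entryIf P? x ≡ nothing
entryIf-false P? ¬p rewrite dec-false P? ¬p = refl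

entryIf-just : ∀ {P X : Set} (P? : Dec P) {x y : X} → entryIf P? x ≡ just y → P × x ≡ y
entryIf-just (yes p) refl = p , refl

map-entryIf : ∀ {P X Y : Set} (P? : Dec P) (f : X → Y) {x} → Maybe.map f (entryIf P? x) ≡ entryIf P? (f x)
map-entryIf (yes _) f = refl
map-entryIf (no _)  f = refl

is-just-entryIf : ∀ {P X : Set} (P? : Dec P) {x : X} → is-just (entryIf P? x) ≡ does P?
is-just-entryIf (yes _) = refl
is-just-entryIf (no _)  = refl

first : ∀ {n} {X : Set} → Vec (Maybe X) n → Maybe X
first []             = nothing
first (just x  ∷ xs) = just x
first (nothing ∷ xs) = first xs

first-nothing : ∀ {n} {X : Set} (v : Vec (Maybe X) n) → (∀ w → lookup v w ≡ nothing) → first v ≡ nothing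
first-nothing []             f = refl
first-nothing (just x  ∷ xs) f = case f zero of λ ()
first-nothing (nothing ∷ xs) f = first-nothing xs (f ∘ suc)

first-just : ∀ {n} {X : Set} {x : X} (v : Vec (Maybe X) n) →
             (∀ w {y} → lookup v w ≡ just y → y ≡ x) → ∀ w → lookup v w ≡ just x → first v ≡ just x
first-just (just y  ∷ xs) f w       eq = cong just (f zero refl)
first-just (nothing ∷ xs) f (suc w) eq = first-just xs (f ∘ suc) w eq

module Computation (N d : ℕ) where

  Net = Network N d

  view : (net : Net) → ∀ r → Fin N → View N r
  view net zero    i = i , does (present? net i)
  view net (suc r) i = view net r i , tabulate λ j → entryIf (adj? (graph net) i j) (view net r j)

  Local : Set → Set₁
  Local X = Net → Fin N → X

  -- `f` may inspect the whole network, `code` only a view; as `code` is chosen before the network,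
  -- it can serve as the program of every vertex.
  record Computes {X : Set} (r : ℕ) (f : Local X) : Set₁ where
    field
      code    : View N r → X
      correct : ∀ net i → code (view net r i) ≡ f net i

  open Computes public

  private
    variable
      X Y : Set
      r : ℕ

  cast : ∀ {f f′ : Local X} → (∀ net i → f net i ≡ f′ net i) → Computes r f → Computes r f′
  cast eq c = record { code = code c ; correct = λ net i → trans (correct c net i) (eq net i) }

  self : Computes 0 λ _ i → i
  self = record { code = proj₁ ; correct = λ _ _ → refl }

  presence : Computes 0 λ net i → does (present? net i)
  presence = record { code = proj₂ ; correct = λ _ _ → refl }

  mapC : ∀ {f : Local X} (h : X → Y) → Computes r f → Computes r λ net i → h (f net i)
  mapC h c = record { code = h ∘ code c ; correct = λ net i → cong h (correct c net i) }

  infixr 4 _⊗_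
  _⊗_ : ∀ {f : Local X} {g : Local Y} → Computes r f → Computes r g → Computes r λ net i → f net i , g net i
  c ⊗ e = record { code = λ v → code c v , code e v ; correct = λ net i → cong₂ _,_ (correct c net i) (correct e net i) }

  later : ∀ m {f : Local X} → Computes r f → Computes (m + r) f
  later zero    c = c
  later (suc m) c = record { code = code (later m c) ∘ proj₁ ; correct = correct (later m c) }

  within : ∀ {m n} {f : Local X} → m ≤ n → Computes m f → Computes n f
  within {m = m} {n} {f} m≤n c = subst (λ k → Computes k f) (m∸n+n≡m m≤n) (later (n ∸ m) c)

  neighbours : ∀ {f : Local X} → Computes r f →
               Computes (suc r) λ net i → tabulate λ j → entryIf (adj? (graph net) i j) (f net j)
  neighbours c = record
    { code    = λ (_ , t) → Vec.map (Maybe.map (code c)) t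
    ; correct = λ net i → trans (sym (tabulate-∘ _ _)) (tabulate-cong λ j →
        trans (map-entryIf (adj? (graph net) i j) (code c)) (cong (entryIf (adj? (graph net) i j)) (correct c net j)))
    }

  ball : ℕ → Local X → Local (Vec (Maybe X) N)
  ball q f net i = tabulate λ j → entryIf (within? (graph net) q i j) (f net j)

  private
    extend : Vec (Maybe X) N → Vec (Maybe (Vec (Maybe X) N)) N → Vec (Maybe X) N
    extend own others = tabulate λ j → first (lookup own j ∷ Vec.map (λ t → t Maybe.>>= λ v → lookup v j) others)

  -- Each round merges the tables of the neighbours. Tables are indexed by identifiers, so all
  -- entries found for `j` agree and `first` may return any of them.
  gather : ∀ q {f : Local X} → Computes r f → Computes (q + r) (ball q f)
  gather zero {f} c = cast (λ net i → tabulate-cong λ j → same net i j (i Fin.≟ j))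
    (mapC (λ (i , x) → tabulate λ j → entryIf (i Fin.≟ j) x) (within z≤n self ⊗ c))
    where
    same : ∀ net i j (e : Dec (i ≡ j)) → entryIf e (f net i) ≡ entryIf e (f net j)
    same net i j (yes refl) = refl
    same net i j (no _)     = refl
  gather (suc q) {f} c = cast (λ net i → tabulate-cong λ j → correct′ net i j)
    (mapC (λ (own , others) → extend own others) (later 1 (gather q c) ⊗ neighbours (gather q c)))
    where
    correct′ : ∀ net i j →
      first (lookup (ball q f net i) j ∷ Vec.map (λ t → t Maybe.>>= λ v → lookup v j)
        (tabulate λ w → entryIf (adj? (graph net) i w) (ball q f net w))) ≡
      entryIf (within? (graph net) (suc q) i j) (f net j)
    correct′ net i j = case within? G (suc q) i j of λ where
        (yes π) → trans (reached π) (sym (entryIf-true (within? G (suc q) i j) π))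
        (no ¬π) → trans (first-nothing all (unreached ¬π)) (sym (entryIf-false (within? G (suc q) i j) ¬π))
      where
      G = graph net
      tables : Vec (Maybe (Vec (Maybe _) N)) N
      tables = tabulate λ w → entryIf (adj? G i w) (ball q f net w)
      all : Vec (Maybe _) (suc N)
      all = lookup (ball q f net i) j ∷ Vec.map (λ t → t Maybe.>>= λ v → lookup v j) tables
      own : lookup all zero ≡ entryIf (within? G q i j) (f net j)
      own = lookup∘tabulate _ j
      bind : ∀ {A B : Set} {P : Set} (P? : Dec P) (a : A) (h : A → Maybe B) {b} →
             (entryIf P? a Maybe.>>= h) ≡ just b → P × h a ≡ just b
      bind (yes p) a h eq = p , eq
      other : ∀ w → lookup all (suc w) ≡ (entryIf (adj? G i w) (ball q f net w) Maybe.>>= λ v → lookup v j)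
      other w = trans (Vecₚ.lookup-map w _ tables) (cong (Maybe._>>= λ v → lookup v j) (lookup∘tabulate _ w))
        where import Data.Vec.Properties as Vecₚ
      sound : ∀ w {y} → lookup all w ≡ just y → y ≡ f net j × Within G (suc q) i j
      sound zero eq with entryIf-just (within? G q i j) (trans (sym own) eq)
      ... | π , x≡y = sym x≡y , within-mono G (n≤1+n q) π
      sound (suc w) eq with bind (adj? G i w) (ball q f net w) (λ v → lookup v j) (trans (sym (other w)) eq)
      ... | iw , eq′ with entryIf-just (within? G q w j) (trans (sym (lookup∘tabulate _ j)) eq′)
      ...   | π , x≡y = sym x≡y , step iw π
      unreached : ¬ Within G (suc q) i j → ∀ w → lookup all w ≡ nothing
      unreached ¬π w with lookup all w in eq
      ... | nothing = refl
      ... | just y  = contradiction (proj₂ (sound w eq)) ¬π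
      reached : Within G (suc q) i j → first all ≡ just (f net j)
      reached here = first-just all (λ w eq → proj₁ (sound w eq)) zero
        (trans own (entryIf-true (within? G q i i) here))
      reached (step {w = w} iw π) = first-just all (λ w eq → proj₁ (sound w eq)) (suc w)
        (trans (other w) (trans (cong (Maybe._>>= λ v → lookup v j) (entryIf-true (adj? G i w) iw))
          (trans (lookup∘tabulate _ j) (entryIf-true (within? G q w j) π))))

  -- The default in `fromMaybe` is never reached, because the target lies in the gathered ball.
  fetch : ∀ q {f : Local X} {g : Local (Fin N)} → Computes r f → Computes r g →
          (∀ net i → Within (graph net) q i (g net i)) → Computes (q + r) λ net i → f net (g net i)
  fetch q {f} {g} c e near = cast
    (λ net i → cong (fromMaybe (f net i)) (trans (lookup∘tabulate _ (g net i))
      (entryIf-true (within? (graph net) q i (g net i)) (near net i))))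
    (mapC (λ (t , j , x) → fromMaybe x (lookup t j)) (gather q c ⊗ later q e ⊗ later q c))

  -- A sum over all identifiers is local if its terms vanish outside the ball; the index `b` lets
  -- one gathering yield a whole row of sums.
  gatherSum : ∀ q {M} {f : Local X} {g : Local Y} (φ : Fin M → Y → X → ℕ) → Computes r f → Computes r g →
              (∀ net i j b → ¬ Within (graph net) q i j → φ b (g net i) (f net j) ≡ 0) →
              Computes (q + r) λ net i → tabulate λ b → ∑ λ j → φ b (g net i) (f net j)
  gatherSum q {M} {f} {g} φ c e vanish = cast
    (λ net i → tabulate-cong λ b → ∑-cong λ j → term net i b j)
    (mapC (λ (t , y) → tabulate λ b → ∑ λ j → maybe′ (φ b y) 0 (lookup t j)) (gather q c ⊗ later q e))
    where
    term : ∀ net i b j → maybe′ (φ b (g net i)) 0 (lookup (ball q f net i) j) ≡ φ b (g net i) (f net j)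
    term net i b j = trans (cong (maybe′ (φ b (g net i)) 0) (lookup∘tabulate _ j)) (case within? (graph net) q i j of λ where
      (yes π) → cong (maybe′ (φ b (g net i)) 0) (entryIf-true (within? (graph net) q i j) π)
      (no ¬π) → trans (cong (maybe′ (φ b (g net i)) 0) (entryIf-false (within? (graph net) q i j) ¬π))
                      (sym (vanish net i j b ¬π)))

  -- Two gatherings: `i` sums its edges into each fibre, then `a` collects these rows from its own
  -- fibre.
  contractC : ∀ q q′ {w : Net → Fin N → Fin N → ℕ} {g : Local (Fin N)} →
              (∀ net {i j} → 0 < w net i j → Within (graph net) q i j) →
              (∀ net i → Within (graph net) q′ i (g net i)) →
              Computes r (λ net i → tabulate (w net i)) → Computes r g →
              Computes (q′ + (q + r)) λ net a → tabulate (contractWeight (g net) (w net) a)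
  contractC q q′ {w} {g} w-near g-near cw cg = cast
    (λ net a → tabulate-cong λ b → trans
      (∑-cong λ i → cong (λ z → (z when (g net i Fin.≟ a)) when ¬? (a Fin.≟ b)) (lookup∘tabulate _ b))
      (∑-when-const (¬? (a Fin.≟ b)) _))
    (gatherSum q′ (λ b a (gi , t) → (lookup t b when (gi Fin.≟ a)) when ¬? (a Fin.≟ b))
      (later q cg ⊗ partial) (within z≤n self)
      λ net a i b ¬π → trans (cong (_when ¬? (a Fin.≟ b))
        (when-false _ (g net i Fin.≟ a) λ gi≡a → ¬π (within-sym (graph net) (subst (Within (graph net) q′ i) gi≡a (g-near net i)))))
        (0when (¬? (a Fin.≟ b))))
    where
    partial : Computes (q + _) λ net i → tabulate λ b → ∑ λ j → w net i j when (g net j Fin.≟ b)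
    partial = cast
      (λ net i → tabulate-cong λ b → ∑-cong λ j → cong (_when (g net j Fin.≟ b)) (lookup∘tabulate _ j))
      (gatherSum q (λ b row (j , gj) → lookup row j when (gj Fin.≟ b)) (within z≤n self ⊗ cg) cw
        λ net i j b ¬π → trans (cong (_when (g net j Fin.≟ b))
          (trans (lookup∘tabulate _ j) (n<1⇒n≡0 (≰⇒> λ 0<w → ¬π (w-near net 0<w))))) (0when (g net j Fin.≟ b)))

-- Whether `S` is covered depends only on the rows of its common neighbours, so the relations need
-- to be compared nowhere else.
covered-transfer : ∀ {n s} {R R′ : Rel (Fin n) 0ℓ} {S : Subset n} →
  (∀ p → (∀ x → x ∈ S → R p x) → (∀ x → x ∈ S → R′ p x) × (∀ k → R′ p k → R p k)) →
  Covered R′ s S → Covered R s S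
covered-transfer f (K , K≤s , K∩S , cov) = K , K≤s , K∩S , λ p cp → case cov p (proj₁ (f p cp)) of λ where
  (k , k∈K , inj₁ k≡p) → k , k∈K , inj₁ k≡p
  (k , k∈K , inj₂ pk)  → k , k∈K , inj₂ (proj₂ (f p cp) k pk)

reach : ℕ → ℕ
reach j = suc (2 * radius j)

-- Eight rounds for the initial rows: four for the core, one each for `Dom` and the centres, two for
-- the contraction. A level then takes `L` hops for colours, `palette` for labels, one for stars and
-- two for contracting, each of `reach j` rounds.
levelTime : ℕ → ℕ → ℕ
levelTime L zero    = 8
levelTime L (suc j) = reach j + (reach j + (reach j + (palette * reach j + (L * reach j + levelTime L j))))

totalTime : ℕ → ℕ → ℕ → ℕ
totalTime k levels L = (k + radius levels) + (radius levels + (k + levelTime L levels))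

slope offset : ℕ → ℕ
slope zero     = 0
slope (suc j)  = reach j + slope j
offset zero    = 8
offset (suc j) = 3 * reach j + palette * reach j + offset j

levelTime-linear : ∀ L j → levelTime L j ≡ slope j * L + offset j
levelTime-linear L zero    = refl
levelTime-linear L (suc j) rewrite levelTime-linear L j =
  solve 5 (λ q p l a b → q :+ (q :+ (q :+ (p :* q :+ (l :* q :+ (a :* l :+ b))))) :=
                         (q :+ a) :* l :+ (con 3 :* q :+ p :* q :+ b)) refl (reach j) palette L (slope j) (offset j)

-- The stages of the construction as local computations

module Stages (N d L : ℕ) (N≤ : N ≤ tower L) (levels k : ℕ) (1≤k : 1 ≤ k) where

  open Computation N d

  module At (net : Net) =
    Construction (graph net) (present? net) (endpoint net) d (sparse net) L N≤ levels k 1≤k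

  Entry : Vec (Vec Bool N) N → Rel (Fin N) 0ℓ
  Entry m p x = lookup (lookup m p) x ≡ true

  entry? : ∀ m → B.Decidable (Entry m)
  entry? m p x = lookup (lookup m p) x Bool.≟ true

  uncovered : Vec (Vec Bool N) N → Subset N → Bool
  uncovered m S = not (does (covered? (entry? m) (2 * d) S))

  -- The edges with an end next to i, which decide whether a set containing i is covered.
  link : Local (Vec (Vec Bool N) N)
  link net i = tabulate λ p → tabulate λ x → does (adj? (graph net) i p ×-dec adj? (graph net) p x)

  rowC : Computes 1 λ net i → tabulate λ j → does (adj? (graph net) i j)
  rowC = cast (λ net i → tabulate-cong λ j → trans (cong is-just (lookup∘tabulate _ j)) (is-just-entryIf (adj? (graph net) i j)))
    (mapC (λ t → tabulate λ j → is-just (lookup t j)) (neighbours self))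

  linkC : Computes 2 link
  linkC = cast (λ net i → tabulate-cong λ p → tabulate-cong λ x →
      trans (cong (maybe′ (λ row → lookup row x) false) (lookup∘tabulate _ p)) (joint net p x (adj? (graph net) i p)))
    (mapC (λ t → tabulate λ p → tabulate λ x → maybe′ (λ row → lookup row x) false (lookup t p)) (neighbours rowC))
    where
    joint : ∀ net p x {P : Set} (P? : Dec P) →
      maybe′ (λ row → lookup row x) false (entryIf P? (tabulate λ j → does (adj? (graph net) p j))) ≡
      does (P? ×-dec adj? (graph net) p x)
    joint net p x (yes _) = lookup∘tabulate _ x
    joint net p x (no _)  = refl

  uncoveredC : Computes 2 λ net i → uncovered (link net i)
  uncoveredC = mapC uncovered linkC

  module _ (net : Net) where

    private G = graph net

    link⁺ : ∀ {i p x} → Adj G i p → Adj G p x → Entry (link net i) p x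
    link⁺ {i} {p} {x} ip px = trans (cong (λ row → lookup row x) (lookup∘tabulate _ p))
      (trans (lookup∘tabulate _ x) (dec-true (adj? G i p ×-dec adj? G p x) (ip , px)))

    link⁻ : ∀ {i p x} → Entry (link net i) p x → Adj G i p × Adj G p x
    link⁻ {i} {p} {x} eq = does-true (adj? G i p ×-dec adj? G p x)
      (trans (sym (trans (cong (λ row → lookup row x) (lookup∘tabulate _ p)) (lookup∘tabulate _ x))) eq)

    -- The common neighbours of a set containing `i` are neighbours of `i`, so `link` has their
    -- complete rows.
    uncovered⁺ : ∀ {i S} → i ∈ S → ¬ Covered (Adj G) (2 * d) S → uncovered (link net i) S ≡ true
    uncovered⁺ {i} {S} i∈S ¬cov = cong not (dec-false (covered? (entry? (link net i)) (2 * d) S) λ cov → ¬cov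
      (covered-transfer (λ p cp → (λ x x∈S → link⁺ (adj-sym G (cp i i∈S)) (cp x x∈S)) , λ k pk → proj₂ (link⁻ {i} pk)) cov))

    uncovered⁻ : ∀ {i S} → i ∈ S → uncovered (link net i) S ≡ true → ¬ Covered (Adj G) (2 * d) S
    uncovered⁻ {i} {S} i∈S eq cov = case trans (sym eq) (cong not (dec-true (covered? (entry? (link net i)) (2 * d) S)
      (covered-transfer (λ p cp → (λ x x∈S → proj₂ (link⁻ {i} (cp x x∈S))) , λ k pk → link⁺ (proj₁ (link⁻ {i} (cp i i∈S))) pk) cov)))
      of λ ()

    -- A set without common neighbours is covered by the empty set. So an uncovered set has one, and
    -- any two of its elements are joined through it.
    uncovered-near : ∀ {i j S} → i ∈ S → j ∈ S → ¬ Covered (Adj G) (2 * d) S → Within G 2 i j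
    uncovered-near {i} {j} {S} i∈S j∈S ¬cov =
      case any? (λ p → all? λ x → (x ∈? S) →-dec adj? G p x) of λ where
        (yes (p , cp)) → step (adj-sym G (cp i i∈S)) (step (cp j j∈S) here)
        (no ¬∃)        → contradiction
          (Subset.⊥ , ≤-trans (≤-reflexive (∣⊥∣≡0 N)) z≤n , (λ x x∈⊥ → contradiction x∈⊥ ∉⊥) , λ p cp → contradiction (p , cp) ¬∃)
          ¬cov

  known : Maybe (Subset N → Bool) → Subset N → Bool
  known t S = maybe′ (λ f → f S) false t

  criticalFrom? : ∀ i (f : Subset N → Bool) (t : Vec (Maybe (Subset N → Bool)) N) → Dec (∃[ S ] (i ∈ S × f S ≡ true ×
    ¬ (∃[ S′ ] (Nonempty S′ × S′ ⊂ S × ∃[ j ] (j ∈ S′ × known (lookup t j) S′ ≡ true)))))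
  criticalFrom? i f t = anySubset? λ S → (i ∈? S) ×-dec (f S Bool.≟ true) ×-dec
    ¬? (anySubset? λ S′ → nonempty? S′ ×-dec (S′ ⊂? S) ×-dec any? λ j → (j ∈? S′) ×-dec (known (lookup t j) S′ Bool.≟ true))

  -- Two rounds for the links, two for asking. A vertex judges only sets containing itself, so a
  -- subset `S′` that may miss `i` is judged by one of its own elements, at distance at most 2.
  coreC : Computes 4 λ net i → does (At.core? net i)
  coreC = cast (λ net i → does-⇔ (mk⇔ (to net i) (from net i)) (criticalFrom? i _ (table net i)) (At.core? net i))
    (mapC (λ (i , f , t) → does (criticalFrom? i f t)) (within z≤n self ⊗ later 2 uncoveredC ⊗ gather 2 uncoveredC))
    where
    table : ∀ net i → Vec (Maybe (Subset N → Bool)) N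
    table = ball 2 λ net i → uncovered (link net i)
    known⁻ : ∀ net i j {S} → known (lookup (table net i) j) S ≡ true → uncovered (link net j) S ≡ true
    known⁻ net i j {S} eq = go (within? (graph net) 2 i j) (trans (cong (λ t → known t S) (sym (lookup∘tabulate _ j))) eq)
      where
      go : ∀ {P : Set} (P? : Dec P) → known (entryIf P? (uncovered (link net j))) S ≡ true → uncovered (link net j) S ≡ true
      go (yes _) eq = eq
    known⁺ : ∀ net i j {S} → Within (graph net) 2 i j → uncovered (link net j) S ≡ true →
             known (lookup (table net i) j) S ≡ true
    known⁺ net i j {S} π eq =
      trans (cong (λ t → known t S) (trans (lookup∘tabulate _ j) (entryIf-true (within? (graph net) 2 i j) π))) eq
    to : ∀ net i → _ → At.Core net i
    to net i (S , i∈S , un , ¬∃) = S , i∈S , uncovered⁻ net i∈S un , λ (S′ , (j , j∈S′) , S′⊂S , ¬cov) →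
      ¬∃ (S′ , (j , j∈S′) , S′⊂S , j , j∈S′ ,
          known⁺ net i j (uncovered-near net i∈S (proj₁ S′⊂S j∈S′) (uncovered⁻ net i∈S un)) (uncovered⁺ net j∈S′ ¬cov))
    from : ∀ net i → At.Core net i → _
    from net i (S , i∈S , ¬cov , ¬∃) = S , i∈S , uncovered⁺ net i∈S ¬cov , λ (S′ , ne , S′⊂S , j , j∈S′ , eq) →
      ¬∃ (S′ , ne , S′⊂S , uncovered⁻ net j∈S′ (known⁻ net i j eq))

  isTrue : Maybe Bool → Bool
  isTrue = fromMaybe false

  isTrue-entryIf : ∀ {P Q : Set} (P? : Dec P) (Q? : Dec Q) → isTrue (entryIf P? (does Q?)) ≡ does (P? ×-dec Q?)
  isTrue-entryIf (yes _) Q? = refl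
  isTrue-entryIf (no _)  Q? = refl

  allFalse? : (t : Vec (Maybe Bool) N) → Dec (∀ j → isTrue (lookup t j) ≢ true)
  allFalse? t = all? λ j → ¬? (isTrue (lookup t j) Bool.≟ true)

  domC : Computes 5 λ net i → does (At.dom? net i)
  domC = cast (λ net i → does-⇔ (mk⇔ (to net i) (from net i))
      (domFrom? (does (present? net i)) (does (At.core? net i)) (table net i)) (At.dom? net i))
    (mapC (λ (v , c , t) → does (domFrom? v c t)) (within z≤n presence ⊗ later 1 coreC ⊗ neighbours coreC))
    where
    domFrom? : ∀ v c (t : Vec (Maybe Bool) N) → Dec (v ≡ true × (c ≡ true ⊎ (∀ j → isTrue (lookup t j) ≢ true)))
    domFrom? v c t = (v Bool.≟ true) ×-dec ((c Bool.≟ true) ⊎-dec allFalse? t)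
    table : ∀ net i → Vec (Maybe Bool) N
    table net i = tabulate λ j → entryIf (adj? (graph net) i j) (does (At.core? net j))
    entry≡ : ∀ net i j → isTrue (lookup (table net i) j) ≡ does (adj? (graph net) i j ×-dec At.core? net j)
    entry≡ net i j = trans (cong isTrue (lookup∘tabulate _ j)) (isTrue-entryIf (adj? (graph net) i j) (At.core? net j))
    to : ∀ net i → _ → At.Dom net i
    to net i (v , inj₁ c) = does-true (present? net i) v , inj₁ (does-true (At.core? net i) c)
    to net i (v , inj₂ f) = does-true (present? net i) v , inj₂ λ j ij cj → f j
      (trans (entry≡ net i j) (dec-true (adj? (graph net) i j ×-dec At.core? net j) (ij , cj)))
    from : ∀ net i → At.Dom net i → _
    from net i (v , inj₁ c) = dec-true (present? net i) v , inj₁ (dec-true (At.core? net i) c)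
    from net i (v , inj₂ f) = dec-true (present? net i) v , inj₂ λ j eq →
      uncurry (f j) (does-true (adj? (graph net) i j ×-dec At.core? net j) (trans (sym (entry≡ net i j)) eq))

  centreC : Computes 6 λ net i → At.centre net i
  centreC = cast (λ net i → cong (λ v → if does (At.dom? net i) then i else choose v i) (tabulate-cong λ m →
      trans (cong isTrue (lookup∘tabulate _ m)) (isTrue-entryIf (adj? (graph net) i m) (At.dom? net m))))
    (mapC (λ (i , b , t) → if b then i else choose (tabulate λ m → isTrue (lookup t m)) i)
      (within z≤n self ⊗ later 1 domC ⊗ neighbours domC))

  row₀C : Computes 8 λ net i → tabulate (weight (At.w net 0) i)
  row₀C = cast (λ net a → tabulate-cong λ b → cong (1 ⊓_) (lookup∘tabulate _ b))
    (mapC (λ t → tabulate λ b → 1 ⊓ lookup t b)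
      (contractC 1 1 (λ net {i} {j} 0<a → step (𝟙-positive (adj? (graph net) i j) 0<a) here) At.centre-near
        (within (s≤s z≤n) adjacencyC) centreC))
    where
    adjacencyC : Computes 1 λ net i → tabulate (adj (graph net) i)
    adjacencyC = cast (λ net i → tabulate-cong λ j → cong (λ b → if b then 1 else 0) (lookup∘tabulate _ j))
      (mapC (λ t → tabulate λ j → if lookup t j then 1 else 0) rowC)

  time : ℕ → ℕ
  time = levelTime L

  module NextLevel (j : ℕ) (rowsC : Computes (time j) λ net i → tabulate (weight (At.w net j) i))
    (clusterC : Computes (time j) λ net → At.cluster net j) where

    private
      q = reach j

    edge-near : ∀ net {a b} → 0 < weight (At.w net j) a b → Within (graph net) q a b
    edge-near net = At.Invariant.near-edge net (At.invariant net j)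

    pointer : Local (Fin N)
    pointer net i = heaviest (tabulate (weight (At.w net j) i)) i

    stay-or-edge : ∀ net {i i′} → i′ ≡ i ⊎ 0 < weight (At.w net j) i i′ → Within (graph net) q i i′
    stay-or-edge net (inj₁ refl) = here
    stay-or-edge net (inj₂ 0<w)  = edge-near net 0<w

    pointer-near : ∀ net i → Within (graph net) q i (pointer net i)
    pointer-near net i = stay-or-edge net (towardsHeaviest (At.w net j) i)

    pointerC : Computes (time j) pointer
    pointerC = mapC (λ (row , i) → heaviest row i) (rowsC ⊗ within z≤n self)

    colour : ℕ → Local ℕ
    colour m net = Colouring.colour (pointer net) m

    colourC : ∀ m → Computes (m * q + time j) (colour m)
    colourC zero    = within z≤n (mapC toℕ self)
    colourC (suc m) = within (≤-reflexive (sym (+-assoc q (m * q) (time j))))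
      (mapC (λ (i , pi , c , c′) → if does (pi Fin.≟ i) then lowBit c else reduceColour c c′)
        (within z≤n self ⊗ later q (later (m * q) pointerC) ⊗ later q (colourC m)
          ⊗ fetch q (colourC m) (later (m * q) pointerC) pointer-near))

    coloured : ℕ
    coloured = L * q + time j

    load : Local ℕ
    load net i = weight (At.w net j) i (pointer net i)

    loadC : Computes coloured load
    loadC = later (L * q) (cast (λ net i → lookup∘tabulate _ (pointer net i)) (mapC (λ (row , p) → lookup row p) (rowsC ⊗ pointerC)))

    label : ℕ → Local (Maybe Bool)
    label m net = Labelling.label (pointer net) (load net) (colour L net) m

    labelC : ∀ m → Computes (m * q + coloured) (label m)
    labelC zero    = within z≤n (mapC (λ _ → nothing) self)
    labelC (suc m) = within (≤-reflexive (sym (+-assoc q (m * q) coloured)))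
      (mapC (λ (c , o , l , t , old) → if does (c ≟ m) then just (decide (o * receiving l) (Vec.head t)) else old)
        (upto (colourC L) ⊗ upto loadC ⊗ fetch q (labelC m) (later (m * q) (later (L * q) pointerC)) pointer-near
          ⊗ incomingC ⊗ later q (labelC m)))
      where
      upto : ∀ {X : Set} {f : Local X} → Computes coloured f → Computes (q + (m * q + coloured)) f
      upto c = later q (later (m * q) c)
      -- A single sum, presented as a row with one entry to fit `gatherSum`.
      incomingC : Computes (q + (m * q + coloured)) λ net i → tabulate {n = 1} λ _ → ∑ λ i′ →
        (load net i′ * sending (label m net i′)) when (pointer net i′ Fin.≟ i)
      incomingC = gatherSum q (λ _ i (p , o , l) → (o * sending l) when (p Fin.≟ i))
        (later (m * q) (later (L * q) pointerC) ⊗ later (m * q) loadC ⊗ labelC m) (within z≤n self)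
        λ net i i′ _ ¬π → when-false _ (pointer net i′ Fin.≟ i) λ p≡i →
          ¬π (within-sym (graph net) (subst (Within (graph net) q i′) p≡i (pointer-near net i′)))

    merged : ℕ
    merged = q + (palette * q + coloured)

    starC : Computes merged λ net → starMap L (At.w net j)
    starC = mapC (λ (i , p , l , l′) → if does (joinedLabels? l l′) then p else i)
      (within z≤n self ⊗ later q pC ⊗ later q (labelC palette) ⊗ fetch q (labelC palette) pC pointer-near)
      where
      pC : Computes (palette * q + coloured) pointer
      pC = later (palette * q) (later (L * q) pointerC)

    star-near : ∀ net i → Within (graph net) q i (starMap L (At.w net j) i)
    star-near net i = stay-or-edge net (starMap-move L N≤ (At.w net j) i)

    nextRowsC : Computes (time (suc j)) λ net i → tabulate (weight (At.w net (suc j)) i)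
    nextRowsC = contractC q q edge-near star-near
      (later q (later (palette * q) (later (L * q) rowsC))) starC

    nextClusterC : Computes (time (suc j)) λ net → At.cluster net (suc j)
    nextClusterC = within (+-mono-≤ (≤-trans (m≤m+n (radius j) _) (n≤1+n _)) (m≤n+m merged q))
      (fetch (radius j) starC (later q (later (palette * q) (later (L * q) clusterC)))
        λ net → At.Invariant.near (At.invariant net j))

  levelsC : ∀ j → Computes (time j) (λ net i → tabulate (weight (At.w net j) i)) × Computes (time j) (λ net → At.cluster net j)
  levelsC zero    = row₀C , later 2 centreC
  levelsC (suc j) = NextLevel.nextRowsC j (proj₁ (levelsC j)) (proj₂ (levelsC j)) ,
                    NextLevel.nextClusterC j (proj₁ (levelsC j)) (proj₂ (levelsC j))

  private
    ρ = radius levels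

  -- Vertices farther than `ρ` from `a` are not in its cluster, so their entries are `nothing`
  -- anyway.
  optimumC : Computes (ρ + (k + time levels)) At.optimum
  optimumC = cast (λ net a → cong smallestHitting (tabulate-cong λ v → correct′ net a v))
    (mapC (λ (a , t) → smallestHitting (tabulate λ v → restrictEntry a (lookup t v)))
      (within z≤n self ⊗ gather ρ (within z≤n presence ⊗ later k (proj₂ (levelsC levels)) ⊗ ballC)))
    where
    ballC : Computes (k + time levels) At.ball
    ballC = within (+-monoʳ-≤ k z≤n) (cast (λ net v → tabulate-cong λ u →
        trans (cong is-just (lookup∘tabulate _ u)) (is-just-entryIf (within? (graph net) k v u)))
      (mapC (λ t → tabulate λ u → is-just (lookup t u)) (gather k self)))
    restrictEntry : Fin N → Maybe (Bool × Fin N × Vec Bool N) → Maybe (Vec Bool N)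
    restrictEntry a nothing            = nothing
    restrictEntry a (just (v , l , b)) = if v ∧ does (l Fin.≟ a) then just b else nothing
    correct′ : ∀ net a v →
      restrictEntry a (lookup (ball ρ (λ net v → does (present? net v) , At.cluster net levels v , At.ball net v) net a) v) ≡ At.entry net a v
    correct′ net a v = trans (cong (restrictEntry a) (lookup∘tabulate _ v)) (go (within? (graph net) ρ a v))
      where
      go : (w : Dec (Within (graph net) ρ a v)) →
           restrictEntry a (entryIf w (does (present? net v) , At.cluster net levels v , At.ball net v)) ≡ At.entry net a v
      go (yes _) = refl
      go (no ¬π) = sym (entryIf-false (present? net v ×-dec (At.cluster net levels v Fin.≟ a)) λ (_ , ℓv≡a) →
        ¬π (within-sym (graph net) (subst (Within (graph net) ρ v) ℓv≡a (At.Invariant.near (At.invariant net levels) v))))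

  selectedC : Computes (totalTime k levels L) λ net i → does (At.selected? net i)
  selectedC = cast (λ net i → does-⇔ (mk⇔ (to net i) (from net i)) (chosen? i (table net i)) (At.selected? net i))
    (mapC (λ (i , t) → does (chosen? i t)) (within z≤n self ⊗ gather (k + ρ) optimumC))
    where
    Chosen : Fin N → Maybe (Subset N) → Set
    Chosen i t = ∃[ S ] (t ≡ just S × i ∈ S)
    chosenBy? : ∀ i t → Dec (Chosen i t)
    chosenBy? i nothing = no λ { (_ , () , _) }
    chosenBy? i (just S) with i ∈? S
    ... | yes i∈S = yes (S , refl , i∈S)
    ... | no i∉S  = no λ { (_ , refl , i∈S) → i∉S i∈S }
    chosen? : ∀ i t → Dec (∃[ a ] Chosen i (lookup t a))
    chosen? i t = any? λ a → chosenBy? i (lookup t a)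
    table : ∀ net i → Vec (Maybe (Subset N)) N
    table = ball (k + ρ) At.optimum
    to : ∀ net i → ∃[ a ] Chosen i (lookup (table net i) a) → At.Selected net i
    to net i (a , S , eq , i∈S) with entryIf-just (within? (graph net) (k + ρ) i a) (trans (sym (lookup∘tabulate _ a)) eq)
    ... | π , refl = a , π , i∈S
    from : ∀ net i → At.Selected net i → ∃[ a ] Chosen i (lookup (table net i) a)
    from net i (a , π , i∈) = a , At.optimum net a ,
      trans (lookup∘tabulate _ a) (entryIf-true (within? (graph net) (k + ρ) i a) π) , i∈

-- Numerical estimates

-- A positive rational is at least the reciprocal of its denominator, so `w * ↧ₙ r ≤ b` bounds `w`
-- by `r` times `b`.
approximation-bound : ∀ {a b w} (r : ℚ) → 0ℚ ℚ.< r → a ≤ b + w → w * ↧ₙ r ≤ b → ℕ→ℚ a ℚ.≤ (1ℚ ℚ.+ r) ℚ.* ℕ→ℚ b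
approximation-bound (mkℚ (pos zero)  q _) (ℚ.*<* (+<+ ())) _ _
approximation-bound (mkℚ -[1+ _ ] q _) (ℚ.*<* ()) _ _
approximation-bound {a} {b} {w} r@(mkℚ +[1+ p ] q _) 0<r a≤b+w wq≤b = toℚᵘ-cancel-≤ (begin
  toℚᵘ (ℕ→ℚ a)                                ≃⟨ toℚᵘ-fromℚᵘ (mkℚᵘ (pos a) 0) ⟩
  mkℚᵘ (pos a) 0                               ≤⟨ ℚᵘ.*≤* (subst₂ ℤ._≤_ (pos-* a _)
                                                    (trans (pos-* (X * b) 1) (cong (ℤ._* pos 1) (pos-* X b))) (ℤ.+≤+ core)) ⟩
  (1ℚᵘ ℚᵘ.+ toℚᵘ r) ℚᵘ.* mkℚᵘ (pos b) 0        ≃⟨ ℚᵘₚ.*-cong (toℚᵘ-homo-+ 1ℚ r) (toℚᵘ-fromℚᵘ (mkℚᵘ (pos b) 0)) ⟨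
  toℚᵘ (1ℚ ℚ.+ r) ℚᵘ.* toℚᵘ (ℕ→ℚ b)            ≃⟨ toℚᵘ-homo-* (1ℚ ℚ.+ r) (ℕ→ℚ b) ⟨
  toℚᵘ ((1ℚ ℚ.+ r) ℚ.* ℕ→ℚ b)                  ∎)
  where
  open ℚᵘₚ.≤-Reasoning
  -- The numerator of `1 + r`, in the shape in which unnormalised addition computes it.
  X : ℕ
  X = suc (q + 0) + suc (p * 1)
  core : a * suc ((q + 0) * 1) ≤ X * b * 1
  core = ≤R.begin
    a * suc ((q + 0) * 1)       ≤R.≡⟨ cong (λ z → a * suc z) (trans (*-identityʳ (q + 0)) (+-identityʳ q)) ⟩
    a * suc q                   ≤R.≤⟨ *-monoˡ-≤ (suc q) a≤b+w ⟩
    (b + w) * suc q             ≤R.≡⟨ *-distribʳ-+ (suc q) b w ⟩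
    b * suc q + w * suc q       ≤R.≤⟨ +-monoʳ-≤ (b * suc q) wq≤b ⟩
    b * suc q + b               ≤R.≤⟨ +-monoʳ-≤ (b * suc q) (m≤m+n b (b * p)) ⟩
    b * suc q + (b + b * p)     ≤R.≡⟨ solve 3 (λ b q p → b :* (con 1 :+ q) :+ (b :+ b :* p) :=
                                    ((con 1 :+ (q :+ con 0)) :+ (con 1 :+ p :* con 1)) :* b :* con 1) refl b q p ⟩
    X * b * 1                   ≤R.∎
    where module ≤R = ≤-Reasoning

-- This is `(1 + 1 / e) ^ m ≥ 1 + m / e`, multiplied by `e ^ (m + 1)`.
bernoulli : ∀ e m → (e + m) * e ^ m ≤ e * suc e ^ m
bernoulli e zero    = ≤-reflexive (cong (_* 1) (+-identityʳ e))
bernoulli e (suc m) = begin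
  (e + suc m) * (e * e ^ m)                  ≤⟨ m≤m+n _ (m * e ^ m) ⟩
  (e + suc m) * (e * e ^ m) + m * e ^ m      ≡⟨ solve 3 (λ e m x → (e :+ (con 1 :+ m)) :* (e :* x) :+ m :* x :=
                                                   e :* (e :+ m) :* x :+ (e :+ m) :* x) refl e m (e ^ m) ⟩
  e * (e + m) * e ^ m + (e + m) * e ^ m      ≡⟨ solve 3 (λ e y x → e :* y :* x :+ y :* x := (con 1 :+ e) :* (y :* x)) refl e (e + m) (e ^ m) ⟩
  suc e * ((e + m) * e ^ m)                  ≤⟨ *-monoʳ-≤ (suc e) (bernoulli e m) ⟩
  suc e * (e * suc e ^ m)                    ≡⟨ solve 3 (λ s e x → s :* (e :* x) := e :* (s :* x)) refl (suc e) e (suc e ^ m) ⟩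
  e * suc e ^ suc m                          ∎
  where open ≤-Reasoning

-- For `m = e * B`, Bernoulli's inequality gives the factor `1 + B`.
geometric-gap : ∀ e .{{_ : NonZero e}} B → B * e ^ (e * B) ≤ suc e ^ (e * B)
geometric-gap e B = ≤-trans (*-monoˡ-≤ (e ^ (e * B)) (n≤1+n B)) (*-cancelˡ-≤ e (begin
  e * (suc B * e ^ (e * B))      ≡⟨ *-assoc e (suc B) _ ⟨
  e * suc B * e ^ (e * B)        ≡⟨ cong (_* e ^ (e * B)) (*-suc e B) ⟩
  (e + e * B) * e ^ (e * B)      ≤⟨ bernoulli e (e * B) ⟩
  e * suc e ^ (e * B)            ∎))
  where open ≤-Reasoning

lower<upper : ∀ (α : ℝ) {r q} → lower α r → upper α q → r ℚ.< q
lower<upper α {r} {q} r<α α<q with ℚₚ.<-cmp r q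
... | tri< r<q _ _    = r<q
... | tri≈ _ refl _   = contradiction (r<α , α<q) (disjoint α q)
... | tri> _ _ q<r    = contradiction (Equivalence.from (lower-rounded α q) (r , q<r , r<α) , α<q) (disjoint α q)

sparse-suc : ∀ {n d} {G : Graph n} → Sparse d G → Sparse (suc d) G
sparse-suc {d = d} sparse conn L? = ≤-trans (sparse conn L?) (*-monoˡ-≤ (# L?) (n≤1+n d))

-- The LOCAL model

-- The message type cannot depend on the round, so views travel with their depth. Vertices run in
-- step, hence the depths match and nothing is lost.
sameRound : ∀ {N} r → ∃ (View N) → Maybe (View N r)
sameRound r (r′ , v) with r′ ≟ r
... | yes refl = just v
... | no _     = nothing

sameRound-refl : ∀ {N} r (v : View N r) → sameRound r (r , v) ≡ just v
sameRound-refl r v with r ≟ r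
... | yes refl = refl
... | no r≢r   = contradiction refl r≢r

result : ∀ {N R} → (View N R → Bool) → ∀ r → View N r → Dec (r ≡ R) → Maybe Bool
result f r v (yes refl) = just (f v)
result f r v (no _)     = nothing

gathering : ∀ {N} R → (View N R → Bool) → Algorithm Bool N
gathering {N} R f = record
  { State   = ∃ (View N)
  ; Message = ∃ (View N)
  -- The flag is `true` since every vertex that runs the algorithm is present.
  ; init    = λ i → 0 , i , true
  ; send    = λ s _ → s
  ; receive = λ (r , v) inbox → suc r , v , tabulate λ j → inbox j Maybe.>>= sameRound r
  ; output  = λ (r , v) → result f r v (r ≟ R)
  }

module Simulation {N n d} (G : Graph n) (ident : Fin n ↣ Fin N) (sparse-image : Sparse d (image (Injection.to ident) G)) where

  open Injection ident using () renaming (to to idOf; injective to idOf-injective)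

  net : Network N d
  net = record
    { graph    = image idOf G
    ; Present  = λ i → ∃[ u ] idOf u ≡ i
    ; present? = λ i → any? λ u → idOf u Fin.≟ i
    ; endpoint = λ (_ , u , _ , idu , _) → u , idu
    ; sparse   = sparse-image
    }

  open Computation N d

  edge⁺ : ∀ {u v} → Adj G u v → Adj (graph net) (idOf u) (idOf v)
  edge⁺ {u} {v} uv = (λ eq → adj-irrefl G (idOf-injective eq) uv) , u , v , refl , refl , uv

  edge⁻ : ∀ {u j} → Adj (graph net) (idOf u) j → ∃[ v ] (idOf v ≡ j × Adj G u v)
  edge⁻ (_ , u′ , v , idu , idv , uv) = v , idv , subst (λ x → Adj G x v) (idOf-injective idu) uv

  within⁺ : ∀ {k u v} → Within G k u v → Within (graph net) k (idOf u) (idOf v)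
  within⁺ here        = here
  within⁺ (step e π) = step (edge⁺ e) (within⁺ π)

  within⁻ : ∀ {k u j} → Within (graph net) k (idOf u) j → ∃[ v ] (idOf v ≡ j × Within G k u v)
  within⁻ here = _ , refl , here
  within⁻ (step e π) with edge⁻ e
  ... | w , refl , uw with within⁻ π
  ...   | v , idv , ρ = v , idv , step uw ρ

  module _ (R : ℕ) (f : View N R → Bool) where

    private A = gathering R f
    open Algorithm A

    inbox-spec : ∀ s v j → (∃[ u ] (Adj G v u × idOf u ≡ j × inbox A G ident s v j ≡ just (s u))) ⊎
                           (¬ (∃[ u ] (Adj G v u × idOf u ≡ j)) × inbox A G ident s v j ≡ nothing)
    inbox-spec s v j with any? (λ u → adj? G v u ×-dec (idOf u Fin.≟ j))
    ... | yes (u , vu , idu) = inj₁ (u , vu , idu , refl)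
    ... | no ¬∃              = inj₂ (¬∃ , refl)

    received : ∀ r s v → (∀ u → s u ≡ (r , view net r (idOf u))) →
               receive (s v) (inbox A G ident s v) ≡ (suc r , view net (suc r) (idOf v))
    received r s v eq = trans (cong (λ z → receive z (inbox A G ident s v)) (eq v))
      (cong (λ t → suc r , view net r (idOf v) , t) (tabulate-cong entry))
      where
      entry : ∀ j → (inbox A G ident s v j Maybe.>>= sameRound r) ≡ entryIf (adj? (graph net) (idOf v) j) (view net r j)
      entry j with inbox-spec s v j
      ... | inj₁ (u , vu , refl , got) = trans (cong (Maybe._>>= sameRound r) (trans got (cong just (eq u))))
        (trans (sameRound-refl r _) (sym (entryIf-true (adj? (graph net) (idOf v) (idOf u)) (edge⁺ vu))))
      ... | inj₂ (¬∃ , got) = trans (cong (Maybe._>>= sameRound r) got)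
        (sym (entryIf-false (adj? (graph net) (idOf v) j) λ e → ¬∃ (case edge⁻ e of λ (u , idu , vu) → u , vu , idu)))

    running : ∀ m v → output (stateAfter A G ident m v) ≡ nothing →
              stateAfter A G ident (suc m) v ≡ receive (stateAfter A G ident m v) (inbox A G ident (stateAfter A G ident m) v)
    running m v eq with output (stateAfter A G ident m v)
    ... | nothing = refl

    halted : ∀ m v {b} → output (stateAfter A G ident m v) ≡ just b →
             stateAfter A G ident (suc m) v ≡ stateAfter A G ident m v
    halted m v eq with output (stateAfter A G ident m v)
    ... | just _ = refl

    gathered : ∀ m → m ≤ R → ∀ v → stateAfter A G ident m v ≡ (m , view net m (idOf v))
    gathered zero    _   v = cong (λ b → 0 , idOf v , b) (sym (dec-true (present? net (idOf v)) (v , refl)))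
    gathered (suc m) m<R v = trans
      (running m v (trans (cong output (gathered m (<⇒≤ m<R) v)) (waiting (m ≟ R))))
      (received m (stateAfter A G ident m) v (gathered m (<⇒≤ m<R)))
      where
      waiting : (d : Dec (m ≡ R)) → result f m (view net m (idOf v)) d ≡ nothing
      waiting (yes refl) = contradiction m<R (<-irrefl refl)
      waiting (no _)     = refl

    -- Halting freezes the state, so the answer still stands at any later `T`. This allows `R` to
    -- depend on `N` while the claimed time depends on `n`.
    outputs : ∀ {T} → R ≤ T → ∀ v → outputAfter A G ident T v ≡ just (f (view net R (idOf v)))
    outputs {T} R≤T v = subst (λ T → outputAfter A G ident T v ≡ just (f (view net R (idOf v)))) (m∸n+n≡m R≤T) (go (T ∸ R))
      where
      ready : (d : Dec (R ≡ R)) → result f R (view net R (idOf v)) d ≡ just (f (view net R (idOf v)))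
      ready (yes refl) = refl
      ready (no R≢R)   = contradiction refl R≢R
      go : ∀ m → outputAfter A G ident (m + R) v ≡ just (f (view net R (idOf v)))
      go zero    = trans (cong output (gathered R ≤-refl v)) (ready (R ≟ R))
      go (suc m) = trans (cong output (halted (m + R) v (go m))) (go m)

  module _ (S : Subset n) where

    Image : Pred (Fin N) 0ℓ
    Image i = ∃[ u ] (u ∈ S × idOf u ≡ i)

    image? : Decidable Image
    image? i = any? λ u → (u ∈? S) ×-dec (idOf u Fin.≟ i)

    image≤ : # image? ≤ ∣ S ∣
    image≤ = begin
      # image?                        ≤⟨ #-⋃ image? (λ u i → (u ∈? S) ×-dec (idOf u Fin.≟ i)) (λ _ → id) ⟩
      ∑ (λ u → ∑ λ i → 𝟙 ((u ∈? S) ×-dec (idOf u Fin.≟ i)))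
                                      ≡⟨ ∑-cong (λ u → trans (∑-cong λ i → trans (𝟙-× (u ∈? S) (idOf u Fin.≟ i)) (*-comm (𝟙 (u ∈? S)) _))
                                           (∑-single′ (idOf u) λ _ → 𝟙 (u ∈? S))) ⟩
      # (_∈? S)                       ≡⟨ ∣ S ∣≡# ⟨
      ∣ S ∣                           ∎
      where open ≤-Reasoning

    image-dominates : ∀ {k} → IsDominating G k S → ∀ {v} → Present net v → ∃[ m ] (Image m × Within (graph net) k v m)
    image-dominates dom (x , refl) with dom x
    ... | u , u∈S , xu = idOf u , (u , u∈S , refl) , within⁺ xu

  module _ {P : Pred (Fin N) 0ℓ} (P? : Decidable P) where

    preimage : Subset n
    preimage = subsetOf (λ u → P? (idOf u))

    preimage≤ : ∣ preimage ∣ ≤ # P?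
    preimage≤ = begin
      ∣ preimage ∣                                       ≡⟨ ∣subsetOf∣ (λ u → P? (idOf u)) ⟩
      ∑ (λ u → 𝟙 (P? (idOf u)))                          ≡⟨ ∑-cong (λ u → ∑-single′ (idOf u) λ i → 𝟙 (P? i)) ⟨
      ∑ (λ u → ∑ λ i → 𝟙 (idOf u Fin.≟ i) * 𝟙 (P? i))    ≡⟨ ∑-swap _ ⟩
      ∑ (λ i → ∑ λ u → 𝟙 (idOf u Fin.≟ i) * 𝟙 (P? i))    ≡⟨ ∑-cong (λ i → trans (∑-cong λ u → *-comm _ (𝟙 (P? i))) (sym (*-∑ (𝟙 (P? i)) _))) ⟩
      ∑ (λ i → 𝟙 (P? i) * # (λ u → idOf u Fin.≟ i))      ≤⟨ ∑-mono (λ i → *-monoʳ-≤ (𝟙 (P? i)) (atMostOne i)) ⟩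
      ∑ (λ i → 𝟙 (P? i) * 1)                             ≡⟨ ∑-cong (λ i → *-identityʳ (𝟙 (P? i))) ⟩
      # P?                                               ∎
      where
      open ≤-Reasoning
      atMostOne : ∀ i → # (λ u → idOf u Fin.≟ i) ≤ 1
      atMostOne i with any? (λ u → idOf u Fin.≟ i)
      ... | yes (u , refl) = #≤length (λ w → idOf w Fin.≟ idOf u) (u ∷ []) λ w idw → here (idOf-injective idw)
      ... | no ¬∃          = ≤-trans (#≤length (λ w → idOf w Fin.≟ i) [] λ w idw → contradiction (w , idw) ¬∃) z≤n

image-sparse : ∀ {n N} t {G : Graph n} (ident : Fin n ↣ Fin N) → CompleteMinorFree (suc t) G →
               Sparse (density t) (image (Injection.to ident) G)
image-sparse t {G} ident minorFree = modelFree⇒sparse t {image (Injection.to ident) G} λ M → minorFree (modelIsMinor {G = G}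
  (liftModel (Injection.to ident) (λ eq → case Injection.injective ident eq of λ { refl → stop refl }) proj₂ M))

-- The dominating set and its size

module Solution {n N d} (G : Graph n) (ident : Fin n ↣ Fin N) (sparse-image : Sparse d (image (Injection.to ident) G))
  (L : ℕ) (N≤ : N ≤ tower L) (levels k : ℕ) (1≤k : 1 ≤ k) where

  open Injection ident using () renaming (to to idOf)
  open Simulation {d = d} G ident sparse-image
  open Stages N d L N≤ levels k 1≤k using (module At; selectedC)

  solution : Subset n
  solution = preimage (At.selected? net)

  found : ∀ {T} → totalTime k levels L ≤ T →
          FindsInRounds solution T (gathering (totalTime k levels L) (Computation.Computes.code selectedC)) G ident
  found time≤T v = trans (outputs _ (Computation.Computes.code selectedC) time≤T v)
    (cong just (trans (Computation.Computes.correct selectedC net (idOf v)) (sym (lookup∘tabulate _ v))))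

  optimal : ∀ j → ∃[ S ] (IsDominating G j S × ∣ S ∣ ≡ γ j G)
  optimal j = proj₁ (proj₂ (minimumSize j G))

  best : ℕ → Subset n
  best j = proj₁ (optimal j)

  best-dominates : ∀ j {v} → Present net v → ∃[ m ] (Image (best j) m × Within (graph net) j v m)
  best-dominates j = image-dominates (best j) (proj₁ (proj₂ (optimal j)))

  best≤ : ∀ j → # (image? (best j)) ≤ γ j G
  best≤ j = ≤-trans (image≤ (best j)) (≤-reflexive (proj₂ (proj₂ (optimal j))))

  solution-dominates : IsDominating G k solution
  solution-dominates v = pull-back (At.covers-within net (image? (best k)) (best-dominates k) (v , refl))
    where
    pull-back : ∃[ i ] (At.Selected net i × Within (graph net) k (idOf v) i) → ∃[ u ] (u ∈ solution × Within G k v u)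
    pull-back (i , sel , π) = case within⁻ π of λ where
      (u , idu , ρ) → u , ∈subsetOf⁺ (λ u → At.selected? net (idOf u)) (subst (At.Selected net) (sym idu) sel) , ρ

  excess : ℕ
  excess = double (weight (At.w net levels))

  solution≤ : ∣ solution ∣ ≤ γ k G + excess
  solution≤ = ≤-trans (preimage≤ (At.selected? net))
    (≤-trans (At.selected≤boundary net (image? (best k)) (best-dominates k)) (+-monoˡ-≤ excess (best≤ k)))

  excess-decays : ∀ e → 4 * d ≡ suc e → suc e ^ levels * excess ≤ e ^ levels * (d * (Constants.approx d * γ 1 G))
  excess-decays e eq = ≤-trans (At.boundary-decay net e eq (image? (best 1)) dominated)
    (*-monoʳ-≤ (e ^ levels) (*-monoʳ-≤ d (*-monoʳ-≤ (Constants.approx d) (best≤ 1))))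
    where
    dominated : ∀ {v} → Present net v → Image (best 1) v ⊎ ∃[ m ] (Adj (graph net) v m × Image (best 1) m)
    dominated pv with best-dominates 1 pv
    ... | m , im , here        = inj₁ im
    ... | m , im , step e here = inj₂ (m , e , im)

-- By Bernoulli's inequality this number of levels makes (e / (1 + e)) ^ levels small enough.
few-excess : ∀ e .{{_ : NonZero e}} {q d a C g₁ gₖ w} → g₁ ≤ C * gₖ →
  let levels = e * (q * (d * (a * C))) in
  suc e ^ levels * w ≤ e ^ levels * (d * (a * g₁)) → w * q ≤ gₖ
few-excess e {q} {d} {a} {C} {g₁} {gₖ} {w} g₁≤ decays = *-cancelˡ-≤ (suc e ^ levels) {{m^n≢0 (suc e) levels}} (begin
  suc e ^ levels * (w * q)                 ≡⟨ *-assoc (suc e ^ levels) w q ⟨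
  suc e ^ levels * w * q                   ≤⟨ *-monoˡ-≤ q decays ⟩
  e ^ levels * (d * (a * g₁)) * q          ≤⟨ *-monoˡ-≤ q (*-monoʳ-≤ (e ^ levels) (*-monoʳ-≤ d (*-monoʳ-≤ a g₁≤))) ⟩
  e ^ levels * (d * (a * (C * gₖ))) * q    ≡⟨ solve 6 (λ x d a c g q → x :* (d :* (a :* (c :* g))) :* q := (q :* (d :* (a :* c))) :* x :* g)
                                                refl (e ^ levels) d a C gₖ q ⟩
  q * (d * (a * C)) * e ^ levels * gₖ      ≤⟨ *-monoˡ-≤ gₖ (geometric-gap e (q * (d * (a * C)))) ⟩
  suc e ^ levels * gₖ                      ∎)
  where
  open ≤-Reasoning
  levels = e * (q * (d * (a * C)))

ℕ→ℚ-nonNegative : ∀ m → 0ℚ ℚ.≤ ℕ→ℚ m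
ℕ→ℚ-nonNegative m = toℚᵘ-cancel-≤ (ℚᵘₚ.≤-respʳ-≃ (ℚᵘₚ.≃-sym (toℚᵘ-fromℚᵘ (mkℚᵘ (pos m) 0)))
  (ℚᵘ.*≤* (subst (ℤ._≤_ (pos 0)) (pos-* m 1) (ℤ.+≤+ z≤n))))

-- The real `α` enters only through one positive rational `r` below it, which is smaller than each
-- `q` above `α`.
within-factor : ∀ (α : ℝ) {r} → 0ℚ ℚ.< r → lower α r → ∀ {a b w} → a ≤ b + w → w * ↧ₙ r ≤ b → a ≤[1+ α ] b
within-factor α {r} 0<r r<α {b = b} a≤ w≤ q α<q = ℚₚ.≤-trans (approximation-bound r 0<r a≤ w≤)
  (ℚₚ.*-monoʳ-≤-nonNeg (ℕ→ℚ b) {{ℚ.nonNegative (ℕ→ℚ-nonNegative b)}}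
    (ℚₚ.+-monoʳ-≤ 1ℚ (ℚₚ.<⇒≤ (lower<upper α r<α α<q))))

timeBound : ℕ → ℕ → ℕ → ℕ → ℕ
timeBound k levels c n =
  slope levels * (c + log* n) + ((k + radius levels) + (radius levels + (k + offset levels)))

totalTime≤ : ∀ k levels {n N c} → N ≤ n ^ c → totalTime k levels (log* N) ≤ timeBound k levels c n
totalTime≤ k levels {n} {N} {c} N≤ = begin
  totalTime k levels (log* N)           ≡⟨ cong (λ z → (k + ρ) + (ρ + (k + z))) (levelTime-linear (log* N) levels) ⟩
  (k + ρ) + (ρ + (k + (slope levels * log* N + offset levels)))
                                        ≡⟨ solve 4 (λ k ρ x o → (k :+ ρ) :+ (ρ :+ (k :+ (x :+ o))) := x :+ ((k :+ ρ) :+ (ρ :+ (k :+ o))))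
                                             refl k ρ (slope levels * log* N) (offset levels) ⟩
  slope levels * log* N + _             ≤⟨ +-monoˡ-≤ _ (*-monoʳ-≤ (slope levels) (log*-^ n c N≤)) ⟩
  timeBound k levels c n                ∎
  where
  open ≤-Reasoning
  ρ = radius levels

timeBound∈O : ∀ k levels c → timeBound k levels c ∈O log*
-- From `n = 2` on, `log* n` is positive and absorbs the constants.
timeBound∈O k levels c = a * suc c + b , 2 , bound
  where
  a = slope levels
  b = (k + radius levels) + (radius levels + (k + offset levels))
  bound : ∀ n → 2 ≤ n → a * (c + log* n) + b ≤ (a * suc c + b) * log* n
  bound (suc zero) (s≤s ())
  bound n@(suc (suc _)) _ = begin
    a * (c + l) + b            ≤⟨ +-mono-≤ (*-monoʳ-≤ a (+-monoˡ-≤ l (m≤m*n c l))) (m≤m*n b l) ⟩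
    a * (c * l + l) + b * l    ≡⟨ solve 4 (λ s c o l → s :* (c :* l :+ l) :+ o :* l := (s :* (con 1 :+ c) :+ o) :* l) refl a c b l ⟩
    (a * suc c + b) * l        ∎
    where
    open ≤-Reasoning
    l = log* n

theorem19 : (C k t : ℕ) .{{_ : NonZero C}} .{{_ : NonZero k}} .{{_ : NonZero t}} →
    (α : ℝ) → 0ℚ <ᴿ α → α ᴿ< 1ℚ →
    (c : ℕ) →
    Σ[ A ∈ ((N : ℕ) → Algorithm Bool N) ]
    Σ[ T ∈ (ℕ → ℕ) ]
    (T ∈O log*) ×
    (∀ {n} (G : Graph n) → CompleteMinorFree t G → DominationBounded C k G →
    ∀ {N} → N ≤ n ^ c → (ident : Fin n ↣ Fin N) →
    Σ[ D ∈ Subset n ]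
    (FindsInRounds D (T n) (A N) G ident ×
    IsDominating G k D ×
    (∣ D ∣ ≤[1+ α ] γ k G)))
theorem19 C k (suc t) α 0<α _ c =
  -- A vertex knows `N` but not `n`, so the number of colour reductions is `log* N`.
  (λ N → gathering (totalTime k levels (log* N)) (code N)) , timeBound k levels c , timeBound∈O k levels c , correctness
  where
  positive-below : ∃[ r ] (0ℚ ℚ.< r × lower α r)
  positive-below = Equivalence.to (lower-rounded α 0ℚ) 0<α
  r = proj₁ positive-below
  -- The successor keeps `d` positive, as `density 0` is 0; then `4 * d` is `suc e` with `e`
  -- nonzero.
  d = suc (density t)
  e = density t + 3 * d
  -- The second factor is the `B` of `geometric-gap`: it outweighs the initial excess, at most
  -- `d * approx * C` times the optimum, and the denominator of `r`.
  levels = e * (↧ₙ r * (d * (Constants.approx d * C)))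
  1≤k : 1 ≤ k
  1≤k = >-nonZero⁻¹ k
  e-nonZero : NonZero e
  e-nonZero = >-nonZero (≤-trans (s≤s z≤n) (m≤n+m (3 * d) (density t)))

  code : ∀ N → View N (totalTime k levels (log* N)) → Bool
  code N = Computation.Computes.code (Stages.selectedC N d (log* N) (≤tower-log* N) levels k 1≤k)

  correctness : ∀ {n} (G : Graph n) → CompleteMinorFree (suc t) G → DominationBounded C k G →
    ∀ {N} → N ≤ n ^ c → (ident : Fin n ↣ Fin N) →
    Σ[ D ∈ Subset n ] (FindsInRounds D (timeBound k levels c n) (gathering (totalTime k levels (log* N)) (code N)) G ident ×
      IsDominating G k D × (∣ D ∣ ≤[1+ α ] γ k G))
  correctness G minorFree bounded {N} N≤ ident =
    solution , found (totalTime≤ k levels {c = c} N≤) , solution-dominates ,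
    within-factor α (proj₁ (proj₂ positive-below)) (proj₂ (proj₂ positive-below)) solution≤
      (few-excess e {{e-nonZero}} {↧ₙ r} {d} {Constants.approx d} {C} bounded (excess-decays e refl))
    where
    sparse-image : Sparse d (image (Injection.to ident) G)
    sparse-image = sparse-suc {d = density t} {image (Injection.to ident) G} (image-sparse t {G} ident minorFree)
    open Solution {d = d} G ident sparse-image (log* N) (≤tower-log* N) levels k 1≤k
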